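{- The labelled transition system of typing derivations of $\pi$LL enjoys non-interference: for every derivation $D$ and all action labels $l_1,l_2\in$ Act with $\mathrm{fn}(l_1)\cap\mathrm{fn}(l_2)=\emptyset$, if $D\xrightarrow{l_1}D_1$ for some $D_1$ and $D\xrightarrow{l_2}D_2$ for some $D_2$, then $D\xrightarrow{l_1\parallel l_2}D'$ for some $D'$.
   Context: **Syntax.** Names $x,y,z,\ldots$ are drawn from an infinite set with decidable equality; $X$ ranges over type variables. Types: $A,B::=A\otimes B\mid A\wp B\mid 1\mid\bot\mid A\oplus B\mid A\&B\mid X\mid X^\perp\mid\exists X.A\mid\forall X.A\mid{?}A\mid{!}A$ ($\wp$ is the "par" connective). Processes: $P,Q::=x[y].P\mid x(y).P\mid x[].P\mid x().P\mid x[\mathsf{inl}].P\mid x[\mathsf{inr}].P\mid x\triangleright(P,Q)\mid x[A].P\mid x(X).P\mid{!}x(y).P\mid{?}x[y].P\mid{?}x[x_1,x_2].P\mid{?}x[].P\mid(\nu xy)P\mid P\parallel Q\mid\mathbf 0\mid x\leftrightarrow y$. Names written inside $[\cdot]$ or $(\cdot)$ of a prefix are bound in its continuation, $x,y$ are bound in $(\nu xy)P$, $X$ is bound in $x(X).P$; free names $\mathrm{fn}(P)$ and $=_\alpha$ are as usual, and $(\nu xy)P$ is identified with $(\nu yx)P$. **Typing.** Duality is the involution with $(A\otimes B)^\perp=A^\perp\wp B^\perp$, $1^\perp=\bot$, $(A\oplus B)^\perp=A^\perp\&B^\perp$, $({?}A)^\perp={!}A^\perp$, $(\exists X.A)^\perp=\forall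 X.A^\perp$, $(X)^\perp=X^\perp$, and symmetrically. An environment $\Gamma,\Delta,\ldots$ is a finite unordered list $x_1:A_1,\ldots,x_k:A_k$ of distinct names with types; "," joins environments with disjoint names. A hyperenvironment $\mathcal G=\Gamma_1\parallel\cdots\parallel\Gamma_n$ is a finite multiset of environments, all names distinct; $\emptyset$ is the hyperenvironment with no environments ("," binds tighter than $\parallel$). ${?}\Gamma$ denotes an environment all of whose types have the form ${?}A$. Typing rules (premises $\Rightarrow$ conclusion): (Ax) $\vdash x\leftrightarrow y::x:A^\perp,y:A$. (Cut) $\vdash P::\mathcal G\parallel\Gamma,x:A\parallel\Delta,y:A^\perp\Rightarrow\ \vdash(\nu xy)P::\mathcal G\parallel\Gamma,\Delta$. (Mix) $\vdash P::\mathcal G$ and $\vdash Q::\mathcal H\Rightarrow\ \vdash P\parallel Q::\mathcal G\parallel\mathcal H$. (Mix$_0$) $\vdash\mathbf 0::\emptyset$. ($\otimes$) $\vdash P::\Gamma,y:A\parallel\Delta,x:B\Rightarrow\ \vdash x[y].P::\Gamma,\Delta,x:A\otimes B$. (1) $\vdash P::\emptyset\Rightarrow\ \vdash x[].P::x:1$. ($\wp$) $\vdash P::\Gamma,y:A,x:B\Rightarrow\ \vdash x(y).P::\Gamma,x:A\wp B$. ($\bot$) $\vdash P::\Gamma\Rightarrow\ \vdash x().P::\Gamma,x:\bot$. ($\oplus_1$) $\vdash P::\Gamma,x:A\Rightarrow\ \vdash x[\mathsf{inl}].P::\Gamma,x:A\oplus B$. ($\oplus_2$) $\vdash P::\Gamma,x:B\Rightarrow\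 \vdash x[\mathsf{inr}].P::\Gamma,x:A\oplus B$. ($\&$) $\vdash P::\Gamma,x:A$ and $\vdash Q::\Gamma,x:B\Rightarrow\ \vdash x\triangleright(P,Q)::\Gamma,x:A\&B$. (!) $\vdash P::{?}\Gamma,y:A\Rightarrow\ \vdash{!}x(y).P::{?}\Gamma,x:{!}A$. (?) $\vdash P::\Gamma,y:A\Rightarrow\ \vdash{?}x[y].P::\Gamma,x:{?}A$. (W) $\vdash P::\Gamma\Rightarrow\ \vdash{?}x[].P::\Gamma,x:{?}A$. (C) $\vdash P::\Gamma,x_1:{?}A,x_2:{?}A\Rightarrow\ \vdash{?}x[x_1,x_2].P::\Gamma,x:{?}A$. ($\exists$) $\vdash P::\Gamma,x:B\{A/X\}\Rightarrow\ \vdash x[A].P::\Gamma,x:\exists X.B$. ($\forall$) $\vdash P::\Gamma,x:B$, $X$ not free in $\Gamma$ $\Rightarrow\ \vdash x(X).P::\Gamma,x:\forall X.B$. A typing derivation $D$ is a finite tree built with these rules; $\mathrm{proc}(D)$ is the process in its conclusion, and $\mathrm{fn}(D)=\mathrm{fn}(\mathrm{proc}(D))$. Each rule introduces exactly one process constructor, so derivations are written with the same constructors, each denoting the application of the corresponding typing rule to subderivations (e.g. $(\nu xy)D$ ends with Cut applied to $D$, $D\parallel E$ ends with Mix, $x\leftrightarrow y$ is an instance of Ax, $\mathbf 0$ is Mix$_0$). **Labels.** Action labels (Act): $x[]$, $x()$, $x[y]$, $x(y)$, $x[\mathsf{inl}]$, $x(\mathsf{inl})$, $x[\mathsf{inr}]$,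 $x(\mathsf{inr})$, ${?}x[y]$, ${!}x(y)$, ${?}x[x_1,x_2]$, ${!}x(x_1,x_2)$, ${?}x[]$, ${!}x()$, $x[A]$, $x(A)$. Labels: $\tau$, $x\leftrightarrow y$, $l$, and unordered pairs $l\parallel l'$, for $l,l'\in$ Act. In an action label $x$ is free and the names inside brackets are bound; both names of $x\leftrightarrow y$ are free; $\tau$ has no names; $\mathrm{fn},\mathrm{bn}$ of a pair are unions; $\mathrm{cn}(l)=\mathrm{fn}(l)\cup\mathrm{bn}(l)$. **Derivation transitions** (least relation closed under the following, all displayed derivations being valid, substitutions applied throughout a derivation): $\pi.D\xrightarrow{\pi}D$ for $\pi$ of the form $x[y],x(y),x[],x(),x[\mathsf{inl}],x[\mathsf{inr}],x[A],{?}x[y],{!}x(y)$; $x\triangleright(D,E)\xrightarrow{x(\mathsf{inl})}D$; $x\triangleright(D,E)\xrightarrow{x(\mathsf{inr})}E$; $x(X).D\xrightarrow{x(A)}D\{A/X\}$; ${?}x[].D\xrightarrow{{?}x[]}x().D$; ${?}x[x_1,x_2].D\xrightarrow{{?}x[x_1,x_2]}x_1(x_2).D$; ${!}x(x').D\xrightarrow{{!}x()}{?}z_1[].\cdots{?}z_n[].x[].\mathbf 0$ if $\mathrm{fn}(D)\setminus\{x'\}=\{z_1,\ldots,z_n\}$; ${!}x(x').D\xrightarrow{{!}x(x_1,x_2)}{?}z_1[z_1\sigma_1,z_1\sigma_2].\cdots{?}z_n[z_n\sigma_1,z_n\sigma_2].x_1[x_2].({!}x_1(x'\sigma_1).D\sigma_1\parallel{!}x_2(x'\sigma_2).D\sigma_2)$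 if $\sigma_1,\sigma_2$ are name substitutions with $\mathrm{fn}(D\sigma_1)\cap\mathrm{fn}(D\sigma_2)=\emptyset$ and $\mathrm{fn}(D)\setminus\{x'\}=\{z_1,\ldots,z_n\}$ (in the last two the target has the same types as the source, except $x:1$ in place of $x:{!}A$, resp. $x_1:{!}A\otimes{!}A$ in place of $x:{!}A$); $x\leftrightarrow y\xrightarrow{x\leftrightarrow y}\mathbf 0$ and $x\leftrightarrow y\xrightarrow{y\leftrightarrow x}\mathbf 0$. ($\alpha$) a derivation of $\vdash P::\mathcal G$ has every transition of any derivation of $\vdash Q::\mathcal G$ with $P=_\alpha Q$. (Par) if $D\xrightarrow{l}D'$ and $\mathrm{bn}(l)\cap\mathrm{fn}(E)=\emptyset$ then $D\parallel E\xrightarrow{l}D'\parallel E$; symmetrically on the right. (Syn) if $D\xrightarrow{l}D'$, $E\xrightarrow{l'}E'$, $l,l'\in$ Act, $\mathrm{bn}(l)\cap\mathrm{bn}(l')=\emptyset$ then $D\parallel E\xrightarrow{l\parallel l'}D'\parallel E'$. (Res) if $D\xrightarrow{l}D'$ and $x,y\notin\mathrm{cn}(l)$ then $(\nu xy)D\xrightarrow{l}(\nu xy)D'$, where $D$ has hyperenvironment $\mathcal G\parallel\Gamma,x:A\parallel\Delta,y:A^\perp$ and $D'$ has $\mathcal G'\parallel\Gamma',x:A\parallel\Delta',y:A^\perp$. (Communication) $(\nu xy)D\xrightarrow{\tau}R$ whenever $D\xrightarrow{m}D'$, $D$ has hyperenvironment $\mathcal G\parallel\Gamma,x:C\parallel\Delta,y:C^\perp$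 and one of: $m=x[]\parallel y()$, $C=1$, $\Gamma$ empty, $D'$ has $\mathcal G\parallel\Delta$, $R=D'$; $m=x[x']\parallel y(y')$, $C=A\otimes B$, $\Gamma=\Gamma_1,\Gamma_2$, $D'$ has $\mathcal G\parallel\Gamma_1,x:B\parallel\Gamma_2,x':A\parallel\Delta,y:B^\perp,y':A^\perp$, $R=(\nu xy)(\nu x'y')D'$; $m=x[\mathsf{inl}]\parallel y(\mathsf{inl})$ (resp. $\mathsf{inr}$), $C=A_1\oplus A_2$, $D'$ has $\mathcal G\parallel\Gamma,x:A_i\parallel\Delta,y:A_i^\perp$ with $i=1$ (resp. $2$), $R=(\nu xy)D'$; $m=x[A]\parallel y(A)$, $C=\exists X.B$, $D'$ has $\mathcal G\parallel\Gamma,x:B\{A/X\}\parallel\Delta,y:B^\perp\{A/X\}$, $R=(\nu xy)D'$; $m={?}x[x']\parallel{!}y(y')$, $C={?}A$, $D'$ has $\mathcal G\parallel\Gamma,x':A\parallel\Delta,y':A^\perp$, $R=(\nu x'y')D'$; $m={?}x[x_1,x_2]\parallel{!}y(y_1,y_2)$, $C={?}A$, $\Delta={?}\Delta'$, $D'$ has $\mathcal G\parallel\Gamma,x_1:{?}A\wp{?}A\parallel\Delta,y_1:{!}A^\perp\otimes{!}A^\perp$, $R=(\nu x_1y_1)D'$; $m={?}x[]\parallel{!}y()$, $C={?}A$, $\Delta={?}\Delta'$, $D'$ has $\mathcal G\parallel\Gamma,x:\bot\parallel\Delta,y:1$, $R=(\nu xy)D'$. (Link) if $D\xrightarrow{z\leftrightarrow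 y}D'$ with $z\notin\{x,y\}$, $D$ having hyperenvironment $\mathcal G\parallel z:A^\perp,y:A\parallel\Gamma,x:A^\perp$ and $D'$ having $\mathcal G\parallel\Gamma,x:A^\perp$, then $(\nu xy)D\xrightarrow{\tau}D'\{z/x\}$.
   Formalization: If l1 and l2 share bound names, no transition l1∥l2 exists, since (Syn) needs disjoint bound names; so the theorem gives D a transition l1∥l2' where l2' is l2 up to its bound names, and l2' = l2 whenever bn(l1) and bn(l2) are disjoint. -}

module Defs where

open import Data.Bool.Base using (Bool; true; false; T)
open import Data.Fin.Base using (Fin; zero; suc; lift)
open import Data.List.Base using (List; []; _∷_; [_]; _++_; map; concat; filter)
open import Data.List.Membership.Propositional using (_∈_; _∉_)
import Data.List.Membership.DecPropositional as DecMembership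
open import Data.List.Relation.Binary.BagAndSetEquality using (_∼[_]_; set)
open import Data.List.Relation.Binary.Disjoint.Propositional using (Disjoint)
open import Data.List.Relation.Binary.Permutation.Homogeneous using (Permutation)
open import Data.List.Relation.Binary.Permutation.Propositional using (_↭_)
open import Data.List.Relation.Unary.All using (All)
open import Data.List.Relation.Unary.Unique.Propositional using (Unique)
open import Data.Nat.Base using (ℕ; zero; suc)
open import Data.Product.Base using (∃; ∃-syntax; _×_; _,_; proj₁; proj₂; map₁; map₂)
open import Data.Vec.Base as Vec using (Vec; []; _∷_; toList)
open import Relation.Binary.Definitions using (DecidableEquality)
open import Relation.Binary.PropositionalEquality using (_≡_; _≢_)
open import Relation.Nullary using (yes; no; ¬?)

record NameSet : Set₁ where
  field
    Name     : Set
    _≟_      : DecidableEquality Name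
    infinite : ∀ (xs : List Name) → ∃[ x ] x ∉ xs

infixr 7 _⊗_ _⅋_
infixr 6 _⊕_ _&_
infix  8 ¿_ !_

-- Type variables are well-scoped de Bruijn indices, so types are
-- identified up to renaming of bound type variables.
data Ty (n : ℕ) : Set where
  var covar       : Fin n → Ty n               -- X and X^⊥
  _⊗_ _⅋_ _⊕_ _&_ : Ty n → Ty n → Ty n
  𝟏 ⊥             : Ty n
  ∃X ∀X           : Ty (suc n) → Ty n
  ¿_ !_           : Ty n → Ty n

dual : ∀ {n} → Ty n → Ty n
dual (var i)   = covar i
dual (covar i) = var i
dual (A ⊗ B)   = dual A ⅋ dual B
dual (A ⅋ B)   = dual A ⊗ dual B
dual (A ⊕ B)   = dual A & dual B
dual (A & B)   = dual A ⊕ dual B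
dual 𝟏         = ⊥
dual ⊥         = 𝟏
dual (∃X A)    = ∀X (dual A)
dual (∀X A)    = ∃X (dual A)
dual (¿ A)     = ! dual A
dual (! A)     = ¿ dual A

renᵗ : ∀ {m n} → (Fin m → Fin n) → Ty m → Ty n
renᵗ r (var i)   = var (r i)
renᵗ r (covar i) = covar (r i)
renᵗ r (A ⊗ B)   = renᵗ r A ⊗ renᵗ r B
renᵗ r (A ⅋ B)   = renᵗ r A ⅋ renᵗ r B
renᵗ r (A ⊕ B)   = renᵗ r A ⊕ renᵗ r B
renᵗ r (A & B)   = renᵗ r A & renᵗ r B
renᵗ r 𝟏         = 𝟏
renᵗ r ⊥         = ⊥
renᵗ r (∃X A)    = ∃X (renᵗ (lift 1 r) A)
renᵗ r (∀X A)    = ∀X (renᵗ (lift 1 r) A)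
renᵗ r (¿ A)     = ¿ renᵗ r A
renᵗ r (! A)     = ! renᵗ r A

liftᵗ : ∀ {m n} → (Fin m → Ty n) → Fin (suc m) → Ty (suc n)
liftᵗ τ zero    = var zero
liftᵗ τ (suc i) = renᵗ suc (τ i)

subᵗ : ∀ {m n} → (Fin m → Ty n) → Ty m → Ty n
subᵗ τ (var i)   = τ i
subᵗ τ (covar i) = dual (τ i)
subᵗ τ (A ⊗ B)   = subᵗ τ A ⊗ subᵗ τ B
subᵗ τ (A ⅋ B)   = subᵗ τ A ⅋ subᵗ τ B
subᵗ τ (A ⊕ B)   = subᵗ τ A ⊕ subᵗ τ B
subᵗ τ (A & B)   = subᵗ τ A & subᵗ τ B
subᵗ τ 𝟏         = 𝟏
subᵗ τ ⊥         = ⊥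
subᵗ τ (∃X A)    = ∃X (subᵗ (liftᵗ τ) A)
subᵗ τ (∀X A)    = ∀X (subᵗ (liftᵗ τ) A)
subᵗ τ (¿ A)     = ¿ subᵗ τ A
subᵗ τ (! A)     = ! subᵗ τ A

inst : ∀ {n} → Ty n → Fin (suc n) → Ty n
inst A zero    = A
inst A (suc i) = var i

infix 9 _⟦_⟧

_⟦_⟧ : ∀ {n} → Ty (suc n) → Ty n → Ty n
B ⟦ A ⟧ = subᵗ (inst A) B

-- A prefix or action label is given by its form, its subject (the free
-- name) and its bound names; the last index of a form is the number of
-- bound names.  The prefixes with subject x are, in this order,
--   x[]  x()  x[inl]  x[inr]  ?x[]  x[A]  x[y]  x(y)  ?x[y]  !x(y)
--   ?x[x₁,x₂]
data Pre (n : ℕ) : ℕ → Set where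
  close wait selₗ selᵣ weaken : Pre n 0
  send-ty                     : Ty n → Pre n 0
  send recv use serve         : Pre n 1
  contract                    : Pre n 2

-- The action labels are those of the prefixes together with, in this order,
--   x(inl)  x(inr)  !x()  x(A)  !x(x₁,x₂)
data Form (n : ℕ) : ℕ → Set where
  ↑_                    : ∀ {k} → Pre n k → Form n k
  offₗ offᵣ serve-weaken : Form n 0
  recv-ty               : Ty n → Form n 0
  serve-contract        : Form n 2

subᵖ : ∀ {m n k} → (Fin m → Ty n) → Pre m k → Pre n k
subᵖ τ close       = close
subᵖ τ wait        = wait
subᵖ τ selₗ        = selₗ
subᵖ τ selᵣ        = selᵣ
subᵖ τ weaken      = weaken
subᵖ τ (send-ty A) = send-ty (subᵗ τ A)
subᵖ τ send        = send
subᵖ τ recv        = recv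
subᵖ τ use         = use
subᵖ τ serve       = serve
subᵖ τ contract    = contract

-- The prefixes π with a transition π.D —π→ D.
Direct : ∀ {n k} → Pre n k → Set
Direct p = T (direct p)
  where
  direct : ∀ {n k} → Pre n k → Bool
  direct weaken   = false
  direct contract = false
  direct _        = true

module πLL (𝒩 : NameSet) where

  open NameSet 𝒩 public
  open DecMembership _≟_ using (_∈?_)

  infixl 6 _∖_

  _∖_ : List Name → List Name → List Name
  xs ∖ ys = filter (λ x → ¬? (x ∈? ys)) xs

  fresh : List Name → Name
  fresh xs = proj₁ (infinite xs)

  freshes : ∀ k → List Name → Vec Name k
  freshes zero    xs = []
  freshes (suc k) xs = fresh xs ∷ freshes k (fresh xs ∷ xs)

  Subst : Set
  Subst = Name → Name

  _[_↦_] : Subst → Name → Name → Subst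
  (σ [ x ↦ y ]) z with z ≟ x
  ... | yes _ = y
  ... | no  _ = σ z

  _[_↦*_] : ∀ {k} → Subst → Vec Name k → Vec Name k → Subst
  σ [ []     ↦* []     ] = σ
  σ [ x ∷ xs ↦* y ∷ ys ] = (σ [ xs ↦* ys ]) [ x ↦ y ]

  ｛_/_｝ : Name → Name → Subst
  ｛ z / x ｝ = (λ y → y) [ x ↦ z ]

  data Proc (n : ℕ) : Set where
    pre  : ∀ {k} → Pre n k → Name → Vec Name k → Proc n → Proc n
    case : Name → Proc n → Proc n → Proc n      -- x ▷ (P , Q)
    all  : Name → Proc (suc n) → Proc n         -- x(X).P
    ν    : Name → Name → Proc n → Proc n
    _∥_  : Proc n → Proc n → Proc n
    nil  : Proc n
    link : Name → Name → Proc n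

  fn : ∀ {n} → Proc n → List Name
  fn (pre p x ys P) = x ∷ (fn P ∖ toList ys)
  fn (case x P Q)   = x ∷ fn P ++ fn Q
  fn (all x P)      = x ∷ fn P
  fn (ν x y P)      = fn P ∖ (x ∷ y ∷ [])
  fn (P ∥ Q)        = fn P ++ fn Q
  fn nil            = []
  fn (link x y)     = x ∷ y ∷ []

  -- α-equivalence, relative to a list of pairs of corresponding bound
  -- names, innermost binder first.
  Binders : Set
  Binders = List (Name × Name)

  data _⊢_≐_ : Binders → Name → Name → Set where
    free  : ∀ {x} → [] ⊢ x ≐ x
    here  : ∀ {ρ x y} → ((x , y) ∷ ρ) ⊢ x ≐ y
    there : ∀ {ρ x y x′ y′} → x ≢ x′ → y ≢ y′ → ρ ⊢ x ≐ y →
            ((x′ , y′) ∷ ρ) ⊢ x ≐ y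

  data _⊢_≈_ (ρ : Binders) {n} : Proc n → Proc n → Set where
    pre  : ∀ {k} {p : Pre n k} {x x′ ys ys′ P P′} → ρ ⊢ x ≐ x′ →
           (toList (Vec.zip ys ys′) ++ ρ) ⊢ P ≈ P′ →
           ρ ⊢ pre p x ys P ≈ pre p x′ ys′ P′
    case : ∀ {x x′ P P′ Q Q′} → ρ ⊢ x ≐ x′ → ρ ⊢ P ≈ P′ → ρ ⊢ Q ≈ Q′ →
           ρ ⊢ case x P Q ≈ case x′ P′ Q′
    all  : ∀ {x x′ P P′} → ρ ⊢ x ≐ x′ → ρ ⊢ P ≈ P′ →
           ρ ⊢ all x P ≈ all x′ P′
    ν    : ∀ {x y x′ y′ P P′} → ((x , x′) ∷ (y , y′) ∷ ρ) ⊢ P ≈ P′ →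
           ρ ⊢ ν x y P ≈ ν x′ y′ P′
    -- (νxy)P is identified with (νyx)P
    ν×   : ∀ {x y x′ y′ P P′} → ((x , y′) ∷ (y , x′) ∷ ρ) ⊢ P ≈ P′ →
           ρ ⊢ ν x y P ≈ ν x′ y′ P′
    _∥_  : ∀ {P P′ Q Q′} → ρ ⊢ P ≈ P′ → ρ ⊢ Q ≈ Q′ →
           ρ ⊢ P ∥ Q ≈ (P′ ∥ Q′)
    nil  : ρ ⊢ nil ≈ nil
    link : ∀ {x x′ y y′} → ρ ⊢ x ≐ x′ → ρ ⊢ y ≐ y′ →
           ρ ⊢ link x y ≈ link x′ y′

  infix 4 _=α_

  _=α_ : ∀ {n} → Proc n → Proc n → Set
  P =α Q = [] ⊢ P ≈ Q

  -- Distinctness of names is imposed on hyperenvironments in Valid, below.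
  Env : ℕ → Set
  Env n = List (Name × Ty n)

  HEnv : ℕ → Set
  HEnv n = List (Env n)

  infixl 4 _▸_∶_

  _▸_∶_ : ∀ {n} → Env n → Name → Ty n → Env n
  Γ ▸ x ∶ A = (x , A) ∷ Γ

  infix 3 _≋_

  -- Equality as multisets of unordered environments.
  _≋_ : ∀ {n} → HEnv n → HEnv n → Set
  _≋_ = Permutation _↭_

  dom : ∀ {n} → Env n → List Name
  dom = map proj₁

  Distinct : ∀ {n} → HEnv n → Set
  Distinct 𝒢 = Unique (dom (concat 𝒢))

  WhyNot : ∀ {n} → Env n → Set
  WhyNot = All (λ (_ , T) → ∃[ A ] T ≡ ¿ A)

  renᴱ : ∀ {n} → Subst → Env n → Env n
  renᴱ σ = map (map₁ σ)

  subᴱ : ∀ {m n} → (Fin m → Ty n) → Env m → Env n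
  subᴱ τ = map (map₂ (subᵗ τ))

  wkᴱ : ∀ {n} → Env n → Env (suc n)
  wkᴱ = map (map₂ (renᵗ suc))

  -- A derivation is a tree of rule applications, one per process
  -- constructor, whose nodes carry their concluding hyperenvironment
  -- (which is ∅ for nil).  Trees are not necessarily correct derivations:
  -- that is Valid.
  data Tree (n : ℕ) : Set where
    pre  : ∀ {k} → HEnv n → Pre n k → Name → Vec Name k → Tree n → Tree n
    case : HEnv n → Name → Tree n → Tree n → Tree n
    all  : HEnv n → Name → Tree (suc n) → Tree n
    ν    : HEnv n → Name → Name → Tree n → Tree n
    par  : HEnv n → Tree n → Tree n → Tree n
    nil  : Tree n
    link : HEnv n → Name → Name → Tree n

  proc : ∀ {n} → Tree n → Proc n
  proc (pre _ p x ys D) = pre p x ys (proc D)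
  proc (case _ x D E)   = case x (proc D) (proc E)
  proc (all _ x D)      = all x (proc D)
  proc (ν _ x y D)      = ν x y (proc D)
  proc (par _ D E)      = proc D ∥ proc E
  proc nil              = nil
  proc (link _ x y)     = link x y

  conc : ∀ {n} → Tree n → HEnv n
  conc (pre 𝒢 _ _ _ _) = 𝒢
  conc (case 𝒢 _ _ _)  = 𝒢
  conc (all 𝒢 _ _)     = 𝒢
  conc (ν 𝒢 _ _ _)     = 𝒢
  conc (par 𝒢 _ _)     = 𝒢
  conc nil             = []
  conc (link 𝒢 _ _)    = 𝒢

  fnᵀ : ∀ {n} → Tree n → List Name
  fnᵀ D = fn (proc D)

  mutual

    record Valid {n} (D : Tree n) : Set where
      inductive
      constructor valid
      field
        distinct : Distinct (conc D)
        rule     : Rule D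

    data Rule {n} : Tree n → Set where

      Ax : ∀ {𝒢 x y A} →
        𝒢 ≋ [ [] ▸ x ∶ dual A ▸ y ∶ A ] →
        Rule (link 𝒢 x y)

      Cut : ∀ {𝒢 𝒢₀ Γ Δ x y A D} → Valid D →
        conc D ≋ (Γ ▸ x ∶ A) ∷ (Δ ▸ y ∶ dual A) ∷ 𝒢₀ →
        𝒢 ≋ (Γ ++ Δ) ∷ 𝒢₀ →
        Rule (ν 𝒢 x y D)

      Mix : ∀ {𝒢 D E} → Valid D → Valid E →
        𝒢 ≋ conc D ++ conc E →
        Rule (par 𝒢 D E)

      Mix₀ : Rule nil

      R⊗ : ∀ {𝒢 Γ Δ x y A B D} → Valid D →
        conc D ≋ (Γ ▸ y ∶ A) ∷ (Δ ▸ x ∶ B) ∷ [] →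
        𝒢 ≋ [ Γ ++ Δ ▸ x ∶ A ⊗ B ] →
        Rule (pre 𝒢 send x (y ∷ []) D)

      R𝟏 : ∀ {𝒢 x D} → Valid D →
        conc D ≋ [] →
        𝒢 ≋ [ [] ▸ x ∶ 𝟏 ] →
        Rule (pre 𝒢 close x [] D)

      R⅋ : ∀ {𝒢 Γ x y A B D} → Valid D →
        conc D ≋ [ Γ ▸ y ∶ A ▸ x ∶ B ] →
        𝒢 ≋ [ Γ ▸ x ∶ A ⅋ B ] →
        Rule (pre 𝒢 recv x (y ∷ []) D)

      R⊥ : ∀ {𝒢 Γ x D} → Valid D →
        conc D ≋ [ Γ ] →
        𝒢 ≋ [ Γ ▸ x ∶ ⊥ ] →
        Rule (pre 𝒢 wait x [] D)

      R⊕₁ : ∀ {𝒢 Γ x A B D} → Valid D →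
        conc D ≋ [ Γ ▸ x ∶ A ] →
        𝒢 ≋ [ Γ ▸ x ∶ A ⊕ B ] →
        Rule (pre 𝒢 selₗ x [] D)

      R⊕₂ : ∀ {𝒢 Γ x A B D} → Valid D →
        conc D ≋ [ Γ ▸ x ∶ B ] →
        𝒢 ≋ [ Γ ▸ x ∶ A ⊕ B ] →
        Rule (pre 𝒢 selᵣ x [] D)

      R& : ∀ {𝒢 Γ x A B D E} → Valid D → Valid E →
        conc D ≋ [ Γ ▸ x ∶ A ] →
        conc E ≋ [ Γ ▸ x ∶ B ] →
        𝒢 ≋ [ Γ ▸ x ∶ A & B ] →
        Rule (case 𝒢 x D E)

      R! : ∀ {𝒢 Γ x y A D} → Valid D → WhyNot Γ →
        conc D ≋ [ Γ ▸ y ∶ A ] →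
        𝒢 ≋ [ Γ ▸ x ∶ ! A ] →
        Rule (pre 𝒢 serve x (y ∷ []) D)

      R? : ∀ {𝒢 Γ x y A D} → Valid D →
        conc D ≋ [ Γ ▸ y ∶ A ] →
        𝒢 ≋ [ Γ ▸ x ∶ ¿ A ] →
        Rule (pre 𝒢 use x (y ∷ []) D)

      RW : ∀ {𝒢 Γ x A D} → Valid D →
        conc D ≋ [ Γ ] →
        𝒢 ≋ [ Γ ▸ x ∶ ¿ A ] →
        Rule (pre 𝒢 weaken x [] D)

      RC : ∀ {𝒢 Γ x x₁ x₂ A D} → Valid D →
        conc D ≋ [ Γ ▸ x₁ ∶ ¿ A ▸ x₂ ∶ ¿ A ] →
        𝒢 ≋ [ Γ ▸ x ∶ ¿ A ] →
        Rule (pre 𝒢 contract x (x₁ ∷ x₂ ∷ []) D)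

      R∃ : ∀ {𝒢 Γ x A B D} → Valid D →
        conc D ≋ [ Γ ▸ x ∶ B ⟦ A ⟧ ] →
        𝒢 ≋ [ Γ ▸ x ∶ ∃X B ] →
        Rule (pre 𝒢 (send-ty A) x [] D)

      -- that X is not free in Γ is expressed by weakening
      R∀ : ∀ {𝒢 Γ x B D} → Valid D →
        conc D ≋ [ wkᴱ Γ ▸ x ∶ B ] →
        𝒢 ≋ [ Γ ▸ x ∶ ∀X B ] →
        Rule (all 𝒢 x D)

  -- Capture-avoiding substitution of names throughout a derivation: bound
  -- names are replaced by names fresh for the image of the free names.
  renᵀ : ∀ {n} → Subst → Tree n → Tree n
  renᵀ σ (pre {k} 𝒢 p x ys D) = pre (map (renᴱ σ) 𝒢) p (σ x) zs (renᵀ (σ [ ys ↦* zs ]) D)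
    where zs = freshes k (map σ (fnᵀ D ∖ toList ys))
  renᵀ σ (case 𝒢 x D E)       = case (map (renᴱ σ) 𝒢) (σ x) (renᵀ σ D) (renᵀ σ E)
  renᵀ σ (all 𝒢 x D)          = all (map (renᴱ σ) 𝒢) (σ x) (renᵀ σ D)
  renᵀ σ (ν 𝒢 x y D)          with freshes 2 (map σ (fnᵀ D ∖ (x ∷ y ∷ [])))
  ... | x′ ∷ y′ ∷ []           = ν (map (renᴱ σ) 𝒢) x′ y′ (renᵀ (σ [ x ∷ y ∷ [] ↦* x′ ∷ y′ ∷ [] ]) D)
  renᵀ σ (par 𝒢 D E)          = par (map (renᴱ σ) 𝒢) (renᵀ σ D) (renᵀ σ E)
  renᵀ σ nil                  = nil
  renᵀ σ (link 𝒢 x y)         = link (map (renᴱ σ) 𝒢) (σ x) (σ y)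

  subᵀ : ∀ {m n} → (Fin m → Ty n) → Tree m → Tree n
  subᵀ τ (pre 𝒢 p x ys D) = pre (map (subᴱ τ) 𝒢) (subᵖ τ p) x ys (subᵀ τ D)
  subᵀ τ (case 𝒢 x D E)   = case (map (subᴱ τ) 𝒢) x (subᵀ τ D) (subᵀ τ E)
  subᵀ τ (all 𝒢 x D)      = all (map (subᴱ τ) 𝒢) x (subᵀ (liftᵗ τ) D)
  subᵀ τ (ν 𝒢 x y D)      = ν (map (subᴱ τ) 𝒢) x y (subᵀ τ D)
  subᵀ τ (par 𝒢 D E)      = par (map (subᴱ τ) 𝒢) (subᵀ τ D) (subᵀ τ E)
  subᵀ τ nil              = nil
  subᵀ τ (link 𝒢 x y)     = link (map (subᴱ τ) 𝒢) x y

  -- ?z₁[].⋯?zₙ[].x[].𝟎 for Θ = z₁:T₁,…,zₙ:Tₙ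
  weakenAll : ∀ {n} → Env n → Name → Tree n
  weakenAll []            x = pre [ [] ▸ x ∶ 𝟏 ] close x [] nil
  weakenAll ((z , T) ∷ Θ) x = pre [ Θ ▸ x ∶ 𝟏 ▸ z ∶ T ] weaken z [] (weakenAll Θ x)

  -- ?z₁[z₁σ₁,z₁σ₂].⋯?zₙ[zₙσ₁,zₙσ₂].D for Θ = z₁:T₁,…,zₙ:Tₙ, where the
  -- conclusion of the result consists of Γ and Θ
  contractAll : ∀ {n} → Subst → Subst → Env n → Env n → Tree n → Tree n
  contractAll σ₁ σ₂ Γ []            D = D
  contractAll σ₁ σ₂ Γ ((z , T) ∷ Θ) D =
    pre [ (Θ ++ Γ) ▸ z ∶ T ] contract z (σ₁ z ∷ σ₂ z ∷ [])
      (contractAll σ₁ σ₂ (Γ ▸ σ₁ z ∶ T ▸ σ₂ z ∶ T) Θ D)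

  -- x₁[x₂].(!x₁(x′σ₁).Dσ₁ ∥ !x₂(x′σ₂).Dσ₂), where D has type Θ, x′:A
  twoServers : ∀ {n} → Subst → Subst → Env n → Name → Name → Name → Ty n → Tree n → Tree n
  twoServers σ₁ σ₂ Θ x₁ x₂ x′ A D =
    pre [ (renᴱ σ₂ Θ ++ renᴱ σ₁ Θ) ▸ x₁ ∶ ! A ⊗ ! A ] send x₁ (x₂ ∷ [])
      (par (Γ₁ ∷ Γ₂ ∷ [])
        (pre [ Γ₁ ] serve x₁ (σ₁ x′ ∷ []) (renᵀ σ₁ D))
        (pre [ Γ₂ ] serve x₂ (σ₂ x′ ∷ []) (renᵀ σ₂ D)))
    where
    Γ₁ = renᴱ σ₁ Θ ▸ x₁ ∶ ! A
    Γ₂ = renᴱ σ₂ Θ ▸ x₂ ∶ ! A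

  data Act (n : ℕ) : Set where
    act : ∀ {k} → Form n k → Name → Vec Name k → Act n

  fnᵃ bnᵃ : ∀ {n} → Act n → List Name
  fnᵃ (act _ x _)  = [ x ]
  bnᵃ (act _ _ ys) = toList ys

  -- Equality of action labels up to the choice of bound names (the names
  -- bound by one label of a transition are always distinct).  Two labels
  -- whose bound names were chosen independently may clash, in which case
  -- they only form a pair, see Syn, after renaming the bound names of one.
  infix 4 _≅_

  data _≅_ {n} : Act n → Act n → Set where
    rebind : ∀ {k} {f : Form n k} {x ys zs} → act f x ys ≅ act f x zs

  infix 6 _∥_ _⟷_

  data Label (n : ℕ) : Set where
    τ   : Label n
    _⟷_ : Name → Name → Label n
    ⌊_⌋ : Act n → Label n
    _∥_ : Act n → Act n → Label n

  fnˡ bnˡ cnˡ : ∀ {n} → Label n → List Name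
  fnˡ τ        = []
  fnˡ (x ⟷ y)  = x ∷ y ∷ []
  fnˡ ⌊ a ⌋    = fnᵃ a
  fnˡ (a ∥ b)  = fnᵃ a ++ fnᵃ b
  bnˡ τ        = []
  bnˡ (x ⟷ y)  = []
  bnˡ ⌊ a ⌋    = bnᵃ a
  bnˡ (a ∥ b)  = bnᵃ a ++ bnᵃ b
  cnˡ l        = fnˡ l ++ bnˡ l

  infix 2 _─[_]→_

  mutual

    -- The source and target of every transition, also in premises of the
    -- rules, are correct derivations.  Given the tree shape, this fixes
    -- the conclusions that the rules leave implicit.
    record _─[_]→_ {n} (D : Tree n) (l : Label n) (D′ : Tree n) : Set where
      inductive
      constructor step
      field
        source-valid : Valid D
        target-valid : Valid D′
        by           : Step D l D′

    data Step {n} : Tree n → Label n → Tree n → Set where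

      prefix : ∀ {k 𝒢 x ys D} {p : Pre n k} → Direct p →
        Step (pre 𝒢 p x ys D) ⌊ act (↑ p) x ys ⌋ D

      caseₗ : ∀ {𝒢 x D E} → Step (case 𝒢 x D E) ⌊ act offₗ x [] ⌋ D
      caseᵣ : ∀ {𝒢 x D E} → Step (case 𝒢 x D E) ⌊ act offᵣ x [] ⌋ E

      all : ∀ {𝒢 x D A} →
        Step (all 𝒢 x D) ⌊ act (recv-ty A) x [] ⌋ (subᵀ (inst A) D)

      weaken : ∀ {𝒢 𝒢′ x D} →
        Step (pre 𝒢 weaken x [] D) ⌊ act (↑ weaken) x [] ⌋ (pre 𝒢′ wait x [] D)

      contract : ∀ {𝒢 𝒢′ x x₁ x₂ D} →
        Step (pre 𝒢 contract x (x₁ ∷ x₂ ∷ []) D)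
             ⌊ act (↑ contract) x (x₁ ∷ x₂ ∷ []) ⌋
             (pre 𝒢′ recv x₁ (x₂ ∷ []) D)

      serve-weaken : ∀ {𝒢 Θ x x′ A D} →
        𝒢 ≋ [ Θ ▸ x ∶ ! A ] →
        dom Θ ∼[ set ] (fnᵀ D ∖ [ x′ ]) →
        Step (pre 𝒢 serve x (x′ ∷ []) D)
             ⌊ act serve-weaken x [] ⌋
             (weakenAll Θ x)

      serve-contract : ∀ {𝒢 Θ x x₁ x₂ x′ A D} (σ₁ σ₂ : Subst) →
        𝒢 ≋ [ Θ ▸ x ∶ ! A ] →
        Disjoint (fnᵀ (renᵀ σ₁ D)) (fnᵀ (renᵀ σ₂ D)) →
        dom Θ ∼[ set ] (fnᵀ D ∖ [ x′ ]) →
        Step (pre 𝒢 serve x (x′ ∷ []) D)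
             ⌊ act serve-contract x (x₁ ∷ x₂ ∷ []) ⌋
             (contractAll σ₁ σ₂ ([] ▸ x₁ ∶ ! A ⊗ ! A) Θ
               (twoServers σ₁ σ₂ Θ x₁ x₂ x′ A D))

      linkₗ : ∀ {𝒢 x y} → Step (link 𝒢 x y) (x ⟷ y) nil
      linkᵣ : ∀ {𝒢 x y} → Step (link 𝒢 x y) (y ⟷ x) nil

      α : ∀ {D E E′ l} →
        proc D =α proc E → conc D ≋ conc E →
        E ─[ l ]→ E′ →
        Step D l E′

      Parₗ : ∀ {𝒢 𝒢′ D D′ E l} →
        D ─[ l ]→ D′ → Disjoint (bnˡ l) (fnᵀ E) →
        Step (par 𝒢 D E) l (par 𝒢′ D′ E)

      Parᵣ : ∀ {𝒢 𝒢′ D E E′ l} →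
        E ─[ l ]→ E′ → Disjoint (bnˡ l) (fnᵀ D) →
        Step (par 𝒢 D E) l (par 𝒢′ D E′)

      Syn : ∀ {𝒢 𝒢′ D D′ E E′ a b} →
        D ─[ ⌊ a ⌋ ]→ D′ → E ─[ ⌊ b ⌋ ]→ E′ →
        Disjoint (bnᵃ a) (bnᵃ b) →
        Step (par 𝒢 D E) (a ∥ b) (par 𝒢′ D′ E′)

      -- pairs of action labels are unordered
      flip : ∀ {D D′ a b} →
        D ─[ a ∥ b ]→ D′ →
        Step D (b ∥ a) D′

      Res : ∀ {𝒢 𝒢′ 𝒢₀ 𝒢₀′ Γ Γ′ Δ Δ′ x y A D D′ l} →
        D ─[ l ]→ D′ → x ∉ cnˡ l → y ∉ cnˡ l →
        conc D  ≋ (Γ  ▸ x ∶ A) ∷ (Δ  ▸ y ∶ dual A) ∷ 𝒢₀ →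
        conc D′ ≋ (Γ′ ▸ x ∶ A) ∷ (Δ′ ▸ y ∶ dual A) ∷ 𝒢₀′ →
        Step (ν 𝒢 x y D) l (ν 𝒢′ x y D′)

      Com𝟏 : ∀ {𝒢 𝒢₀ Δ x y D D′} →
        D ─[ act (↑ close) x [] ∥ act (↑ wait) y [] ]→ D′ →
        conc D  ≋ ([] ▸ x ∶ 𝟏) ∷ (Δ ▸ y ∶ ⊥) ∷ 𝒢₀ →
        conc D′ ≋ Δ ∷ 𝒢₀ →
        Step (ν 𝒢 x y D) τ D′

      Com⊗ : ∀ {𝒢 𝒢′ 𝒢″ 𝒢₀ Γ₁ Γ₂ Δ x x′ y y′ A B D D′} →
        D ─[ act (↑ send) x (x′ ∷ []) ∥ act (↑ recv) y (y′ ∷ []) ]→ D′ →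
        conc D  ≋ (Γ₁ ++ Γ₂ ▸ x ∶ A ⊗ B) ∷ (Δ ▸ y ∶ dual A ⅋ dual B) ∷ 𝒢₀ →
        conc D′ ≋ (Γ₁ ▸ x ∶ B) ∷ (Γ₂ ▸ x′ ∶ A)
                  ∷ (Δ ▸ y ∶ dual B ▸ y′ ∶ dual A) ∷ 𝒢₀ →
        Step (ν 𝒢 x y D) τ (ν 𝒢′ x y (ν 𝒢″ x′ y′ D′))

      Com⊕₁ : ∀ {𝒢 𝒢′ 𝒢₀ Γ Δ x y A₁ A₂ D D′} →
        D ─[ act (↑ selₗ) x [] ∥ act offₗ y [] ]→ D′ →
        conc D  ≋ (Γ ▸ x ∶ A₁ ⊕ A₂) ∷ (Δ ▸ y ∶ dual A₁ & dual A₂) ∷ 𝒢₀ →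
        conc D′ ≋ (Γ ▸ x ∶ A₁) ∷ (Δ ▸ y ∶ dual A₁) ∷ 𝒢₀ →
        Step (ν 𝒢 x y D) τ (ν 𝒢′ x y D′)

      Com⊕₂ : ∀ {𝒢 𝒢′ 𝒢₀ Γ Δ x y A₁ A₂ D D′} →
        D ─[ act (↑ selᵣ) x [] ∥ act offᵣ y [] ]→ D′ →
        conc D  ≋ (Γ ▸ x ∶ A₁ ⊕ A₂) ∷ (Δ ▸ y ∶ dual A₁ & dual A₂) ∷ 𝒢₀ →
        conc D′ ≋ (Γ ▸ x ∶ A₂) ∷ (Δ ▸ y ∶ dual A₂) ∷ 𝒢₀ →
        Step (ν 𝒢 x y D) τ (ν 𝒢′ x y D′)

      Com∃ : ∀ {𝒢 𝒢′ 𝒢₀ Γ Δ x y A B D D′} →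
        D ─[ act (↑ (send-ty A)) x [] ∥ act (recv-ty A) y [] ]→ D′ →
        conc D  ≋ (Γ ▸ x ∶ ∃X B) ∷ (Δ ▸ y ∶ ∀X (dual B)) ∷ 𝒢₀ →
        conc D′ ≋ (Γ ▸ x ∶ B ⟦ A ⟧) ∷ (Δ ▸ y ∶ dual B ⟦ A ⟧) ∷ 𝒢₀ →
        Step (ν 𝒢 x y D) τ (ν 𝒢′ x y D′)

      Com? : ∀ {𝒢 𝒢′ 𝒢₀ Γ Δ x x′ y y′ A D D′} →
        D ─[ act (↑ use) x (x′ ∷ []) ∥ act (↑ serve) y (y′ ∷ []) ]→ D′ →
        conc D  ≋ (Γ ▸ x ∶ ¿ A) ∷ (Δ ▸ y ∶ ! dual A) ∷ 𝒢₀ →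
        conc D′ ≋ (Γ ▸ x′ ∶ A) ∷ (Δ ▸ y′ ∶ dual A) ∷ 𝒢₀ →
        Step (ν 𝒢 x y D) τ (ν 𝒢′ x′ y′ D′)

      ComC : ∀ {𝒢 𝒢′ 𝒢₀ Γ Δ x x₁ x₂ y y₁ y₂ A D D′} →
        D ─[ act (↑ contract) x (x₁ ∷ x₂ ∷ [])
             ∥ act serve-contract y (y₁ ∷ y₂ ∷ []) ]→ D′ →
        WhyNot Δ →
        conc D  ≋ (Γ ▸ x ∶ ¿ A) ∷ (Δ ▸ y ∶ ! dual A) ∷ 𝒢₀ →
        conc D′ ≋ (Γ ▸ x₁ ∶ ¿ A ⅋ ¿ A) ∷ (Δ ▸ y₁ ∶ ! dual A ⊗ ! dual A) ∷ 𝒢₀ →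
        Step (ν 𝒢 x y D) τ (ν 𝒢′ x₁ y₁ D′)

      ComW : ∀ {𝒢 𝒢′ 𝒢₀ Γ Δ x y A D D′} →
        D ─[ act (↑ weaken) x [] ∥ act serve-weaken y [] ]→ D′ →
        WhyNot Δ →
        conc D  ≋ (Γ ▸ x ∶ ¿ A) ∷ (Δ ▸ y ∶ ! dual A) ∷ 𝒢₀ →
        conc D′ ≋ (Γ ▸ x ∶ ⊥) ∷ (Δ ▸ y ∶ 𝟏) ∷ 𝒢₀ →
        Step (ν 𝒢 x y D) τ (ν 𝒢′ x y D′)

      Link : ∀ {𝒢 𝒢₀ Γ x y z A D D′} →
        D ─[ z ⟷ y ]→ D′ → z ≢ x → z ≢ y →
        conc D  ≋ ([] ▸ z ∶ dual A ▸ y ∶ A) ∷ (Γ ▸ x ∶ dual A) ∷ 𝒢₀ →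
        conc D′ ≋ (Γ ▸ x ∶ dual A) ∷ 𝒢₀ →
        Step (ν 𝒢 x y D) τ (renᵀ ｛ z / x ｝ D′)

{-# OPTIONS --safe #-}
module Submission where

-- The two given transitions may come from different α-variants of D, and these
-- may assign different types to the names bound by cuts, so the targets of the
-- transitions cannot be combined directly.  But whether an action is possible
-- depends on the process alone: up to renaming of bound names, its prefix must
-- occur outside of all other prefixes, with a subject that is not restricted.
-- Hence both actions are read off the process of one α-variant of D whose
-- restrictions avoid the names of both labels, and performed in it.  Prefixes
-- with distinct subjects are distinct, so they lie on the two sides of some
-- parallel composition, where Syn applies.  To lift a transition through a cut
-- of x and y one needs that x and y keep their types and remain in different
-- environments: a transition only affects the types of the names in its label
-- and never merges environments.

open import Defs
open import Data.Empty using (⊥-elim)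
open import Data.Fin.Base using (Fin; zero; suc; lift)
open import Data.List.Base using (List; []; _∷_; [_]; _++_; map; concat)
import Data.List.Membership.DecPropositional as DecMembership
open import Data.List.Membership.Propositional using (_∈_; _∉_)
open import Data.List.Membership.Propositional.Properties
  using (∈-map⁺; ∈-map⁻; ∈-++⁺ˡ; ∈-++⁺ʳ; ∈-++⁻; ∈-filter⁺; ∈-filter⁻)
open import Data.List.Properties
  using (map-++; ++-identityʳ; ++-assoc; map-∘; map-id; map-cong; concat-map; concat-++)
open import Data.List.Relation.Binary.BagAndSetEquality using (_∼[_]_; set)
open import Data.List.Relation.Binary.Disjoint.Propositional using (Disjoint)
open import Data.List.Relation.Binary.Permutation.Homogeneous using (Permutation)
open import Data.List.Relation.Binary.Permutation.Propositional
  using (_↭_; ↭-setoid; ↭-refl; ↭-sym; ↭-trans; ↭-reflexive; ↭-prep; ↭-swap; ↭⇒↭ₛ)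
open import Data.List.Relation.Binary.Permutation.Propositional.Properties
  using (∈-resp-↭; shift; shifts; ++-comm)
  renaming (map⁺ to ↭-map⁺; ++⁺ to ↭-++⁺; ++⁺ʳ to ↭-++⁺ʳ)
import Data.List.Relation.Binary.Permutation.Setoid as SetoidPerm
import Data.List.Relation.Binary.Permutation.Setoid.Properties as SetoidPermProps
open import Data.List.Relation.Binary.Pointwise using ([]; _∷_)
open import Data.List.Relation.Unary.All as All using (All; []; _∷_)
import Data.List.Relation.Unary.All.Properties as All
open import Data.List.Relation.Unary.AllPairs using ([]; _∷_)
open import Data.List.Relation.Unary.Any as Any using (Any; here; there)
import Data.List.Relation.Unary.Any.Properties as Any
open import Data.List.Relation.Unary.Unique.Propositional using (Unique)
import Data.List.Relation.Unary.Unique.Propositional.Properties as Unique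
open import Data.Nat.Base using (ℕ; zero; suc)
open import Data.Product.Base using (∃-syntax; _×_; _,_; proj₁; proj₂; map₁; map₂)
open import Data.Sum.Base using (_⊎_; inj₁; inj₂)
open import Data.Unit.Base using (⊤; tt)
open import Data.Vec.Base as Vec using (Vec; []; _∷_; toList)
open import Function.Base using (_∘_; id)
open import Function.Bundles using (Equivalence; mk⇔)
open import Relation.Binary.PropositionalEquality
  using (_≡_; _≢_; refl; sym; trans; cong; cong₂; subst; setoid)
open import Relation.Nullary using (¬_; Dec; yes; no; ¬?)
open import Relation.Nullary.Decidable using (map′)

-- Types

-- Every step carries proofs that its source and target are valid, so performing an action means
-- constructing a target together with its typing. For this reason typing must be stable under
-- renamings injective on free names (for α-variants and for the two copies of a duplicated server)
-- and under type substitution (for the target of `x(A)`). The two labels may bind the same name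
-- although their subjects differ: by α, `x[y].P ∥ z[w].Q` can do both `x[y]` and `z[y]`. Pairs
-- arise only from `Syn`, which demands disjoint bound names, so the second label is rebound exactly
-- in this case. Identifying (νxy)P with (νyx)P complicates α-equivalence: symmetry and transitivity
-- must exchange adjacent pairs of bound names, which is sound only when the names are distinct. Raw
-- processes do not guarantee this, but processes of valid derivations do. The given transitions
-- serve only to learn what the process can do. Invariants about types and environments are
-- therefore proved for the transitions that are constructed, and never for arbitrary ones such as
-- communications or links.

dual-involutive : ∀ {n} (A : Ty n) → dual (dual A) ≡ A
dual-involutive (var i)   = refl
dual-involutive (covar i) = refl
dual-involutive (A ⊗ B)   = cong₂ _⊗_ (dual-involutive A) (dual-involutive B)
dual-involutive (A ⅋ B)   = cong₂ _⅋_ (dual-involutive A) (dual-involutive B)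
dual-involutive (A ⊕ B)   = cong₂ _⊕_ (dual-involutive A) (dual-involutive B)
dual-involutive (A & B)   = cong₂ _&_ (dual-involutive A) (dual-involutive B)
dual-involutive 𝟏         = refl
dual-involutive ⊥         = refl
dual-involutive (∃X A)    = cong ∃X (dual-involutive A)
dual-involutive (∀X A)    = cong ∀X (dual-involutive A)
dual-involutive (¿ A)     = cong ¿_ (dual-involutive A)
dual-involutive (! A)     = cong !_ (dual-involutive A)

renᵗ-dual : ∀ {m n} (r : Fin m → Fin n) A → renᵗ r (dual A) ≡ dual (renᵗ r A)
renᵗ-dual r (var i)   = refl
renᵗ-dual r (covar i) = refl
renᵗ-dual r (A ⊗ B)   = cong₂ _⅋_ (renᵗ-dual r A) (renᵗ-dual r B)
renᵗ-dual r (A ⅋ B)   = cong₂ _⊗_ (renᵗ-dual r A) (renᵗ-dual r B)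
renᵗ-dual r (A ⊕ B)   = cong₂ _&_ (renᵗ-dual r A) (renᵗ-dual r B)
renᵗ-dual r (A & B)   = cong₂ _⊕_ (renᵗ-dual r A) (renᵗ-dual r B)
renᵗ-dual r 𝟏         = refl
renᵗ-dual r ⊥         = refl
renᵗ-dual r (∃X A)    = cong ∀X (renᵗ-dual (lift 1 r) A)
renᵗ-dual r (∀X A)    = cong ∃X (renᵗ-dual (lift 1 r) A)
renᵗ-dual r (¿ A)     = cong !_ (renᵗ-dual r A)
renᵗ-dual r (! A)     = cong ¿_ (renᵗ-dual r A)

subᵗ-dual : ∀ {m n} (τ : Fin m → Ty n) A → subᵗ τ (dual A) ≡ dual (subᵗ τ A)
subᵗ-dual τ (var i)   = refl
subᵗ-dual τ (covar i) = sym (dual-involutive (τ i))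
subᵗ-dual τ (A ⊗ B)   = cong₂ _⅋_ (subᵗ-dual τ A) (subᵗ-dual τ B)
subᵗ-dual τ (A ⅋ B)   = cong₂ _⊗_ (subᵗ-dual τ A) (subᵗ-dual τ B)
subᵗ-dual τ (A ⊕ B)   = cong₂ _&_ (subᵗ-dual τ A) (subᵗ-dual τ B)
subᵗ-dual τ (A & B)   = cong₂ _⊕_ (subᵗ-dual τ A) (subᵗ-dual τ B)
subᵗ-dual τ 𝟏         = refl
subᵗ-dual τ ⊥         = refl
subᵗ-dual τ (∃X A)    = cong ∀X (subᵗ-dual (liftᵗ τ) A)
subᵗ-dual τ (∀X A)    = cong ∃X (subᵗ-dual (liftᵗ τ) A)
subᵗ-dual τ (¿ A)     = cong !_ (subᵗ-dual τ A)
subᵗ-dual τ (! A)     = cong ¿_ (subᵗ-dual τ A)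

-- The composite is a separate function with a pointwise equation, here and in the next lemmas, so
-- that the induction passes under quantifiers: lifting commutes with composition only pointwise,
-- and function extensionality is avoided.
renᵗ-renᵗ : ∀ {k m n} {r : Fin m → Fin n} {s : Fin k → Fin m} {t} →
            (∀ i → r (s i) ≡ t i) → ∀ A → renᵗ r (renᵗ s A) ≡ renᵗ t A
renᵗ-renᵗ {r = r} {s} {t} h = go
  where
  h↑ : ∀ i → lift 1 r (lift 1 s i) ≡ lift 1 t i
  h↑ zero    = refl
  h↑ (suc i) = cong suc (h i)
  go : ∀ A → renᵗ r (renᵗ s A) ≡ renᵗ t A
  go (var i)   = cong var (h i)
  go (covar i) = cong covar (h i)
  go (A ⊗ B)   = cong₂ _⊗_ (go A) (go B)
  go (A ⅋ B)   = cong₂ _⅋_ (go A) (go B)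
  go (A ⊕ B)   = cong₂ _⊕_ (go A) (go B)
  go (A & B)   = cong₂ _&_ (go A) (go B)
  go 𝟏         = refl
  go ⊥         = refl
  go (∃X A)    = cong ∃X (renᵗ-renᵗ h↑ A)
  go (∀X A)    = cong ∀X (renᵗ-renᵗ h↑ A)
  go (¿ A)     = cong ¿_ (go A)
  go (! A)     = cong !_ (go A)

subᵗ-renᵗ : ∀ {k m n} {τ : Fin m → Ty n} {r : Fin k → Fin m} {υ} →
            (∀ i → τ (r i) ≡ υ i) → ∀ A → subᵗ τ (renᵗ r A) ≡ subᵗ υ A
subᵗ-renᵗ {τ = τ} {r} {υ} h = go
  where
  h↑ : ∀ i → liftᵗ τ (lift 1 r i) ≡ liftᵗ υ i
  h↑ zero    = refl
  h↑ (suc i) = cong (renᵗ suc) (h i)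
  go : ∀ A → subᵗ τ (renᵗ r A) ≡ subᵗ υ A
  go (var i)   = h i
  go (covar i) = cong dual (h i)
  go (A ⊗ B)   = cong₂ _⊗_ (go A) (go B)
  go (A ⅋ B)   = cong₂ _⅋_ (go A) (go B)
  go (A ⊕ B)   = cong₂ _⊕_ (go A) (go B)
  go (A & B)   = cong₂ _&_ (go A) (go B)
  go 𝟏         = refl
  go ⊥         = refl
  go (∃X A)    = cong ∃X (subᵗ-renᵗ h↑ A)
  go (∀X A)    = cong ∀X (subᵗ-renᵗ h↑ A)
  go (¿ A)     = cong ¿_ (go A)
  go (! A)     = cong !_ (go A)

renᵗ-subᵗ : ∀ {k m n} {r : Fin m → Fin n} {τ : Fin k → Ty m} {υ} →
            (∀ i → renᵗ r (τ i) ≡ υ i) → ∀ A → renᵗ r (subᵗ τ A) ≡ subᵗ υ A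
renᵗ-subᵗ {r = r} {τ} {υ} h = go
  where
  h↑ : ∀ i → renᵗ (lift 1 r) (liftᵗ τ i) ≡ liftᵗ υ i
  h↑ zero    = refl
  -- Both `lift 1 r` after `suc` and `suc` after `r` are fused into one renaming of `τ i`, where
  -- they agree definitionally.
  h↑ (suc i) = trans (renᵗ-renᵗ (λ _ → refl) (τ i))
    (trans (sym (renᵗ-renᵗ (λ _ → refl) (τ i))) (cong (renᵗ suc) (h i)))
  go : ∀ A → renᵗ r (subᵗ τ A) ≡ subᵗ υ A
  go (var i)   = h i
  go (covar i) = trans (renᵗ-dual r (τ i)) (cong dual (h i))
  go (A ⊗ B)   = cong₂ _⊗_ (go A) (go B)
  go (A ⅋ B)   = cong₂ _⅋_ (go A) (go B)
  go (A ⊕ B)   = cong₂ _⊕_ (go A) (go B)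
  go (A & B)   = cong₂ _&_ (go A) (go B)
  go 𝟏         = refl
  go ⊥         = refl
  go (∃X A)    = cong ∃X (renᵗ-subᵗ h↑ A)
  go (∀X A)    = cong ∀X (renᵗ-subᵗ h↑ A)
  go (¿ A)     = cong ¿_ (go A)
  go (! A)     = cong !_ (go A)

subᵗ-wk : ∀ {m n} (τ : Fin m → Ty n) A →
          subᵗ (liftᵗ τ) (renᵗ suc A) ≡ renᵗ suc (subᵗ τ A)
subᵗ-wk τ A = trans (subᵗ-renᵗ (λ _ → refl) A) (sym (renᵗ-subᵗ (λ _ → refl) A))

subᵗ-subᵗ : ∀ {k m n} {τ : Fin m → Ty n} {υ : Fin k → Ty m} {ω} →
            (∀ i → subᵗ τ (υ i) ≡ ω i) → ∀ A → subᵗ τ (subᵗ υ A) ≡ subᵗ ω A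
subᵗ-subᵗ {τ = τ} {υ} {ω} h = go
  where
  h↑ : ∀ i → subᵗ (liftᵗ τ) (liftᵗ υ i) ≡ liftᵗ ω i
  h↑ zero    = refl
  h↑ (suc i) = trans (subᵗ-wk τ (υ i)) (cong (renᵗ suc) (h i))
  go : ∀ A → subᵗ τ (subᵗ υ A) ≡ subᵗ ω A
  go (var i)   = h i
  go (covar i) = trans (subᵗ-dual τ (υ i)) (cong dual (h i))
  go (A ⊗ B)   = cong₂ _⊗_ (go A) (go B)
  go (A ⅋ B)   = cong₂ _⅋_ (go A) (go B)
  go (A ⊕ B)   = cong₂ _⊕_ (go A) (go B)
  go (A & B)   = cong₂ _&_ (go A) (go B)
  go 𝟏         = refl
  go ⊥         = refl
  go (∃X A)    = cong ∃X (subᵗ-subᵗ h↑ A)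
  go (∀X A)    = cong ∀X (subᵗ-subᵗ h↑ A)
  go (¿ A)     = cong ¿_ (go A)
  go (! A)     = cong !_ (go A)

subᵗ-id : ∀ {n} {τ : Fin n → Ty n} → (∀ i → τ i ≡ var i) → ∀ A → subᵗ τ A ≡ A
subᵗ-id {τ = τ} h = go
  where
  h↑ : ∀ i → liftᵗ τ i ≡ var i
  h↑ zero    = refl
  h↑ (suc i) = cong (renᵗ suc) (h i)
  go : ∀ A → subᵗ τ A ≡ A
  go (var i)   = h i
  go (covar i) = cong dual (h i)
  go (A ⊗ B)   = cong₂ _⊗_ (go A) (go B)
  go (A ⅋ B)   = cong₂ _⅋_ (go A) (go B)
  go (A ⊕ B)   = cong₂ _⊕_ (go A) (go B)
  go (A & B)   = cong₂ _&_ (go A) (go B)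
  go 𝟏         = refl
  go ⊥         = refl
  go (∃X A)    = cong ∃X (subᵗ-id h↑ A)
  go (∀X A)    = cong ∀X (subᵗ-id h↑ A)
  go (¿ A)     = cong ¿_ (go A)
  go (! A)     = cong !_ (go A)

inst-wk : ∀ {n} (A B : Ty n) → renᵗ suc B ⟦ A ⟧ ≡ B
inst-wk A B = trans (subᵗ-renᵗ (λ _ → refl) B) (subᵗ-id (λ _ → refl) B)

-- Both sides fuse to the same substitution in `B`. This is what rule `R∃` needs to survive a type
-- substitution.
subᵗ-⟦⟧ : ∀ {m n} (τ : Fin m → Ty n) B A →
          subᵗ τ (B ⟦ A ⟧) ≡ subᵗ (liftᵗ τ) B ⟦ subᵗ τ A ⟧
subᵗ-⟦⟧ τ B A = trans (subᵗ-subᵗ (λ _ → refl) B) (sym (subᵗ-subᵗ h B))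
  where
  h : ∀ i → liftᵗ τ i ⟦ subᵗ τ A ⟧ ≡ subᵗ τ (inst A i)
  h zero    = refl
  h (suc i) = inst-wk (subᵗ τ A) (τ i)

module NonInterference (𝒩 : NameSet) where

  open πLL 𝒩
  open DecMembership _≟_ using (_∈?_)

  -- Hyperenvironments and names

  module _ {n : ℕ} where
    open SetoidPerm (↭-setoid {A = Name × Ty n}) public
      using () renaming (↭-refl to ≋-refl; ↭-sym to ≋-sym; ↭-trans to ≋-trans; ↭-reflexive to ≡⇒≋)
    open SetoidPermProps (↭-setoid {A = Name × Ty n}) public
      using () renaming (Any-resp-↭ to Any-resp-≋; map⁺ to ≋-map⁺)

  names : ∀ {n} → HEnv n → List Name
  names 𝒢 = dom (concat 𝒢)

  -- Membership in `concat` forgets how names are divided into environments; this predicate recovers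
  -- it in a form invariant under `≋`, so that no explicit permutation has to be followed through a
  -- transition.
  Together : ∀ {n} → HEnv n → Name → Name → Set
  Together 𝒢 w w′ = Any (λ Γ → w ∈ dom Γ × w′ ∈ dom Γ) 𝒢

  concat-↭ : ∀ {n} {𝒢 ℋ : HEnv n} → 𝒢 ≋ ℋ → concat 𝒢 ↭ concat ℋ
  concat-↭ (Permutation.refl [])      = ↭-refl
  concat-↭ (Permutation.refl (p ∷ q)) = ↭-++⁺ p (concat-↭ (Permutation.refl q))
  concat-↭ (Permutation.prep p q)     = ↭-++⁺ p (concat-↭ q)
  concat-↭ (Permutation.swap {x = Γ} {y = Δ} p q r) =
    ↭-trans (shifts Γ Δ) (↭-++⁺ q (↭-++⁺ p (concat-↭ r)))
  concat-↭ (Permutation.trans p q)    = ↭-trans (concat-↭ p) (concat-↭ q)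

  dom-↭ : ∀ {n} {Γ Δ : Env n} → Γ ↭ Δ → dom Γ ↭ dom Δ
  dom-↭ = ↭-map⁺ proj₁

  names-≋ : ∀ {n} {𝒢 ℋ : HEnv n} {w} → 𝒢 ≋ ℋ → w ∈ names 𝒢 → w ∈ names ℋ
  names-≋ e = ∈-resp-↭ (dom-↭ (concat-↭ e))

  unique-↭ : ∀ {n} {Γ Δ : Env n} → Γ ↭ Δ → Unique (dom Γ) → Unique (dom Δ)
  unique-↭ p = SetoidPermProps.Unique-resp-↭ (setoid Name) (↭⇒↭ₛ (dom-↭ p))

  distinct-≋ : ∀ {n} {𝒢 ℋ : HEnv n} → 𝒢 ≋ ℋ → Distinct 𝒢 → Distinct ℋ
  distinct-≋ e = unique-↭ (concat-↭ e)

  together-≋ : ∀ {n} {𝒢 ℋ : HEnv n} {w w′} → 𝒢 ≋ ℋ → Together 𝒢 w w′ → Together ℋ w w′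
  together-≋ = Any-resp-≋ λ p (i , j) → ∈-resp-↭ (dom-↭ p) i , ∈-resp-↭ (dom-↭ p) j

  [_]≋ : ∀ {n} {Γ Δ : Env n} → Γ ↭ Δ → [ Γ ] ≋ [ Δ ]
  [ p ]≋ = Permutation.prep p ≋-refl

  dom⁺ : ∀ {n} {Γ : Env n} {w T} → (w , T) ∈ Γ → w ∈ dom Γ
  dom⁺ = ∈-map⁺ proj₁

  dom⁻ : ∀ {n} {Γ : Env n} {w} → w ∈ dom Γ → ∃[ T ] (w , T) ∈ Γ
  dom⁻ i with (_ , T) , j , refl ← ∈-map⁻ proj₁ i = T , j

  dom-++⁻ : ∀ {n} (Γ : Env n) {Δ w} → w ∈ dom (Γ ++ Δ) → w ∈ dom Γ ⊎ w ∈ dom Δ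
  dom-++⁻ Γ {Δ} i rewrite map-++ proj₁ Γ Δ = ∈-++⁻ (dom Γ) i

  dom-++⁺ˡ : ∀ {n} {Γ Δ : Env n} {w} → w ∈ dom Γ → w ∈ dom (Γ ++ Δ)
  dom-++⁺ˡ {Γ = Γ} {Δ} i rewrite map-++ proj₁ Γ Δ = ∈-++⁺ˡ i

  dom-++⁺ʳ : ∀ {n} (Γ : Env n) {Δ w} → w ∈ dom Δ → w ∈ dom (Γ ++ Δ)
  dom-++⁺ʳ Γ {Δ} i rewrite map-++ proj₁ Γ Δ = ∈-++⁺ʳ (dom Γ) i

  ∷-unique⁻ : ∀ {x : Name} {xs} → Unique (x ∷ xs) → x ∉ xs
  ∷-unique⁻ = Unique.Unique[x∷xs]⇒x∉xs

  ∷-unique⁺ : ∀ {x : Name} {xs} → x ∉ xs → Unique xs → Unique (x ∷ xs)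
  ∷-unique⁺ x∉ u = All.tabulate (λ i e → x∉ (subst (_∈ _) (sym e) i)) ∷ u

  unique-tail : ∀ {x : Name} {xs} → Unique (x ∷ xs) → Unique xs
  unique-tail (_ ∷ u) = u

  ++-unique⁻ : ∀ (xs : List Name) {ys} → Unique (xs ++ ys) → Unique xs × Unique ys × Disjoint xs ys
  ++-unique⁻ []       u = [] , u , λ ()
  ++-unique⁻ (x ∷ xs) (p ∷ u) with ++-unique⁻ xs u
  ... | v , w , d = All.tabulate (λ i → All.lookup p (∈-++⁺ˡ i)) ∷ v , w , λ where
    (here refl , j) → All.lookup p (∈-++⁺ʳ xs j) refl
    (there i , j)   → d (i , j)

  dom-unique⁻ : ∀ {n} (Γ : Env n) {Δ} → Unique (dom (Γ ++ Δ)) →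
                Unique (dom Γ) × Unique (dom Δ) × Disjoint (dom Γ) (dom Δ)
  dom-unique⁻ Γ {Δ} u = ++-unique⁻ (dom Γ) (subst Unique (map-++ proj₁ Γ Δ) u)

  dom-unique⁺ : ∀ {n} (Γ : Env n) {Δ} → Unique (dom Γ) → Unique (dom Δ) →
                Disjoint (dom Γ) (dom Δ) → Unique (dom (Γ ++ Δ))
  dom-unique⁺ Γ {Δ} u v d = subst Unique (sym (map-++ proj₁ Γ Δ)) (Unique.++⁺ u v d)

  concat-++-↭ : ∀ {n} (𝒢 : HEnv n) {ℋ} → concat (𝒢 ++ ℋ) ↭ concat 𝒢 ++ concat ℋ
  concat-++-↭ 𝒢 {ℋ} = ↭-reflexive (sym (concat-++ 𝒢 ℋ))

  []-↭ : ∀ {n} {𝒢 : HEnv n} {Γ} → 𝒢 ≋ [ Γ ] → concat 𝒢 ↭ Γ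
  []-↭ {Γ = Γ} e = ↭-trans (concat-↭ e) (↭-reflexive (++-identityʳ Γ))

  ∈-∖⁺ : ∀ {xs ys w} → w ∈ xs → w ∉ ys → w ∈ xs ∖ ys
  ∈-∖⁺ {ys = ys} = ∈-filter⁺ (λ x → ¬? (x ∈? ys))

  ∈-∖⁻ : ∀ {xs ys w} → w ∈ xs ∖ ys → w ∈ xs × w ∉ ys
  ∈-∖⁻ {ys = ys} = ∈-filter⁻ (λ x → ¬? (x ∈? ys))

  fresh-∉ : ∀ L → fresh L ∉ L
  fresh-∉ L = proj₂ (infinite L)

  freshes-disjoint : ∀ k L → Disjoint (toList (freshes k L)) L
  freshes-disjoint (suc k) L (here refl , j) = fresh-∉ L j
  freshes-disjoint (suc k) L (there i , j)   = freshes-disjoint k _ (i , there j)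

  freshes-unique : ∀ k L → Unique (toList (freshes k L))
  freshes-unique zero    L = []
  freshes-unique (suc k) L =
    ∷-unique⁺ (λ i → freshes-disjoint k _ (i , here refl)) (freshes-unique k _)

  -- Distinctness and membership depend only on the flattened hyperenvironment, where joining `Γ`
  -- and `Δ` merely removes `x` and `y`. The same shape occurs in the premise of `R⊗`.
  cut-↭ : ∀ {n} {ℋ : HEnv n} {Γ Δ 𝒢 x y A B} → ℋ ≋ (Γ ▸ x ∶ A) ∷ (Δ ▸ y ∶ B) ∷ 𝒢 →
          concat ℋ ↭ (x , A) ∷ (y , B) ∷ concat ((Γ ++ Δ) ∷ 𝒢)
  cut-↭ {Γ = Γ} {Δ} {𝒢} e = ↭-trans (concat-↭ e) (↭-prep _ (↭-trans (shift _ Γ (Δ ++ concat 𝒢))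
    (↭-prep _ (↭-reflexive (sym (++-assoc Γ Δ (concat 𝒢)))))))

  together⇒names : ∀ {n} {𝒢 : HEnv n} {w w′} → Together 𝒢 w w′ → w ∈ names 𝒢 × w′ ∈ names 𝒢
  together⇒names {𝒢 = Γ ∷ 𝒢} (here (i , j)) = dom-++⁺ˡ i , dom-++⁺ˡ j
  together⇒names {𝒢 = Γ ∷ 𝒢} (there t) with i , j ← together⇒names t = dom-++⁺ʳ Γ i , dom-++⁺ʳ Γ j

  not-together : ∀ {n} {Γ Δ : Env n} {𝒢 x y A B} →
                 Distinct ((Γ ▸ x ∶ A) ∷ (Δ ▸ y ∶ B) ∷ 𝒢) →
                 ¬ Together ((Γ ▸ x ∶ A) ∷ (Δ ▸ y ∶ B) ∷ 𝒢) x y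
  not-together {Γ = Γ} {Δ} {𝒢} {x} {y} {A} {B} d = λ where
      (here (_ , j))          → proj₂ (proj₂ u) (j , here refl)
      (there (here (i , _)))  → proj₂ (proj₂ u) (here refl , dom-++⁺ˡ {Γ = Δ ▸ y ∶ B} i)
      (there (there t))       → proj₂ (proj₂ u) (here refl , dom-++⁺ʳ (Δ ▸ y ∶ B) (proj₁ (together⇒names t)))
    where
    u = dom-unique⁻ (Γ ▸ x ∶ A) d

  ∈⇒↭ : ∀ {n} {Γ : Env n} {w T} → (w , T) ∈ Γ → ∃[ Γ′ ] Γ ↭ (Γ′ ▸ w ∶ T)
  ∈⇒↭ {Γ = _ ∷ Γ} (here refl) = Γ , ↭-refl
  ∈⇒↭ {Γ = e ∷ Γ} (there i) with Γ′ , p ← ∈⇒↭ i =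
    e ∷ Γ′ , ↭-trans (↭-prep e p) (↭-swap e _ ↭-refl)

  ∈⇒≋ : ∀ {n} (𝒢 : HEnv n) {w T} → (w , T) ∈ concat 𝒢 →
        ∃[ Γ ] ∃[ 𝒢₀ ] 𝒢 ≋ (Γ ▸ w ∶ T) ∷ 𝒢₀
  ∈⇒≋ (Γ ∷ 𝒢) i with ∈-++⁻ Γ i
  ... | inj₁ j with Γ′ , p ← ∈⇒↭ j = Γ′ , 𝒢 , Permutation.prep p ≋-refl
  ... | inj₂ j with Δ , 𝒢₀ , p ← ∈⇒≋ 𝒢 j =
    Δ , Γ ∷ 𝒢₀ , ≋-trans (Permutation.prep ↭-refl p) (Permutation.swap ↭-refl ↭-refl ≋-refl)

  -- A converse to `not-together`: it exhibits the form demanded by the premise of `Cut` for a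
  -- hyperenvironment known only through its members.
  ∈∈⇒≋ : ∀ {n} (𝒢 : HEnv n) {x y A B} → (x , A) ∈ concat 𝒢 → (y , B) ∈ concat 𝒢 → x ≢ y →
         ¬ Together 𝒢 x y →
         ∃[ Γ ] ∃[ Δ ] ∃[ 𝒢₀ ] 𝒢 ≋ (Γ ▸ x ∶ A) ∷ (Δ ▸ y ∶ B) ∷ 𝒢₀
  ∈∈⇒≋ 𝒢 i j x≢y ¬t with Γ , 𝒢₁ , p ← ∈⇒≋ 𝒢 i with ∈-++⁻ (Γ ▸ _ ∶ _) (∈-resp-↭ (concat-↭ p) j)
  ... | inj₁ k = ⊥-elim (¬t (together-≋ (≋-sym p) (here (here refl , dom⁺ k))))
  ... | inj₂ k with Δ , 𝒢₀ , q ← ∈⇒≋ 𝒢₁ k =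
    Γ , Δ , 𝒢₀ , ≋-trans p (Permutation.prep ↭-refl q)

  -- Free names of derivations

  -- The typing rules of prefixes turn a premise Γ plus the bound names ys (and
  -- possibly x) into the single environment Γ, x : T.
  record Shape {n k} (𝒢 : HEnv n) (x : Name) (ys : Vec Name k) (D : Tree n) : Set where
    constructor shape
    field
      {E Γ}   : Env n
      {T}     : Ty n
      {rest}  : List Name
      premise : Valid D
      concl   : 𝒢 ≋ [ Γ ▸ x ∶ T ]
      perm    : concat (conc D) ↭ E ++ Γ
      dom-E   : dom E ≡ toList ys ++ rest
      rest≡x  : ∀ {w} → w ∈ rest → w ≡ x

  pre-shape : ∀ {n k} {𝒢 : HEnv n} {p : Pre n k} {x ys D} →
              Rule (pre 𝒢 p x ys D) → Shape 𝒢 x ys D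
  pre-shape (R⊗ {x = x} {y} {A} {B} v e g) =
    shape {E = (y , A) ∷ (x , B) ∷ []} {rest = [ x ]} v g
      (↭-trans (cut-↭ e) (↭-prep _ (↭-prep _ ([]-↭ ≋-refl)))) refl λ { (here e) → e }
  pre-shape (R𝟏 v e g) = shape {E = []} {rest = []} v g (concat-↭ e) refl λ ()
  pre-shape (R⅋ {x = x} {y} {A} {B} v e g) =
    shape {E = (y , A) ∷ (x , B) ∷ []} {rest = [ x ]} v g
      (↭-trans ([]-↭ e) (↭-swap _ _ ↭-refl)) refl λ { (here e) → e }
  pre-shape (R⊥ v e g) = shape {E = []} {rest = []} v g ([]-↭ e) refl λ ()
  pre-shape (R⊕₁ {x = x} {A} v e g) =
    shape {E = [ (x , A) ]} {rest = [ x ]} v g ([]-↭ e) refl λ { (here e) → e }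
  pre-shape (R⊕₂ {x = x} {B = B} v e g) =
    shape {E = [ (x , B) ]} {rest = [ x ]} v g ([]-↭ e) refl λ { (here e) → e }
  pre-shape (R! {y = y} {A} v _ e g) = shape {E = [ (y , A) ]} {rest = []} v g ([]-↭ e) refl λ ()
  pre-shape (R? {y = y} {A} v e g) = shape {E = [ (y , A) ]} {rest = []} v g ([]-↭ e) refl λ ()
  pre-shape (RW v e g) = shape {E = []} {rest = []} v g ([]-↭ e) refl λ ()
  pre-shape (RC {x₁ = y} {z} {A} v e g) =
    shape {E = (y , ¿ A) ∷ (z , ¿ A) ∷ []} {rest = []} v g
      (↭-trans ([]-↭ e) (↭-swap _ _ ↭-refl)) refl λ ()
  pre-shape (R∃ {x = x} {A} {B} v e g) =
    shape {E = [ (x , B ⟦ A ⟧) ]} {rest = [ x ]} v g ([]-↭ e) refl λ { (here e) → e }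

  module _ {n k} {𝒢 : HEnv n} {x} {ys : Vec Name k} {D : Tree n} (s : Shape 𝒢 x ys D) where
    open Shape s

    shape-unique : Unique (dom (E ++ Γ))
    shape-unique = unique-↭ perm (Valid.distinct premise)

    bound-unique : Unique (toList ys)
    bound-unique =
      proj₁ (++-unique⁻ (toList ys) (subst Unique dom-E (proj₁ (dom-unique⁻ E shape-unique))))

    bound-disjoint : Disjoint (toList ys) (dom Γ)
    bound-disjoint (i , j) = proj₂ (proj₂ (dom-unique⁻ E shape-unique))
      (subst (_ ∈_) (sym dom-E) (∈-++⁺ˡ i) , j)

    Γ⊆premise : ∀ {w} → w ∈ dom Γ → w ∈ names (conc D)
    Γ⊆premise i = ∈-resp-↭ (↭-sym (dom-↭ perm)) (dom-++⁺ʳ E i)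

    E⊆ : ∀ {w} → w ∈ dom E → w ∈ toList ys ⊎ w ≡ x
    E⊆ i with ∈-++⁻ (toList ys) (subst (_ ∈_) dom-E i)
    ... | inj₁ j = inj₁ j
    ... | inj₂ j = inj₂ (rest≡x j)

    premise⊆ : ∀ {w T} → (w , T) ∈ concat (conc D) → w ∉ toList ys → w ≢ x → (w , T) ∈ Γ
    premise⊆ i w∉ w≢ with ∈-++⁻ E (∈-resp-↭ perm i)
    ... | inj₂ j = j
    ... | inj₁ j with E⊆ (dom⁺ j)
    ...   | inj₁ k = ⊥-elim (w∉ k)
    ...   | inj₂ e = ⊥-elim (w≢ e)

  -- With `fn⊆names`, free names can be read off the conclusion. This turns the freshness conditions
  -- of transitions, which concern processes, into distinctness of hyperenvironments, and shows that
  -- derivations with the same conclusion have the same free names.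
  names⊆fn : ∀ {n w} (D : Tree n) → Valid D → w ∈ names (conc D) → w ∈ fnᵀ D
  names⊆fn (pre 𝒢 p x ys D) (valid d r) i with pre-shape r
  ... | s with ∈-resp-↭ (dom-↭ ([]-↭ (Shape.concl s))) i
  ...   | here e  = here e
  ...   | there j = there (∈-∖⁺ (names⊆fn D (Shape.premise s) (Γ⊆premise s j))
                                (λ k → bound-disjoint s (k , j)))
  names⊆fn (case 𝒢 x D E) (valid d (R& v w e f g)) i with ∈-resp-↭ (dom-↭ ([]-↭ g)) i
  ... | here e  = here e
  ... | there j = there (∈-++⁺ˡ (names⊆fn D v (∈-resp-↭ (dom-↭ (↭-sym ([]-↭ e))) (there j))))
  names⊆fn (all 𝒢 x D) (valid d (R∀ {Γ = Γ} v e g)) i with ∈-resp-↭ (dom-↭ ([]-↭ g)) i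
  ... | here e  = here e
  ... | there j = there (names⊆fn D v (∈-resp-↭ (dom-↭ (↭-sym ([]-↭ e)))
                    (there (subst (_ ∈_) (map-∘ Γ) j))))
  names⊆fn (ν 𝒢 x y D) (valid d (Cut v e g)) i =
    ∈-∖⁺ (names⊆fn D v (∈-resp-↭ (dom-↭ (↭-sym (cut-↭ e))) (there (there j)))) λ where
      (here refl)         → ∷-unique⁻ u (there j)
      (there (here refl)) → ∷-unique⁻ (unique-tail u) j
    where
    j = names-≋ g i
    u = unique-↭ (cut-↭ e) (Valid.distinct v)
  names⊆fn (par 𝒢 D E) (valid d (Mix v w g)) i
    with dom-++⁻ (concat (conc D)) (∈-resp-↭ (dom-↭ (↭-trans (concat-↭ g) (concat-++-↭ (conc D)))) i)
  ... | inj₁ j = ∈-++⁺ˡ (names⊆fn D v j)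
  ... | inj₂ j = ∈-++⁺ʳ (fnᵀ D) (names⊆fn E w j)
  names⊆fn (link 𝒢 x y) (valid d (Ax g)) i with ∈-resp-↭ (dom-↭ ([]-↭ g)) i
  ... | here e         = there (here e)
  ... | there (here e) = here e

  fn⊆names : ∀ {n w} (D : Tree n) → Valid D → w ∈ fnᵀ D → w ∈ names (conc D)
  fn⊆names (pre 𝒢 p x ys D) (valid d r) i with pre-shape r
  ... | s = ∈-resp-↭ (dom-↭ (↭-sym ([]-↭ (Shape.concl s)))) (go i)
    where
    go : ∀ {w} → w ∈ x ∷ (fnᵀ D ∖ toList ys) → w ∈ x ∷ dom (Shape.Γ s)
    go (here e) = here e
    go {w} (there i) with w ≟ x
    ... | yes e = here e
    ... | no w≢ with j , w∉ ← ∈-∖⁻ i with T , k ← dom⁻ (fn⊆names D (Shape.premise s) j) =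
      there (dom⁺ (premise⊆ s k w∉ w≢))
  fn⊆names (case 𝒢 x D E) (valid d (R& {Γ = Γ} v w e f g)) i = ∈-resp-↭ (dom-↭ (↭-sym ([]-↭ g))) (go i)
    where
    go : ∀ {w} → w ∈ x ∷ fnᵀ D ++ fnᵀ E → w ∈ x ∷ dom Γ
    go (here e) = here e
    go (there i) with ∈-++⁻ (fnᵀ D) i
    ... | inj₁ j = ∈-resp-↭ (dom-↭ ([]-↭ e)) (fn⊆names D v j)
    ... | inj₂ j = ∈-resp-↭ (dom-↭ ([]-↭ f)) (fn⊆names E w j)
  fn⊆names (all 𝒢 x D) (valid d (R∀ {Γ = Γ} v e g)) i = ∈-resp-↭ (dom-↭ (↭-sym ([]-↭ g))) (go i)
    where
    go : ∀ {w} → w ∈ x ∷ fnᵀ D → w ∈ x ∷ dom Γ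
    go (here e) = here e
    go (there i) = subst (λ Z → _ ∈ x ∷ Z) (sym (map-∘ Γ)) (∈-resp-↭ (dom-↭ ([]-↭ e)) (fn⊆names D v i))
  fn⊆names (ν 𝒢 x y D) (valid d (Cut v e g)) i
    with j , w∉ ← ∈-∖⁻ i
    with ∈-resp-↭ (dom-↭ (cut-↭ e)) (fn⊆names D v j)
  ... | here e          = ⊥-elim (w∉ (here e))
  ... | there (here e)  = ⊥-elim (w∉ (there (here e)))
  ... | there (there k) = names-≋ (≋-sym g) k
  fn⊆names (par 𝒢 D E) (valid d (Mix v w g)) i =
    ∈-resp-↭ (dom-↭ (↭-sym (↭-trans (concat-↭ g) (concat-++-↭ (conc D))))) (go i)
    where
    go : ∀ {w} → w ∈ fnᵀ D ++ fnᵀ E → w ∈ dom (concat (conc D) ++ concat (conc E))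
    go i with ∈-++⁻ (fnᵀ D) i
    ... | inj₁ j = dom-++⁺ˡ (fn⊆names D v j)
    ... | inj₂ j = dom-++⁺ʳ (concat (conc D)) (fn⊆names E w j)
  fn⊆names (link 𝒢 x y) (valid d (Ax g)) i = ∈-resp-↭ (dom-↭ (↭-sym ([]-↭ g))) (go i)
    where
    go : ∀ {w} → w ∈ x ∷ y ∷ [] → w ∈ y ∷ x ∷ []
    go (here e)         = there (here e)
    go (there (here e)) = here e

  -- Renaming derivations

  InjectiveOn : Subst → List Name → Set
  InjectiveOn σ xs = ∀ {a b} → a ∈ xs → b ∈ xs → σ a ≡ σ b → a ≡ b

  update-≡ : ∀ σ x y → (σ [ x ↦ y ]) x ≡ y
  update-≡ σ x y with x ≟ x
  ... | yes _  = refl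
  ... | no x≢x = ⊥-elim (x≢x refl)

  update-≢ : ∀ σ {x y z} → z ≢ x → (σ [ x ↦ y ]) z ≡ σ z
  update-≢ σ {x} {z = z} z≢x with z ≟ x
  ... | yes e = ⊥-elim (z≢x e)
  ... | no _  = refl

  updates-∉ : ∀ {k σ w} (ys zs : Vec Name k) → w ∉ toList ys → (σ [ ys ↦* zs ]) w ≡ σ w
  updates-∉ []       []       w∉ = refl
  updates-∉ (y ∷ ys) (z ∷ zs) w∉ =
    trans (update-≢ _ (w∉ ∘ here)) (updates-∉ ys zs (w∉ ∘ there))

  updates-∈ : ∀ {k σ w} (ys zs : Vec Name k) → w ∈ toList ys → (σ [ ys ↦* zs ]) w ∈ toList zs
  updates-∈ {w = w} (y ∷ ys) (z ∷ zs) i with w ≟ y | i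
  ... | yes _  | _       = here refl
  ... | no w≢y | here e  = ⊥-elim (w≢y e)
  ... | no _   | there j = there (updates-∈ ys zs j)

  updates-injective : ∀ {k σ} (ys zs : Vec Name k) → Unique (toList zs) →
                      InjectiveOn (σ [ ys ↦* zs ]) (toList ys)
  updates-injective (y ∷ ys) (z ∷ zs) u {a} {b} i j e with a ≟ y | b ≟ y
  ... | yes p | yes q = trans p (sym q)
  ... | yes p | no q  = ⊥-elim (∷-unique⁻ u (subst (_∈ _) (sym e) (updates-∈ ys zs (Any.tail q j))))
  ... | no p  | yes q = ⊥-elim (∷-unique⁻ u (subst (_∈ _) e (updates-∈ ys zs (Any.tail p i))))
  ... | no p  | no q  = updates-injective ys zs (unique-tail u) (Any.tail p i) (Any.tail q j) e

  updates-injectiveOn : ∀ {k σ xs} (ys zs : Vec Name k) → Unique (toList zs) →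
                        Disjoint (toList zs) (map σ (xs ∖ toList ys)) →
                        InjectiveOn σ (xs ∖ toList ys) → InjectiveOn (σ [ ys ↦* zs ]) xs
  updates-injectiveOn {σ = σ} {xs} ys zs u d inj {a} {b} i j e with a ∈? toList ys | b ∈? toList ys
  ... | yes p | yes q = updates-injective ys zs u p q e
  ... | yes p | no q  = ⊥-elim (d
    (subst (_∈ _) (trans e (updates-∉ ys zs q)) (updates-∈ ys zs p) , ∈-map⁺ σ (∈-∖⁺ j q)))
  ... | no p  | yes q = ⊥-elim (d
    (subst (_∈ _) (trans (sym e) (updates-∉ ys zs p)) (updates-∈ ys zs q) , ∈-map⁺ σ (∈-∖⁺ i p)))
  ... | no p  | no q  = inj (∈-∖⁺ i p) (∈-∖⁺ j q)
                            (trans (sym (updates-∉ ys zs p)) (trans e (updates-∉ ys zs q)))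

  -- Both the update and the binder list resolve `w` at its first occurrence in `ys`. Passing a pair
  -- with `there` also requires the image to differ from `z`: for later names of `ys` this is
  -- distinctness of `zs`, for all other names it is absence of capture.
  updates-≐ : ∀ {k σ w ρ} (ys zs : Vec Name k) → Unique (toList zs) →
              (w ∉ toList ys → ρ ⊢ w ≐ σ w × σ w ∉ toList zs) →
              (toList (Vec.zip ys zs) ++ ρ) ⊢ w ≐ (σ [ ys ↦* zs ]) w
  updates-≐ [] [] u h = proj₁ (h λ ())
  updates-≐ {σ = σ} {w} (y ∷ ys) (z ∷ zs) u h with w ≟ y
  ... | yes refl = here
  ... | no w≢y   = there w≢y z≢ (updates-≐ ys zs (unique-tail u) λ w∉ → proj₁ (h′ w∉) , proj₂ (h′ w∉) ∘ there)
    where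
    h′ : w ∉ toList ys → _
    h′ w∉ = h λ { (here e) → w≢y e ; (there i) → w∉ i }
    z≢ : (σ [ ys ↦* zs ]) w ≢ z
    z≢ e with w ∈? toList ys
    ... | yes i = ∷-unique⁻ u (subst (_∈ _) e (updates-∈ ys zs i))
    ... | no w∉ = proj₂ (h′ w∉) (here (trans (sym (updates-∉ ys zs w∉)) e))

  -- D′ is D under σ, for an arbitrary capture-avoiding choice of bound names.
  data Renamed : ∀ {n} → Subst → Tree n → Tree n → Set where
    pre  : ∀ {n k σ 𝒢} {p : Pre n k} {x ys zs D D′} → Unique (toList zs) →
           Disjoint (toList zs) (map σ (fnᵀ D ∖ toList ys)) →
           Renamed (σ [ ys ↦* zs ]) D D′ →
           Renamed σ (pre 𝒢 p x ys D) (pre (map (renᴱ σ) 𝒢) p (σ x) zs D′)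
    case : ∀ {n σ 𝒢 x} {D D′ E E′ : Tree n} → Renamed σ D D′ → Renamed σ E E′ →
           Renamed σ (case 𝒢 x D E) (case (map (renᴱ σ) 𝒢) (σ x) D′ E′)
    all  : ∀ {n σ 𝒢 x} {D D′ : Tree (suc n)} → Renamed σ D D′ →
           Renamed σ (all 𝒢 x D) (all (map (renᴱ σ) 𝒢) (σ x) D′)
    ν    : ∀ {n σ 𝒢 x y x′ y′} {D D′ : Tree n} → Unique (x′ ∷ y′ ∷ []) →
           Disjoint (x′ ∷ y′ ∷ []) (map σ (fnᵀ D ∖ (x ∷ y ∷ []))) →
           Renamed (σ [ x ∷ y ∷ [] ↦* x′ ∷ y′ ∷ [] ]) D D′ →
           Renamed σ (ν 𝒢 x y D) (ν (map (renᴱ σ) 𝒢) x′ y′ D′)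
    par  : ∀ {n σ 𝒢} {D D′ E E′ : Tree n} → Renamed σ D D′ → Renamed σ E E′ →
           Renamed σ (par 𝒢 D E) (par (map (renᴱ σ) 𝒢) D′ E′)
    nil  : ∀ {n σ} → Renamed {n} σ nil nil
    link : ∀ {n σ 𝒢 x y} →
           Renamed {n} σ (link 𝒢 x y) (link (map (renᴱ σ) 𝒢) (σ x) (σ y))

  renᵀ-renamed : ∀ {n} σ (D : Tree n) → Renamed σ D (renᵀ σ D)
  renᵀ-renamed σ (pre {k} 𝒢 p x ys D) =
    pre (freshes-unique k _) (freshes-disjoint k _) (renᵀ-renamed _ D)
  renᵀ-renamed σ (case 𝒢 x D E) = case (renᵀ-renamed σ D) (renᵀ-renamed σ E)
  renᵀ-renamed σ (all 𝒢 x D)    = all (renᵀ-renamed σ D)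
  renᵀ-renamed σ (ν 𝒢 x y D)    = ν (freshes-unique 2 _) (freshes-disjoint 2 _) (renᵀ-renamed _ D)
  renᵀ-renamed σ (par 𝒢 D E)    = par (renᵀ-renamed σ D) (renᵀ-renamed σ E)
  renᵀ-renamed σ nil            = nil
  renᵀ-renamed σ (link 𝒢 x y)   = link

  -- Only restrictions outside of all prefixes are constrained, as these are the binders that an
  -- action has to cross. The names bound by a consumed prefix are chosen by the label instead.
  Avoids : ∀ {n} → List Name → Proc n → Set
  Avoids L (ν x y P) = x ∉ L × y ∉ L × Avoids L P
  Avoids L (P ∥ Q)   = Avoids L P × Avoids L Q
  Avoids L _         = ⊤

  -- `renᵀ` fixes its own bound names and cannot be told to avoid `L`, which is why renaming is also
  -- given as the relation `Renamed`. Below a prefix, where `Avoids` asks nothing, `renᵀ` is good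
  -- enough.
  freshen : ∀ {n} σ L (D : Tree n) → ∃[ D′ ] Renamed σ D D′ × Avoids L (proc D′)
  freshen σ L D@(pre _ _ _ _ _) = _ , renᵀ-renamed σ D , tt
  freshen σ L D@(case _ _ _ _)  = _ , renᵀ-renamed σ D , tt
  freshen σ L D@(all _ _ _)     = _ , renᵀ-renamed σ D , tt
  freshen σ L D@nil             = _ , renᵀ-renamed σ D , tt
  freshen σ L D@(link _ _ _)    = _ , renᵀ-renamed σ D , tt
  freshen σ L (par 𝒢 D E)
    with _ , r , a ← freshen σ L D | _ , s , b ← freshen σ L E = _ , par r s , a , b
  freshen σ L (ν 𝒢 x y D) =
    _ , ν u (λ (i , j) → d (i , ∈-++⁺ʳ L j)) (proj₁ (proj₂ rec)) ,
        (λ i → d (here refl , ∈-++⁺ˡ i)) , (λ i → d (there (here refl) , ∈-++⁺ˡ i)) , proj₂ (proj₂ rec)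
    where
    F   = L ++ map σ (fnᵀ D ∖ (x ∷ y ∷ []))
    u   = freshes-unique 2 F
    d   = freshes-disjoint 2 F
    rec = freshen (σ [ x ∷ y ∷ [] ↦* freshes 2 F ]) L D

  renamed-conc : ∀ {n σ} {D D′ : Tree n} → Renamed σ D D′ → conc D′ ≡ map (renᴱ σ) (conc D)
  renamed-conc (pre _ _ _) = refl
  renamed-conc (case _ _)  = refl
  renamed-conc (all _)     = refl
  renamed-conc (ν _ _ _)   = refl
  renamed-conc (par _ _)   = refl
  renamed-conc nil         = refl
  renamed-conc link        = refl

  renamed-≈ : ∀ {n σ ρ} {D D′ : Tree n} → Renamed σ D D′ →
              (∀ {w} → w ∈ fnᵀ D → ρ ⊢ w ≐ σ w) → ρ ⊢ proc D ≈ proc D′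
  renamed-≈ {σ = σ} (pre {ys = ys} {zs} u d r) h = pre (h (here refl)) (renamed-≈ r λ i →
    updates-≐ ys zs u λ w∉ → h (there (∈-∖⁺ i w∉)) , λ j → d (j , ∈-map⁺ σ (∈-∖⁺ i w∉)))
  renamed-≈ {D = case _ _ D _} (case r s) h =
    case (h (here refl)) (renamed-≈ r (h ∘ there ∘ ∈-++⁺ˡ)) (renamed-≈ s (h ∘ there ∘ ∈-++⁺ʳ (fnᵀ D)))
  renamed-≈ (all r) h = all (h (here refl)) (renamed-≈ r (h ∘ there))
  renamed-≈ {σ = σ} (ν {x = x} {y} {x′} {y′} u d r) h = ν (renamed-≈ r λ i →
    updates-≐ (x ∷ y ∷ []) (x′ ∷ y′ ∷ []) u λ w∉ →
      h (∈-∖⁺ i w∉) , λ j → d (j , ∈-map⁺ σ (∈-∖⁺ i w∉)))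
  renamed-≈ {D = par _ D _} (par r s) h =
    renamed-≈ r (h ∘ ∈-++⁺ˡ) ∥ renamed-≈ s (h ∘ ∈-++⁺ʳ (fnᵀ D))
  renamed-≈ nil  h = nil
  renamed-≈ link h = link (h (here refl)) (h (there (here refl)))

  names-renᴱ : ∀ {n} σ (𝒢 : HEnv n) → names (map (renᴱ σ) 𝒢) ≡ map σ (names 𝒢)
  names-renᴱ σ 𝒢 = trans (cong dom (concat-map 𝒢))
    (trans (sym (map-∘ (concat 𝒢))) (map-∘ (concat 𝒢)))

  map-unique : ∀ {σ} xs → InjectiveOn σ xs → Unique xs → Unique (map σ xs)
  map-unique []       inj u = []
  map-unique {σ} (x ∷ xs) inj u =
    ∷-unique⁺ x∉ (map-unique xs (λ i j → inj (there i) (there j)) (unique-tail u))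
    where
    x∉ : σ x ∉ map σ xs
    x∉ i with y , j , e ← ∈-map⁻ σ i =
      ∷-unique⁻ u (subst (_∈ xs) (sym (inj (here refl) (there j) e)) j)

  renᴱ-distinct : ∀ {n σ} {𝒢 : HEnv n} → InjectiveOn σ (names 𝒢) → Distinct 𝒢 →
                  Distinct (map (renᴱ σ) 𝒢)
  renᴱ-distinct {σ = σ} {𝒢} inj d =
    subst Unique (sym (names-renᴱ σ 𝒢)) (map-unique (names 𝒢) inj d)

  renᴱ-cong : ∀ {n σ υ} (Γ : Env n) → (∀ {w} → w ∈ dom Γ → σ w ≡ υ w) → renᴱ σ Γ ≡ renᴱ υ Γ
  renᴱ-cong []      h = refl
  renᴱ-cong (_ ∷ Γ) h = cong₂ (λ w → (w , _) ∷_) (h (here refl)) (renᴱ-cong Γ (h ∘ there))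

  renᴱ-wk : ∀ {n} σ (Γ : Env n) → renᴱ σ (wkᴱ Γ) ≡ wkᴱ (renᴱ σ Γ)
  renᴱ-wk σ Γ = trans (sym (map-∘ Γ)) (map-∘ Γ)

  renᴱ-whyNot : ∀ {n σ} {Γ : Env n} → WhyNot Γ → WhyNot (renᴱ σ Γ)
  renᴱ-whyNot w = All.map⁺ w

  ≋-renᴱ : ∀ {n σ} {𝒢 ℋ : HEnv n} → 𝒢 ≋ ℋ → map (renᴱ σ) 𝒢 ≋ map (renᴱ σ) ℋ
  ≋-renᴱ {σ = σ} = ≋-map⁺ ↭-setoid (↭-map⁺ (map₁ σ))

  ▸-cong : ∀ {n Γ Δ x y} {A : Ty n} → Γ ≡ Δ → x ≡ y → (Γ ▸ x ∶ A) ≡ (Δ ▸ y ∶ A)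
  ▸-cong refl refl = refl

  renᴱ-++ : ∀ {n} σ (Γ Δ : Env n) → renᴱ σ (Γ ++ Δ) ≡ renᴱ σ Γ ++ renᴱ σ Δ
  renᴱ-++ σ Γ Δ = map-++ (map₁ σ) Γ Δ

  module _ {n k} σ {𝒢 𝒢′ : HEnv n} {x} {ys : Vec Name k} zs {D : Tree n} (s : Shape 𝒢 x ys D)
           (eq : 𝒢′ ≡ map (renᴱ (σ [ ys ↦* zs ])) (conc D)) where

    renamed-context : ∀ (Δ : Env n) → (∀ {w} → w ∈ dom Δ → w ∈ dom (Shape.Γ s)) →
                      renᴱ (σ [ ys ↦* zs ]) Δ ≡ renᴱ σ Δ
    renamed-context Δ h =
      renᴱ-cong Δ λ i → updates-∉ ys zs λ j → bound-disjoint s (j , h i)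

    renamed-premise : ∀ {ℋ} → conc D ≋ ℋ → 𝒢′ ≋ map (renᴱ (σ [ ys ↦* zs ])) ℋ
    renamed-premise e = ≋-trans (≡⇒≋ eq) (≋-renᴱ e)

  pre-renamed : ∀ {n k σ 𝒢} {p : Pre n k} {x ys zs D D′} → Rule (pre 𝒢 p x ys D) → Valid D′ →
                conc D′ ≡ map (renᴱ (σ [ ys ↦* zs ])) (conc D) →
                Rule (pre (map (renᴱ σ) 𝒢) p (σ x) zs D′)
  pre-renamed {σ = σ} {zs = zs@(z ∷ [])} r@(R⊗ {Γ = Γ} {Δ} {x} {y} v e g) w eq = R⊗ w
    (≋-trans (renamed-premise σ zs s eq e) (≡⇒≋ (cong₂ (λ a b → a ∷ b ∷ [])
      (▸-cong (renamed-context σ zs s eq Γ dom-++⁺ˡ) (update-≡ σ y z))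
      (▸-cong (renamed-context σ zs s eq Δ (dom-++⁺ʳ Γ)) (update-≢ σ x≢y)))))
    (≋-trans (≋-renᴱ g) (≡⇒≋ (cong (λ a → [ a ▸ σ x ∶ _ ]) (renᴱ-++ σ Γ Δ))))
    where
    s = pre-shape r
    x≢y : x ≢ y
    x≢y e = ∷-unique⁻ (shape-unique s) (here (sym e))
  pre-renamed {zs = []} (R𝟏 v e g) w eq = R𝟏 w (≋-trans (≡⇒≋ eq) (≋-renᴱ e)) (≋-renᴱ g)
  pre-renamed {σ = σ} {zs = zs@(z ∷ [])} r@(R⅋ {Γ = Γ} {x} {y} v e g) w eq = R⅋ w
    (≋-trans (renamed-premise σ zs s eq e) (≡⇒≋ (cong [_]
      (▸-cong (▸-cong (renamed-context σ zs s eq Γ id) (update-≡ σ y z)) (update-≢ σ x≢y)))))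
    (≋-renᴱ g)
    where
    s = pre-shape r
    x≢y : x ≢ y
    x≢y e = ∷-unique⁻ (shape-unique s) (here (sym e))
  pre-renamed {zs = []} (R⊥ v e g) w eq = R⊥ w (≋-trans (≡⇒≋ eq) (≋-renᴱ e)) (≋-renᴱ g)
  pre-renamed {zs = []} (R⊕₁ v e g) w eq = R⊕₁ w (≋-trans (≡⇒≋ eq) (≋-renᴱ e)) (≋-renᴱ g)
  pre-renamed {zs = []} (R⊕₂ v e g) w eq = R⊕₂ w (≋-trans (≡⇒≋ eq) (≋-renᴱ e)) (≋-renᴱ g)
  pre-renamed {σ = σ} {zs = zs@(z ∷ [])} r@(R! {Γ = Γ} {y = y} v q e g) w eq = R! w (renᴱ-whyNot q)
    (≋-trans (renamed-premise σ zs s eq e) (≡⇒≋ (cong [_]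
      (▸-cong (renamed-context σ zs s eq Γ id) (update-≡ σ y z)))))
    (≋-renᴱ g)
    where s = pre-shape r
  pre-renamed {σ = σ} {zs = zs@(z ∷ [])} r@(R? {Γ = Γ} {y = y} v e g) w eq = R? w
    (≋-trans (renamed-premise σ zs s eq e) (≡⇒≋ (cong [_]
      (▸-cong (renamed-context σ zs s eq Γ id) (update-≡ σ y z)))))
    (≋-renᴱ g)
    where s = pre-shape r
  pre-renamed {zs = []} (RW v e g) w eq = RW w (≋-trans (≡⇒≋ eq) (≋-renᴱ e)) (≋-renᴱ g)
  pre-renamed {σ = σ} {zs = zs@(z ∷ z′ ∷ [])} r@(RC {Γ = Γ} {x₁ = y} {y′} v e g) w eq = RC w
    (≋-trans (renamed-premise σ zs s eq e) (≡⇒≋ (cong [_]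
      (▸-cong (▸-cong (renamed-context σ zs s eq Γ id) (update-≡ _ y z))
              (trans (update-≢ (σ [ y′ ∷ [] ↦* z′ ∷ [] ]) y′≢y) (update-≡ σ y′ z′))))))
    (≋-renᴱ g)
    where
    s = pre-shape r
    y′≢y : y′ ≢ y
    y′≢y e = ∷-unique⁻ (shape-unique s) (here (sym e))
  pre-renamed {zs = []} (R∃ v e g) w eq = R∃ w (≋-trans (≡⇒≋ eq) (≋-renᴱ e)) (≋-renᴱ g)

  -- Injectivity on free names keeps the names of a conclusion distinct. It persists under binders
  -- because the new bound names are distinct and avoid the images of the remaining free names.
  renamed-valid : ∀ {n σ} {D D′ : Tree n} → Renamed σ D D′ → Valid D → InjectiveOn σ (fnᵀ D) → Valid D′
  renamed-valid {σ = σ} {D} {D′} r v@(valid d rule) inj = valid distinct (go r rule inj)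
    where
    distinct : Distinct (conc D′)
    distinct = subst Distinct (sym (renamed-conc r))
      (renᴱ-distinct {𝒢 = conc D} (λ i j → inj (names⊆fn D v i) (names⊆fn D v j)) d)
    go : ∀ {E E′} → Renamed σ E E′ → Rule E → InjectiveOn σ (fnᵀ E) → Rule E′
    go (pre {ys = ys} {zs} u d r) rule inj = pre-renamed rule
      (renamed-valid r (Shape.premise (pre-shape rule))
        (updates-injectiveOn ys zs u d λ i j → inj (there i) (there j)))
      (renamed-conc r)
    go (case {D = D} r s) (R& v w e f g) inj = R&
      (renamed-valid r v λ i j → inj (there (∈-++⁺ˡ i)) (there (∈-++⁺ˡ j)))
      (renamed-valid s w λ i j → inj (there (∈-++⁺ʳ (fnᵀ D) i)) (there (∈-++⁺ʳ (fnᵀ D) j)))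
      (≋-trans (≡⇒≋ (renamed-conc r)) (≋-renᴱ e)) (≋-trans (≡⇒≋ (renamed-conc s)) (≋-renᴱ f)) (≋-renᴱ g)
    go (all r) (R∀ {Γ = Γ} v e g) inj = R∀
      (renamed-valid r v λ i j → inj (there i) (there j))
      (≋-trans (≡⇒≋ (renamed-conc r)) (≋-trans (≋-renᴱ e)
        (≡⇒≋ (cong (λ Γ → [ Γ ▸ _ ∶ _ ]) (renᴱ-wk σ Γ)))))
      (≋-renᴱ g)
    go (ν {𝒢 = 𝒢} {x} {y} {x′} {y′} {D} {D′} u d r) (Cut {𝒢₀ = 𝒢₀} {Γ} {Δ} {A = A} v e g) inj = Cut
      (renamed-valid r v (updates-injectiveOn (x ∷ y ∷ []) (x′ ∷ y′ ∷ []) u d inj))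
      (≋-trans (≡⇒≋ (renamed-conc r)) (≋-trans (≋-renᴱ e) (≡⇒≋ (cong₂ _∷_
        (▸-cong (env Γ (λ i → dom-++⁺ˡ (dom-++⁺ˡ i))) (update-≡ _ x x′)) (cong₂ _∷_
        (▸-cong (env Δ (λ i → dom-++⁺ˡ (dom-++⁺ʳ Γ i))) (trans (update-≢ _ y≢x) (update-≡ σ y y′)))
        (henv 𝒢₀ (dom-++⁺ʳ (Γ ++ Δ))))))))
      (≋-trans (≋-renᴱ g) (≡⇒≋ (cong (_∷ _) (renᴱ-++ σ Γ Δ))))
      where
      unique : Unique (x ∷ y ∷ names ((Γ ++ Δ) ∷ 𝒢₀))
      unique = unique-↭ (cut-↭ e) (Valid.distinct v)
      y≢x : y ≢ x
      y≢x e = ∷-unique⁻ unique (here (sym e))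
      -- By distinctness of the premise, `Γ`, `Δ` and `𝒢₀` contain neither `x` nor `y`, so the
      -- updated substitution acts on them as `σ`.
      env : ∀ Θ → (∀ {w} → w ∈ dom Θ → w ∈ names ((Γ ++ Δ) ∷ 𝒢₀)) →
            renᴱ (σ [ x ∷ y ∷ [] ↦* x′ ∷ y′ ∷ [] ]) Θ ≡ renᴱ σ Θ
      env Θ h = renᴱ-cong Θ λ i → updates-∉ (x ∷ y ∷ []) (x′ ∷ y′ ∷ []) λ where
        (here refl)         → ∷-unique⁻ unique (there (h i))
        (there (here refl)) → ∷-unique⁻ (unique-tail unique) (h i)
      henv : ∀ ℋ → (∀ {w} → w ∈ names ℋ → w ∈ names ((Γ ++ Δ) ∷ 𝒢₀)) →
             map (renᴱ (σ [ x ∷ y ∷ [] ↦* x′ ∷ y′ ∷ [] ])) ℋ ≡ map (renᴱ σ) ℋ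
      henv []      h = refl
      henv (Θ ∷ ℋ) h = cong₂ _∷_ (env Θ (h ∘ dom-++⁺ˡ)) (henv ℋ (h ∘ dom-++⁺ʳ Θ))
    go (par {D = D} r s) (Mix v w g) inj = Mix
      (renamed-valid r v λ i j → inj (∈-++⁺ˡ i) (∈-++⁺ˡ j))
      (renamed-valid s w λ i j → inj (∈-++⁺ʳ (fnᵀ D) i) (∈-++⁺ʳ (fnᵀ D) j))
      (≋-trans (≋-renᴱ g) (≡⇒≋ (trans (map-++ (renᴱ σ) (conc D) _)
        (sym (cong₂ _++_ (renamed-conc r) (renamed-conc s))))))
    go nil  Mix₀   inj = Mix₀
    go link (Ax g) inj = Ax (≋-renᴱ g)

  -- α-equivalence

  -- The part of validity on which the equivalence laws depend: `ν×` crosses the two pairs of bound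
  -- names, and restoring their order is sound only if neither name shadows the other.
  Proper : ∀ {n} → Proc n → Set
  Proper (pre p x ys P) = Proper P
  Proper (case x P Q)   = Proper P × Proper Q
  Proper (all x P)      = Proper P
  Proper (ν x y P)      = x ≢ y × Proper P
  Proper (P ∥ Q)        = Proper P × Proper Q
  Proper nil            = ⊤
  Proper (link x y)     = ⊤

  valid⇒proper : ∀ {n} (D : Tree n) → Valid D → Proper (proc D)
  valid⇒proper (pre 𝒢 p x ys D) (valid _ r)              = valid⇒proper D (Shape.premise (pre-shape r))
  valid⇒proper (case 𝒢 x D E)   (valid _ (R& v w _ _ _)) = valid⇒proper D v , valid⇒proper E w
  valid⇒proper (all 𝒢 x D)      (valid _ (R∀ v _ _))     = valid⇒proper D v
  valid⇒proper (ν 𝒢 x y D)      (valid _ (Cut v e _))    =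
    (λ x≡y → ∷-unique⁻ (unique-↭ (cut-↭ e) (Valid.distinct v)) (here x≡y)) , valid⇒proper D v
  valid⇒proper (par 𝒢 D E)      (valid _ (Mix v w _))    = valid⇒proper D v , valid⇒proper E w
  valid⇒proper nil              _                        = tt
  valid⇒proper (link 𝒢 x y)     _                        = tt

  -- Binder lists matter only through the relation on names that they induce. Comparing these
  -- relations, here and in `Converse` and `Composes`, makes exchange, symmetry and transitivity
  -- stable under further binders.
  Refines : Binders → Binders → Set
  Refines ρ₁ ρ₂ = ∀ {a b} → ρ₁ ⊢ a ≐ b → ρ₂ ⊢ a ≐ b

  refines-∷ : ∀ {ρ₁ ρ₂ x y} → Refines ρ₁ ρ₂ → Refines ((x , y) ∷ ρ₁) ((x , y) ∷ ρ₂)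
  refines-∷ h here          = here
  refines-∷ h (there p q r) = there p q (h r)

  refines-++ : ∀ {ρ₁ ρ₂} ρ → Refines ρ₁ ρ₂ → Refines (ρ ++ ρ₁) (ρ ++ ρ₂)
  refines-++ []      h = h
  refines-++ (_ ∷ ρ) h = refines-∷ (refines-++ ρ h)

  ≈-refine : ∀ {n ρ₁ ρ₂} {P Q : Proc n} → Refines ρ₁ ρ₂ → ρ₁ ⊢ P ≈ Q → ρ₂ ⊢ P ≈ Q
  ≈-refine h (pre {ys = ys} {ys′} e r) = pre (h e) (≈-refine (refines-++ (toList (Vec.zip ys ys′)) h) r)
  ≈-refine h (case e r s) = case (h e) (≈-refine h r) (≈-refine h s)
  ≈-refine h (all e r)    = all (h e) (≈-refine h r)
  ≈-refine h (ν r)        = ν (≈-refine (refines-∷ (refines-∷ h)) r)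
  ≈-refine h (ν× r)       = ν× (≈-refine (refines-∷ (refines-∷ h)) r)
  ≈-refine h (r ∥ s)      = ≈-refine h r ∥ ≈-refine h s
  ≈-refine h nil          = nil
  ≈-refine h (link e f)   = link (h e) (h f)

  exchange : ∀ {ρ x y x′ y′} → x ≢ y → x′ ≢ y′ →
             Refines ((x , x′) ∷ (y , y′) ∷ ρ) ((y , y′) ∷ (x , x′) ∷ ρ)
  exchange p q here                           = there p q here
  exchange p q (there _ _ here)               = here
  exchange p q (there p′ q′ (there p″ q″ r)) = there p″ q″ (there p′ q′ r)

  Converse : Binders → Binders → Set
  Converse ρ₁ ρ₂ = ∀ {a b} → ρ₁ ⊢ a ≐ b → ρ₂ ⊢ b ≐ a

  converse-∷ : ∀ {ρ₁ ρ₂ x y} → Converse ρ₁ ρ₂ → Converse ((x , y) ∷ ρ₁) ((y , x) ∷ ρ₂)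
  converse-∷ h here          = here
  converse-∷ h (there p q r) = there q p (h r)

  converse-zip : ∀ {k ρ₁ ρ₂} (xs ys : Vec Name k) → Converse ρ₁ ρ₂ →
                 Converse (toList (Vec.zip xs ys) ++ ρ₁) (toList (Vec.zip ys xs) ++ ρ₂)
  converse-zip []       []       h = h
  converse-zip (x ∷ xs) (y ∷ ys) h = converse-∷ (converse-zip xs ys h)

  ≈-sym : ∀ {n ρ₁ ρ₂} {P Q : Proc n} → Converse ρ₁ ρ₂ → Proper P → Proper Q → ρ₁ ⊢ P ≈ Q → ρ₂ ⊢ Q ≈ P
  ≈-sym h p       q       (pre {ys = ys} {ys′} e r) = pre (h e) (≈-sym (converse-zip ys ys′ h) p q r)
  ≈-sym h (p , p′) (q , q′) (case e r s) = case (h e) (≈-sym h p q r) (≈-sym h p′ q′ s)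
  ≈-sym h p       q       (all e r)  = all (h e) (≈-sym h p q r)
  ≈-sym h (_ , p) (_ , q) (ν r)      = ν (≈-sym (converse-∷ (converse-∷ h)) p q r)
  ≈-sym h (x≢y , p) (x′≢y′ , q) (ν× r) =
    ν× (≈-refine (exchange (x′≢y′ ∘ sym) x≢y) (≈-sym (converse-∷ (converse-∷ h)) p q r))
  ≈-sym h (p , p′) (q , q′) (r ∥ s)  = ≈-sym h p q r ∥ ≈-sym h p′ q′ s
  ≈-sym h p       q       nil        = nil
  ≈-sym h p       q       (link e f) = link (h e) (h f)

  Composes : Binders → Binders → Binders → Set
  Composes ρ₁ ρ₂ ρ₃ = ∀ {a b c} → ρ₁ ⊢ a ≐ b → ρ₂ ⊢ b ≐ c → ρ₃ ⊢ a ≐ c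

  composes-∷ : ∀ {ρ₁ ρ₂ ρ₃ x y z} → Composes ρ₁ ρ₂ ρ₃ →
               Composes ((x , y) ∷ ρ₁) ((y , z) ∷ ρ₂) ((x , z) ∷ ρ₃)
  composes-∷ h here          here            = here
  composes-∷ h here          (there q _ _)   = ⊥-elim (q refl)
  composes-∷ h (there _ q _) here            = ⊥-elim (q refl)
  composes-∷ h (there p _ r) (there _ q′ r′) = there p q′ (h r r′)

  composes-zip : ∀ {k ρ₁ ρ₂ ρ₃} (xs ys zs : Vec Name k) → Composes ρ₁ ρ₂ ρ₃ →
                 Composes (toList (Vec.zip xs ys) ++ ρ₁) (toList (Vec.zip ys zs) ++ ρ₂)
                          (toList (Vec.zip xs zs) ++ ρ₃)
  composes-zip []       []       []       h = h
  composes-zip (x ∷ xs) (y ∷ ys) (z ∷ zs) h = composes-∷ (composes-zip xs ys zs h)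

  -- Two crossed restrictions compose to a straight one, and one crossed with one straight stays
  -- crossed. When the first is crossed, the pairs of the second appear in the wrong order and are
  -- exchanged before composing.
  ≈-trans : ∀ {n ρ₁ ρ₂ ρ₃} {P Q R : Proc n} → Composes ρ₁ ρ₂ ρ₃ → Proper Q → Proper R →
            ρ₁ ⊢ P ≈ Q → ρ₂ ⊢ Q ≈ R → ρ₃ ⊢ P ≈ R
  ≈-trans h q s (pre {ys = xs} {ys} e r) (pre {ys′ = zs} e′ r′) =
    pre (h e e′) (≈-trans (composes-zip xs ys zs h) q s r r′)
  ≈-trans h (q , q′) (s , s′) (case e r t) (case e′ r′ t′) =
    case (h e e′) (≈-trans h q s r r′) (≈-trans h q′ s′ t t′)
  ≈-trans h q s (all e r) (all e′ r′) = all (h e e′) (≈-trans h q s r r′)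
  ≈-trans h (_ , q) (_ , s) (ν r)  (ν r′)  = ν (≈-trans (composes-∷ (composes-∷ h)) q s r r′)
  ≈-trans h (_ , q) (_ , s) (ν r)  (ν× r′) = ν× (≈-trans (composes-∷ (composes-∷ h)) q s r r′)
  ≈-trans h (x≢ , q) (z≢ , s) (ν× r) (ν r′) =
    ν× (≈-trans (composes-∷ (composes-∷ h)) q s r (≈-refine (exchange x≢ z≢) r′))
  ≈-trans h (x≢ , q) (z≢ , s) (ν× r) (ν× r′) =
    ν (≈-trans (composes-∷ (composes-∷ h)) q s r (≈-refine (exchange x≢ (z≢ ∘ sym)) r′))
  ≈-trans h (q , q′) (s , s′) (r ∥ t) (r′ ∥ t′) = ≈-trans h q s r r′ ∥ ≈-trans h q′ s′ t t′
  ≈-trans h q s nil nil = nil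
  ≈-trans h q s (link e f) (link e′ f′) = link (h e e′) (h f f′)

  zip-∉ : ∀ {k ρ a b} (xs ys : Vec Name k) → a ∉ toList xs →
          (toList (Vec.zip xs ys) ++ ρ) ⊢ a ≐ b → ρ ⊢ a ≐ b × b ∉ toList ys
  zip-∉ []       []       a∉ r    = r , λ ()
  zip-∉ (x ∷ xs) (y ∷ ys) a∉ here = ⊥-elim (a∉ (here refl))
  zip-∉ (x ∷ xs) (y ∷ ys) a∉ (there _ q r) with zip-∉ xs ys (a∉ ∘ there) r
  ... | r′ , b∉ = r′ , λ { (here e) → q e ; (there i) → b∉ i }

  ≈-fn : ∀ {n ρ a} {P Q : Proc n} → ρ ⊢ P ≈ Q → a ∈ fn P → ∃[ b ] b ∈ fn Q × ρ ⊢ a ≐ b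
  ≈-fn (pre e r) (here refl) = _ , here refl , e
  ≈-fn (pre {ys = ys} {ys′} e r) (there i) with j , a∉ ← ∈-∖⁻ i with b , k , r′ ← ≈-fn r j
    with r″ , b∉ ← zip-∉ ys ys′ a∉ r′ = b , there (∈-∖⁺ k b∉) , r″
  ≈-fn (case e r s) (here refl) = _ , here refl , e
  ≈-fn (case {P = P} {P′ = P′} e r s) (there i) with ∈-++⁻ (fn P) i
  ... | inj₁ j with b , k , r′ ← ≈-fn r j = b , there (∈-++⁺ˡ k) , r′
  ... | inj₂ j with b , k , r′ ← ≈-fn s j = b , there (∈-++⁺ʳ (fn P′) k) , r′
  ≈-fn (all e r) (here refl) = _ , here refl , e
  ≈-fn (all e r) (there i) with b , k , r′ ← ≈-fn r i = b , there k , r′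
  ≈-fn (ν {x} {y} {x′} {y′} r) i with j , a∉ ← ∈-∖⁻ i with b , k , r′ ← ≈-fn r j
    with r″ , b∉ ← zip-∉ (x ∷ y ∷ []) (x′ ∷ y′ ∷ []) a∉ r′ = b , ∈-∖⁺ k b∉ , r″
  ≈-fn (ν× {x} {y} {x′} {y′} r) i with j , a∉ ← ∈-∖⁻ i with b , k , r′ ← ≈-fn r j
    with r″ , b∉ ← zip-∉ (x ∷ y ∷ []) (y′ ∷ x′ ∷ []) a∉ r′ =
    b , ∈-∖⁺ k (λ { (here e) → b∉ (there (here e)) ; (there (here e)) → b∉ (here e) }) , r″
  ≈-fn (_∥_ {P} {P′} r s) i with ∈-++⁻ (fn P) i
  ... | inj₁ j with b , k , r′ ← ≈-fn r j = b , ∈-++⁺ˡ k , r′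
  ... | inj₂ j with b , k , r′ ← ≈-fn s j = b , ∈-++⁺ʳ (fn P′) k , r′
  ≈-fn (link e f) (here refl)         = _ , here refl , e
  ≈-fn (link e f) (there (here refl)) = _ , there (here refl) , f

  -- Type substitution in derivations

  names-subᴱ : ∀ {m n} (θ : Fin m → Ty n) 𝒢 → names (map (subᴱ θ) 𝒢) ≡ names 𝒢
  names-subᴱ θ 𝒢 = trans (cong dom (concat-map 𝒢)) (sym (map-∘ (concat 𝒢)))

  ≋-subᴱ : ∀ {m n} {θ : Fin m → Ty n} {𝒢 ℋ} → 𝒢 ≋ ℋ → map (subᴱ θ) 𝒢 ≋ map (subᴱ θ) ℋ
  ≋-subᴱ {θ = θ} = ≋-map⁺ ↭-setoid (↭-map⁺ (map₂ (subᵗ θ)))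

  subᴱ-++ : ∀ {m n} (θ : Fin m → Ty n) Γ Δ → subᴱ θ (Γ ++ Δ) ≡ subᴱ θ Γ ++ subᴱ θ Δ
  subᴱ-++ θ Γ Δ = map-++ (map₂ (subᵗ θ)) Γ Δ

  subᴱ-wk : ∀ {m n} (θ : Fin m → Ty n) Γ → subᴱ (liftᵗ θ) (wkᴱ Γ) ≡ wkᴱ (subᴱ θ Γ)
  subᴱ-wk θ []            = refl
  subᴱ-wk θ ((x , A) ∷ Γ) = cong₂ (λ B Δ → (x , B) ∷ Δ) (subᵗ-wk θ A) (subᴱ-wk θ Γ)

  inst-wkᴱ : ∀ {n} (A : Ty n) Γ → subᴱ (inst A) (wkᴱ Γ) ≡ Γ
  inst-wkᴱ A []            = refl
  inst-wkᴱ A ((x , B) ∷ Γ) = cong₂ (λ B Δ → (x , B) ∷ Δ) (inst-wk A B) (inst-wkᴱ A Γ)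

  subᴱ-whyNot : ∀ {m n} {θ : Fin m → Ty n} {Γ} → WhyNot Γ → WhyNot (subᴱ θ Γ)
  subᴱ-whyNot w = All.map⁺ (All.map (λ { (A , refl) → _ , refl }) w)

  subᵀ-conc : ∀ {m n} (θ : Fin m → Ty n) D → conc (subᵀ θ D) ≡ map (subᴱ θ) (conc D)
  subᵀ-conc θ (pre _ _ _ _ _) = refl
  subᵀ-conc θ (case _ _ _ _)  = refl
  subᵀ-conc θ (all _ _ _)     = refl
  subᵀ-conc θ (ν _ _ _ _)     = refl
  subᵀ-conc θ (par _ _ _)     = refl
  subᵀ-conc θ nil             = refl
  subᵀ-conc θ (link _ _ _)    = refl

  mutual

    -- Needed for the target of `x(A)`. Names are untouched, so distinctness is inherited; the rules
    -- that mention duals, weakening or instantiation rest on the commutation laws for types.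
    subᵀ-valid : ∀ {m n} (θ : Fin m → Ty n) {D} → Valid D → Valid (subᵀ θ D)
    subᵀ-valid θ {D} (valid d r) =
      valid (subst Distinct (sym (subᵀ-conc θ D)) (subst Unique (sym (names-subᴱ θ (conc D))) d))
            (subᵀ-rule θ r)

    subᵀ-premise : ∀ {m n} (θ : Fin m → Ty n) {D 𝒢} → conc D ≋ 𝒢 → conc (subᵀ θ D) ≋ map (subᴱ θ) 𝒢
    subᵀ-premise θ {D} e = ≋-trans (≡⇒≋ (subᵀ-conc θ D)) (≋-subᴱ e)

    subᵀ-rule : ∀ {m n} (θ : Fin m → Ty n) {D} → Rule D → Rule (subᵀ θ D)
    subᵀ-rule θ (Ax {x = x} {y} {A} g) =
      Ax (≋-trans (≋-subᴱ g) (≡⇒≋ (cong (λ B → [ [] ▸ x ∶ B ▸ y ∶ subᵗ θ A ]) (subᵗ-dual θ A))))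
    subᵀ-rule θ (Cut {𝒢₀ = 𝒢₀} {Γ} {Δ} {x} {y} {A} {D} v e g) = Cut (subᵀ-valid θ v)
      (≋-trans (subᵀ-premise θ {D} e) (≡⇒≋ (cong
        (λ B → (subᴱ θ Γ ▸ x ∶ subᵗ θ A) ∷ (subᴱ θ Δ ▸ y ∶ B) ∷ map (subᴱ θ) 𝒢₀)
        (subᵗ-dual θ A))))
      (≋-trans (≋-subᴱ g) (≡⇒≋ (cong (_∷ _) (subᴱ-++ θ Γ Δ))))
    subᵀ-rule θ (Mix {D = D} {E} v w g) = Mix (subᵀ-valid θ v) (subᵀ-valid θ w)
      (≋-trans (≋-subᴱ g) (≡⇒≋ (trans (map-++ (subᴱ θ) (conc D) (conc E))
        (sym (cong₂ _++_ (subᵀ-conc θ D) (subᵀ-conc θ E))))))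
    subᵀ-rule θ Mix₀ = Mix₀
    subᵀ-rule θ (R⊗ {Γ = Γ} {Δ} {x} {D = D} v e g) = R⊗ (subᵀ-valid θ v) (subᵀ-premise θ {D} e)
      (≋-trans (≋-subᴱ g) (≡⇒≋ (cong (λ Γ → [ Γ ▸ x ∶ _ ]) (subᴱ-++ θ Γ Δ))))
    subᵀ-rule θ (R𝟏 {D = D} v e g)    = R𝟏 (subᵀ-valid θ v) (subᵀ-premise θ {D} e) (≋-subᴱ g)
    subᵀ-rule θ (R⅋ {D = D} v e g)    = R⅋ (subᵀ-valid θ v) (subᵀ-premise θ {D} e) (≋-subᴱ g)
    subᵀ-rule θ (R⊥ {D = D} v e g)    = R⊥ (subᵀ-valid θ v) (subᵀ-premise θ {D} e) (≋-subᴱ g)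
    subᵀ-rule θ (R⊕₁ {D = D} v e g)   = R⊕₁ (subᵀ-valid θ v) (subᵀ-premise θ {D} e) (≋-subᴱ g)
    subᵀ-rule θ (R⊕₂ {D = D} v e g)   = R⊕₂ (subᵀ-valid θ v) (subᵀ-premise θ {D} e) (≋-subᴱ g)
    subᵀ-rule θ (R& {D = D} {E} v w e f g) =
      R& (subᵀ-valid θ v) (subᵀ-valid θ w) (subᵀ-premise θ {D} e) (subᵀ-premise θ {E} f) (≋-subᴱ g)
    subᵀ-rule θ (R! {D = D} v q e g)  = R! (subᵀ-valid θ v) (subᴱ-whyNot q) (subᵀ-premise θ {D} e) (≋-subᴱ g)
    subᵀ-rule θ (R? {D = D} v e g)    = R? (subᵀ-valid θ v) (subᵀ-premise θ {D} e) (≋-subᴱ g)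
    subᵀ-rule θ (RW {D = D} v e g)    = RW (subᵀ-valid θ v) (subᵀ-premise θ {D} e) (≋-subᴱ g)
    subᵀ-rule θ (RC {D = D} v e g)    = RC (subᵀ-valid θ v) (subᵀ-premise θ {D} e) (≋-subᴱ g)
    subᵀ-rule θ (R∃ {x = x} {A} {B} {D} v e g) = R∃ (subᵀ-valid θ v)
      (≋-trans (subᵀ-premise θ {D} e) (≡⇒≋ (cong (λ C → [ _ ▸ x ∶ C ]) (subᵗ-⟦⟧ θ B A))))
      (≋-subᴱ g)
    subᵀ-rule θ (R∀ {Γ = Γ} {x} {D = D} v e g) = R∀ (subᵀ-valid (liftᵗ θ) v)
      (≋-trans (subᵀ-premise (liftᵗ θ) {D} e) (≡⇒≋ (cong (λ Γ → [ Γ ▸ x ∶ _ ]) (subᴱ-wk θ Γ))))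
      (≋-subᴱ g)

  -- Actions of a process

  -- Can f x ys P: the action with form f, subject x and bound names ys is
  -- possible in P after renaming the bound names of the prefix that it consumes,
  -- but no binder (νxy).
  data Can {n} : ∀ {k} → Form n k → Name → Vec Name k → Proc n → Set where
    prefix : ∀ {k} {p : Pre n k} {x ys zs P} → Unique (toList zs) →
             Disjoint (toList zs) (fn P ∖ toList ys) → Can (↑ p) x zs (pre p x ys P)
    offₗ   : ∀ {x P Q} → Can offₗ x [] (case x P Q)
    offᵣ   : ∀ {x P Q} → Can offᵣ x [] (case x P Q)
    all    : ∀ {x P A} → Can (recv-ty A) x [] (all x P)
    serve-weaken   : ∀ {x ys P} → Can serve-weaken x [] (pre serve x ys P)
    serve-contract : ∀ {x ys P x₁ x₂} → x₁ ≢ x₂ → x₁ ∉ fn P ∖ toList ys →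
                     Can serve-contract x (x₁ ∷ x₂ ∷ []) (pre serve x ys P)
    parₗ   : ∀ {k} {f : Form n k} {x ys P Q} → Can f x ys P →
             Disjoint (toList ys) (fn Q) → Can f x ys (P ∥ Q)
    parᵣ   : ∀ {k} {f : Form n k} {x ys P Q} → Can f x ys Q →
             Disjoint (toList ys) (fn P) → Can f x ys (P ∥ Q)
    ν      : ∀ {k} {f : Form n k} {x ys a b P} → Can f x ys P →
             a ∉ x ∷ toList ys → b ∉ x ∷ toList ys → Can f x ys (ν a b P)

  can-fn : ∀ {n k} {f : Form n k} {x ys P} → Can f x ys P → x ∈ fn P
  can-fn (prefix _ _)           = here refl
  can-fn offₗ                   = here refl
  can-fn offᵣ                   = here refl
  can-fn all                    = here refl
  can-fn serve-weaken           = here refl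
  can-fn (serve-contract _ _)   = here refl
  can-fn (parₗ c _)             = ∈-++⁺ˡ (can-fn c)
  can-fn (parᵣ {P = P} c _)     = ∈-++⁺ʳ (fn P) (can-fn c)
  can-fn (ν c a∉ b∉)            = ∈-∖⁺ (can-fn c) λ where
    (here refl)         → a∉ (here refl)
    (there (here refl)) → b∉ (here refl)

  -- This is what resolves a clash between the bound names of two labels. Freshness for the free
  -- names covers the conditions at prefixes and parallel compositions, and `Avoids` those at
  -- restrictions.
  can-rebind : ∀ {n k} {f : Form n k} {x ys zs P} → Can f x ys P → Unique (toList zs) →
               Disjoint (toList zs) (fn P) → Avoids (toList zs) P → Can f x zs P
  can-rebind (prefix _ _) u d a = prefix u λ (i , j) → d (i , there j)
  can-rebind {zs = []} offₗ u d a = offₗ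
  can-rebind {zs = []} offᵣ u d a = offᵣ
  can-rebind {zs = []} all u d a = all
  can-rebind {zs = []} serve-weaken u d a = serve-weaken
  can-rebind {zs = _ ∷ _ ∷ []} (serve-contract _ _) u d a =
    serve-contract (λ e → ∷-unique⁻ u (here e)) (λ i → d (here refl , there i))
  can-rebind {P = P ∥ Q} (parₗ c _) u d (a , _) =
    parₗ (can-rebind c u (λ (i , j) → d (i , ∈-++⁺ˡ j)) a) (λ (i , j) → d (i , ∈-++⁺ʳ (fn P) j))
  can-rebind {P = P ∥ Q} (parᵣ c _) u d (_ , a) =
    parᵣ (can-rebind c u (λ (i , j) → d (i , ∈-++⁺ʳ (fn P) j)) a) (λ (i , j) → d (i , ∈-++⁺ˡ j))
  can-rebind {zs = zs} {ν x y P} (ν c x∉ y∉) u d (x∉′ , y∉′ , a) =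
    ν (can-rebind c u d′ a)
      (λ { (here e) → x∉ (here e) ; (there i) → x∉′ i })
      (λ { (here e) → y∉ (here e) ; (there i) → y∉′ i })
    where
    d′ : Disjoint (toList zs) (fn P)
    d′ (i , j) = d (i , ∈-∖⁺ j λ { (here refl) → x∉′ i ; (there (here refl)) → y∉′ i })

  -- Reading actions off transitions

  ≐-injective : ∀ {ρ a b c} → ρ ⊢ a ≐ c → ρ ⊢ b ≐ c → a ≡ b
  ≐-injective free          free           = refl
  ≐-injective here          here           = refl
  ≐-injective here          (there _ q _)  = ⊥-elim (q refl)
  ≐-injective (there _ q _) here           = ⊥-elim (q refl)
  ≐-injective (there _ _ r) (there _ _ r′) = ≐-injective r r′

  ≐-unbound : ∀ {ρ a b} → a ∉ map proj₁ ρ → ρ ⊢ a ≐ b → a ≡ b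
  ≐-unbound a∉ free          = refl
  ≐-unbound a∉ here          = ⊥-elim (a∉ (here refl))
  ≐-unbound a∉ (there _ _ r) = ≐-unbound (a∉ ∘ there) r

  ≈-unbound-fn : ∀ {n ρ a} {P Q : Proc n} → a ∉ map proj₁ ρ → ρ ⊢ P ≈ Q → a ∈ fn P → a ∈ fn Q
  ≈-unbound-fn a∉ r i with b , j , r′ ← ≈-fn r i = subst (_∈ _) (sym (≐-unbound a∉ r′)) j

  ≈-unbound-fn-∖ : ∀ {n k ρ a ys ys′} {P Q : Proc n} → a ∉ map proj₁ ρ →
                   (toList (Vec.zip {n = k} ys ys′) ++ ρ) ⊢ P ≈ Q →
                   a ∈ fn P ∖ toList ys → a ∈ fn Q ∖ toList ys′
  ≈-unbound-fn-∖ {ys = ys} {ys′} a∉ r i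
    with j , a∉ys ← ∈-∖⁻ i
    with b , k , r′ ← ≈-fn r j
    with r″ , b∉ ← zip-∉ ys ys′ a∉ys r′ = subst (_∈ _) (sym (≐-unbound a∉ r″)) (∈-∖⁺ k b∉)

  -- The transition rule `serve-contract` does not itself say that `x₁` and `x₂` differ or that `x₁`
  -- avoids the context. Validity of the target does: contractions are peeled off to reach the
  -- output `x₁[x₂]`, whose premise must have distinct names.
  contractAll-valid⁻ : ∀ {n σ₁ σ₂ Γ} Θ {D : Tree n} → Valid (contractAll σ₁ σ₂ Γ Θ D) → Valid D
  contractAll-valid⁻ []      v                      = v
  contractAll-valid⁻ (_ ∷ Θ) (valid _ (RC v _ _)) = contractAll-valid⁻ Θ v

  contractAll-distinct : ∀ {n σ₁ σ₂ x A w} (Θ : Env n) {D : Tree n} →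
                         Valid (contractAll σ₁ σ₂ ([] ▸ x ∶ A) Θ D) → w ∈ dom Θ → x ≢ w
  contractAll-distinct {x = x} {A} ((z , T) ∷ Θ) (valid d _) i refl
    with _ , _ , disj ← dom-unique⁻ ((z , T) ∷ Θ)
      (unique-↭ ([]-↭ {𝒢 = [ (Θ ++ ([] ▸ x ∶ A)) ▸ z ∶ T ]} ≋-refl) d) =
    disj (i , here refl)

  twoServers-distinct : ∀ {n σ₁ σ₂ Θ x₁ x₂ x′ A} {D : Tree n} →
                        Valid (twoServers σ₁ σ₂ Θ x₁ x₂ x′ A D) → x₁ ≢ x₂
  twoServers-distinct {σ₁ = σ₁} {Θ = Θ} (valid _ (R⊗ (valid d _) _ _)) x₁≡x₂ =
    ∷-unique⁻ d (dom-++⁺ʳ (renᴱ σ₁ Θ) (here x₁≡x₂))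

  -- The process `P` stays fixed while `α` may replace the derivation at any depth, so the two are
  -- kept α-equivalent relative to the restrictions already crossed, collected in `ρ`; `x°` is the
  -- subject as named in `P`. The names bound by the label must avoid the restrictions on the side
  -- of `P`, as they are compared with free names there.
  step⇒can : ∀ {n k ρ x x° P} {f : Form n k} {ys D D′} → D ─[ ⌊ act f x ys ⌋ ]→ D′ →
             ρ ⊢ P ≈ proc D → ρ ⊢ x° ≐ x → Disjoint (toList ys) (map proj₁ ρ) →
             Avoids (x° ∷ toList ys) P → Can f x° ys P
  step⇒can {D′ = D} (step (valid _ rule) _ (prefix _)) (pre e r) h c a
    -- A name bound by the label is not restricted in `ρ`, so if it were free in the continuation in
    -- `P`, outside of the names bound there, it would also be free in the continuation of the
    -- derivation outside of `ys`.
    with refl ← ≐-injective e h =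
    prefix (bound-unique (pre-shape rule)) λ (i , j) →
      proj₂ (∈-∖⁻ {fnᵀ D} (≈-unbound-fn-∖ (λ k → c (i , k)) r j)) i
  step⇒can (step _ _ caseₗ) (case e r s) h c a with refl ← ≐-injective e h = offₗ
  step⇒can (step _ _ caseᵣ) (case e r s) h c a with refl ← ≐-injective e h = offᵣ
  step⇒can (step _ _ all)   (all e r)    h c a with refl ← ≐-injective e h = all
  step⇒can (step (valid _ rule) _ weaken) (pre e r) h c a with refl ← ≐-injective e h =
    prefix [] λ ()
  step⇒can {D′ = pre _ _ _ _ D} (step (valid _ rule) _ contract) (pre e r) h c a
    with refl ← ≐-injective e h =
    prefix (bound-unique (pre-shape rule)) λ (i , j) →
      proj₂ (∈-∖⁻ {fnᵀ D} (≈-unbound-fn-∖ (λ k → c (i , k)) r j)) i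
  step⇒can (step _ _ (serve-weaken _ _)) (pre e r) h c a
    with refl ← ≐-injective e h = serve-weaken
  step⇒can (step _ v (serve-contract {Θ = Θ} σ₁ σ₂ _ _ eq)) (pre e r) h c a
    with refl ← ≐-injective e h =
    serve-contract (twoServers-distinct (contractAll-valid⁻ Θ v)) λ i →
      contractAll-distinct Θ v
        (Equivalence.from eq (≈-unbound-fn-∖ (λ k → c (here refl , k)) r i)) refl
  step⇒can {ρ = ρ} {D = D} (step v _ (α {E = E} r₀ _ s)) r h c a =
    step⇒can s (≈-trans {ρ₁ = ρ} {[]} {ρ} compose (valid⇒proper D v)
      (valid⇒proper E (_─[_]→_.source-valid s)) r r₀) h c a
    where
    -- The equivalence in `α` concerns whole processes and has no binders, so composing with it
    -- leaves `ρ` unchanged.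
    compose : Composes ρ [] ρ
    compose e free = e
  step⇒can (step _ _ (Parₗ s d)) (r ∥ t) h c (a , _) = parₗ (step⇒can s r h c a)
    λ (i , j) → d (i , ≈-unbound-fn (λ k → c (i , k)) t j)
  step⇒can (step _ _ (Parᵣ s d)) (r ∥ t) h c (_ , a) = parᵣ (step⇒can s t h c a)
    λ (i , j) → d (i , ≈-unbound-fn (λ k → c (i , k)) r j)
  -- The subjects stay related past the new pairs: `x°` differs from the restricted names of `P` by
  -- `Avoids`, and its counterpart from those of the derivation by the side condition of `Res`.
  step⇒can (step _ _ (Res s x∉ y∉ _ _)) (ν r) h c (a∉ , b∉ , a) =
    ν (step⇒can s r
        (there (λ e → a∉ (here (sym e))) (λ e → x∉ (here (sym e)))
          (there (λ e → b∉ (here (sym e))) (λ e → y∉ (here (sym e))) h))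
        (λ { (i , here refl) → a∉ (there i) ; (i , there (here refl)) → b∉ (there i)
           ; (i , there (there j)) → c (i , j) }) a)
      a∉ b∉
  step⇒can (step _ _ (Res s x∉ y∉ _ _)) (ν× r) h c (a∉ , b∉ , a) =
    ν (step⇒can s r
        (there (λ e → a∉ (here (sym e))) (λ e → y∉ (here (sym e)))
          (there (λ e → b∉ (here (sym e))) (λ e → x∉ (here (sym e))) h))
        (λ { (i , here refl) → a∉ (there i) ; (i , there (here refl)) → b∉ (there i)
           ; (i , there (there j)) → c (i , j) }) a)
      a∉ b∉

  -- Lifting transitions through parallel composition and restriction

  -- Entries are compared one by one, so that frames combine along parallel composition without
  -- bookkeeping of permutations. Only merging of environments is excluded by `apart`: an output
  -- `x[y]` splits its environment, so the converse of that field would fail.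
  record Frame {n} (𝒢 : HEnv n) (cs : List Name) (𝒢′ : HEnv n) : Set where
    constructor frame
    field
      keep  : ∀ {w T} → (w , T) ∈ concat 𝒢 → w ∉ cs → (w , T) ∈ concat 𝒢′
      from  : ∀ {w T} → (w , T) ∈ concat 𝒢′ → w ∉ cs → (w , T) ∈ concat 𝒢
      apart : ∀ {w w′} → Together 𝒢′ w w′ → w ∉ cs → w′ ∉ cs → Together 𝒢 w w′

  open Frame

  frame-refl : ∀ {n} {𝒢 : HEnv n} {cs} → Frame 𝒢 cs 𝒢
  frame-refl = frame (λ i _ → i) (λ i _ → i) (λ t _ _ → t)

  frame-mono : ∀ {n} {𝒢 𝒢′ : HEnv n} {cs cs′} → (∀ {w} → w ∈ cs → w ∈ cs′) →
               Frame 𝒢 cs 𝒢′ → Frame 𝒢 cs′ 𝒢′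
  frame-mono h F = frame (λ i w∉ → keep F i (w∉ ∘ h)) (λ i w∉ → from F i (w∉ ∘ h))
                         (λ t w∉ w′∉ → apart F t (w∉ ∘ h) (w′∉ ∘ h))

  frame-++ : ∀ {n} {𝒢 ℋ 𝒢′ ℋ′ 𝒦 : HEnv n} {cs} → 𝒦 ≋ 𝒢 ++ ℋ →
             Frame 𝒢 cs 𝒢′ → Frame ℋ cs ℋ′ → Frame 𝒦 cs (𝒢′ ++ ℋ′)
  frame-++ {𝒢 = 𝒢} {ℋ} {𝒢′} {ℋ′} {𝒦} {cs} e F G = frame k f a
    where
    k : ∀ {w T} → (w , T) ∈ concat 𝒦 → w ∉ cs → (w , T) ∈ concat (𝒢′ ++ ℋ′)
    k i w∉ with ∈-++⁻ (concat 𝒢) (∈-resp-↭ (↭-trans (concat-↭ e) (concat-++-↭ 𝒢)) i)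
    ... | inj₁ j = ∈-resp-↭ (↭-sym (concat-++-↭ 𝒢′)) (∈-++⁺ˡ (keep F j w∉))
    ... | inj₂ j = ∈-resp-↭ (↭-sym (concat-++-↭ 𝒢′)) (∈-++⁺ʳ (concat 𝒢′) (keep G j w∉))
    f : ∀ {w T} → (w , T) ∈ concat (𝒢′ ++ ℋ′) → w ∉ cs → (w , T) ∈ concat 𝒦
    f i w∉ with ∈-++⁻ (concat 𝒢′) (∈-resp-↭ (concat-++-↭ 𝒢′) i)
    ... | inj₁ j = ∈-resp-↭ (↭-sym (↭-trans (concat-↭ e) (concat-++-↭ 𝒢))) (∈-++⁺ˡ (from F j w∉))
    ... | inj₂ j = ∈-resp-↭ (↭-sym (↭-trans (concat-↭ e) (concat-++-↭ 𝒢))) (∈-++⁺ʳ (concat 𝒢) (from G j w∉))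
    a : ∀ {w w′} → Together (𝒢′ ++ ℋ′) w w′ → w ∉ cs → w′ ∉ cs → Together 𝒦 w w′
    a t w∉ w′∉ with Any.++⁻ 𝒢′ t
    ... | inj₁ u = together-≋ (≋-sym e) (Any.++⁺ˡ (apart F u w∉ w′∉))
    ... | inj₂ u = together-≋ (≋-sym e) (Any.++⁺ʳ 𝒢 (apart G u w∉ w′∉))

  -- Prefix rules conclude with one environment, so `apart` is immediate: any two names outside of
  -- the label that occur afterwards come from `Γ`.
  frame-[] : ∀ {n} {𝒢 𝒢′ : HEnv n} {Γ x T cs} → 𝒢 ≋ [ Γ ▸ x ∶ T ] → x ∈ cs →
             (∀ {w T} → (w , T) ∈ Γ → (w , T) ∈ concat 𝒢′) →
             (∀ {w T} → (w , T) ∈ concat 𝒢′ → w ∉ cs → (w , T) ∈ Γ) →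
             Frame 𝒢 cs 𝒢′
  frame-[] {𝒢 = 𝒢} {𝒢′} {Γ} {x} {T} {cs} e x∈ into out = frame k
    (λ i w∉ → ∈-resp-↭ (↭-sym ([]-↭ e)) (there (out i w∉)))
    (λ t w∉ w′∉ → together-≋ (≋-sym e) (here (there (dom-out (proj₁ (together⇒names t)) w∉) ,
                                              there (dom-out (proj₂ (together⇒names t)) w′∉))))
    where
    k : ∀ {w T} → (w , T) ∈ concat 𝒢 → w ∉ cs → (w , T) ∈ concat 𝒢′
    k i w∉ with ∈-resp-↭ ([]-↭ e) i
    ... | here refl = ⊥-elim (w∉ x∈)
    ... | there j   = into j
    dom-out : ∀ {w} → w ∈ names 𝒢′ → w ∉ cs → w ∈ dom Γ
    dom-out i w∉ with T , j ← dom⁻ i = dom⁺ (out j w∉)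

  frame-names : ∀ {n} {𝒢 𝒢′ : HEnv n} {cs w} → Frame 𝒢 cs 𝒢′ → w ∈ names 𝒢′ → w ∈ cs ⊎ w ∈ names 𝒢
  frame-names {cs = cs} {w} F i with w ∈? cs
  ... | yes j = inj₁ j
  ... | no w∉ with T , j ← dom⁻ i = inj₂ (dom⁺ (from F j w∉))

  -- The frame is built along with the transition because lifting through an enclosing cut consumes
  -- it and must produce one again.
  Transition : ∀ {n} → Tree n → Label n → Set
  Transition D l = ∃[ D′ ] (D ─[ l ]→ D′) × Frame (conc D) (cnˡ l) (conc D′)

  transition-α : ∀ {n} {D E : Tree n} {l} → Valid D → proc D =α proc E → conc D ≡ conc E →
                 Transition E l → Transition D l
  transition-α {l = l} v r e (D′ , s@(step _ v′ _) , F) =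
    D′ , step v v′ (α r (≡⇒≋ e) s) , subst (λ 𝒢 → Frame 𝒢 (cnˡ l) (conc D′)) (sym e) F

  transition-flip : ∀ {n} {D : Tree n} {a b} → Transition D (a ∥ b) → Transition D (b ∥ a)
  transition-flip {a = a} {b} (D′ , s@(step v v′ _) , F) =
    D′ , step v v′ (flip s) , frame-mono h F
    where
    swap-++ : ∀ {w} (xs ys : List Name) → w ∈ xs ++ ys → w ∈ ys ++ xs
    swap-++ xs ys i with ∈-++⁻ xs i
    ... | inj₁ j = ∈-++⁺ʳ ys j
    ... | inj₂ j = ∈-++⁺ˡ j
    h : ∀ {w} → w ∈ cnˡ (a ∥ b) → w ∈ cnˡ (b ∥ a)
    h i with ∈-++⁻ (fnᵃ a ++ fnᵃ b) i
    ... | inj₁ j = ∈-++⁺ˡ (swap-++ (fnᵃ a) (fnᵃ b) j)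
    ... | inj₂ j = ∈-++⁺ʳ (fnᵃ b ++ fnᵃ a) (swap-++ (bnᵃ a) (bnᵃ b) j)

  par-valid : ∀ {n} {D E : Tree n} → Valid D → Valid E →
              Disjoint (names (conc D)) (names (conc E)) → Valid (par (conc D ++ conc E) D E)
  par-valid {D = D} {E} v w d = valid
    (unique-↭ (↭-sym (concat-++-↭ (conc D)))
      (dom-unique⁺ (concat (conc D)) (Valid.distinct v) (Valid.distinct w) d))
    (Mix v w ≋-refl)

  mix-disjoint : ∀ {n 𝒢} {D E : Tree n} → Distinct 𝒢 → 𝒢 ≋ conc D ++ conc E →
                 Disjoint (names (conc D)) (names (conc E))
  mix-disjoint {D = D} d g = proj₂ (proj₂ (dom-unique⁻ (concat (conc D))
    (unique-↭ (↭-trans (concat-↭ g) (concat-++-↭ (conc D))) d)))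

  -- A name that is new in the target must be bound by the label, since the subjects of the label
  -- are free in `D` already. Hence parallel components remain disjoint after a transition.
  transition-names : ∀ {n} {D D′ : Tree n} {l : Label n} {w} → Valid D → (∀ {w} → w ∈ fnˡ l → w ∈ fnᵀ D) →
                     Frame (conc D) (cnˡ l) (conc D′) →
                     w ∈ names (conc D′) → w ∈ bnˡ l ⊎ w ∈ names (conc D)
  transition-names {D = D} {l = l} v h F i with frame-names F i
  ... | inj₂ j = inj₂ j
  ... | inj₁ j with ∈-++⁻ (fnˡ l) j
  ...   | inj₁ k = inj₂ (fn⊆names D v (h k))
  ...   | inj₂ k = inj₁ k

  transition-parₗ : ∀ {n 𝒢} {D E : Tree n} {l} → Valid (par 𝒢 D E) →
                    (∀ {w} → w ∈ fnˡ l → w ∈ fnᵀ D) → Disjoint (bnˡ l) (fnᵀ E) →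
                    Transition D l → Transition (par 𝒢 D E) l
  transition-parₗ {D = D} {E} {l} v₀@(valid d (Mix v w g)) h dis (D′ , s@(step _ v′ _) , F) =
    _ , step v₀ (par-valid v′ w d′) (Parₗ s dis) , frame-++ g F frame-refl
    where
    d′ : Disjoint (names (conc D′)) (names (conc E))
    d′ (i , j) with transition-names {D = D} {D′} {l} v h F i
    ... | inj₁ k = dis (k , names⊆fn E w j)
    ... | inj₂ k = mix-disjoint {D = D} {E} d g (k , j)

  transition-parᵣ : ∀ {n 𝒢} {D E : Tree n} {l} → Valid (par 𝒢 D E) →
                    (∀ {w} → w ∈ fnˡ l → w ∈ fnᵀ E) → Disjoint (bnˡ l) (fnᵀ D) →
                    Transition E l → Transition (par 𝒢 D E) l
  transition-parᵣ {D = D} {E} {l} v₀@(valid d (Mix v w g)) h dis (E′ , s@(step _ v′ _) , F) =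
    _ , step v₀ (par-valid v v′ d′) (Parᵣ s dis) , frame-++ g frame-refl F
    where
    d′ : Disjoint (names (conc D)) (names (conc E′))
    d′ (i , j) with transition-names {D = E} {E′} {l} w h F j
    ... | inj₁ k = dis (k , names⊆fn D v i)
    ... | inj₂ k = mix-disjoint {D = D} {E} d g (i , k)

  transition-syn : ∀ {n 𝒢} {D E : Tree n} {a b} → Valid (par 𝒢 D E) →
                   (∀ {w} → w ∈ fnᵃ a → w ∈ fnᵀ D) → (∀ {w} → w ∈ fnᵃ b → w ∈ fnᵀ E) →
                   Disjoint (bnᵃ a) (fnᵀ E) → Disjoint (bnᵃ b) (fnᵀ D) →
                   Disjoint (bnᵃ a) (bnᵃ b) →
                   Transition D ⌊ a ⌋ → Transition E ⌊ b ⌋ → Transition (par 𝒢 D E) (a ∥ b)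
  transition-syn {D = D} {E} {a} {b} v₀@(valid d (Mix v w g)) ha hb da db dab
                 (D′ , s@(step _ v′ _) , F) (E′ , t@(step _ w′ _) , G) =
    _ , step v₀ (par-valid v′ w′ d′) (Syn s t dab) , frame-++ g (frame-mono l F) (frame-mono r G)
    where
    d′ : Disjoint (names (conc D′)) (names (conc E′))
    d′ (i , j) with transition-names {D = D} {D′} {⌊ a ⌋} v ha F i
                  | transition-names {D = E} {E′} {⌊ b ⌋} w hb G j
    ... | inj₁ k | inj₁ m = dab (k , m)
    ... | inj₁ k | inj₂ m = da (k , names⊆fn E w m)
    ... | inj₂ k | inj₁ m = db (m , names⊆fn D v k)
    ... | inj₂ k | inj₂ m = mix-disjoint {D = D} {E} d g (k , m)
    l : ∀ {w} → w ∈ cnˡ ⌊ a ⌋ → w ∈ cnˡ (a ∥ b)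
    l i with ∈-++⁻ (fnᵃ a) i
    ... | inj₁ j = ∈-++⁺ˡ (∈-++⁺ˡ j)
    ... | inj₂ j = ∈-++⁺ʳ (fnᵃ a ++ fnᵃ b) (∈-++⁺ˡ j)
    r : ∀ {w} → w ∈ cnˡ ⌊ b ⌋ → w ∈ cnˡ (a ∥ b)
    r i with ∈-++⁻ (fnᵃ b) i
    ... | inj₁ j = ∈-++⁺ˡ (∈-++⁺ʳ (fnᵃ a) j)
    ... | inj₂ j = ∈-++⁺ʳ (fnᵃ a ++ fnᵃ b) (∈-++⁺ʳ (bnᵃ a) j)

  -- By the frame, `keep` retains the dual types of `x` and `y`, and `apart` their separation, so
  -- the conclusion of `D′` can again be cut. Most of the work is to frame the result, since the cut
  -- joins two environments.
  transition-ν : ∀ {n 𝒢 x y} {D : Tree n} {l} → Valid (ν 𝒢 x y D) → x ∉ cnˡ l → y ∉ cnˡ l →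
                 Transition D l → Transition (ν 𝒢 x y D) l
  transition-ν {n} {𝒢} {x} {y} {D} {l} v₀@(valid d (Cut {𝒢₀ = 𝒢₀} {Γ} {Δ} {A = A} v e g)) x∉ y∉
               (D′ , s@(step _ v′ _) , F)
    with ∈∈⇒≋ (conc D′)
           (keep F (∈-resp-↭ (↭-sym (cut-↭ e)) (here refl)) x∉)
           (keep F (∈-resp-↭ (↭-sym (cut-↭ e)) (there (here refl))) y∉)
           (λ x≡y → ∷-unique⁻ (unique-↭ (cut-↭ e) (Valid.distinct v)) (here x≡y))
           (λ t → not-together {Γ = Γ} {Δ} {𝒢₀} {A = A}
             (distinct-≋ e (Valid.distinct v)) (together-≋ e (apart F t x∉ y∉)))
  ... | Γ′ , Δ′ , 𝒢₀′ , e′ =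
    _ , step v₀ (valid (unique-tail (unique-tail (unique-↭ (cut-↭ e′) (Valid.distinct v′))))
                      (Cut v′ e′ ≋-refl))
          (Res s x∉ y∉ e e′)
      , frame k f a
    where
    ℋ : HEnv n
    ℋ = (Γ′ ++ Δ′) ∷ 𝒢₀′
    u : Unique (x ∷ y ∷ names ((Γ ++ Δ) ∷ 𝒢₀))
    u = unique-↭ (cut-↭ e) (Valid.distinct v)
    u′ : Unique (x ∷ y ∷ names ℋ)
    u′ = unique-↭ (cut-↭ e′) (Valid.distinct v′)
    uncut : ∀ {w T Γ Δ 𝒢 𝒢₀ A B} → 𝒢 ≋ (Γ ▸ x ∶ A) ∷ (Δ ▸ y ∶ B) ∷ 𝒢₀ → w ≢ x → w ≢ y →
            (w , T) ∈ concat 𝒢 → (w , T) ∈ concat {A = Name × Ty n} ((Γ ++ Δ) ∷ 𝒢₀)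
    uncut e w≢x w≢y i with ∈-resp-↭ (cut-↭ e) i
    ... | here refl         = ⊥-elim (w≢x refl)
    ... | there (here refl) = ⊥-elim (w≢y refl)
    ... | there (there j)   = j
    ≢x : ∀ {w xs} → Unique (x ∷ y ∷ xs) → w ∈ xs → w ≢ x
    ≢x u i refl = ∷-unique⁻ u (there i)
    ≢y : ∀ {w xs} → Unique (x ∷ y ∷ xs) → w ∈ xs → w ≢ y
    ≢y u i refl = ∷-unique⁻ (unique-tail u) i
    k : ∀ {w T} → (w , T) ∈ concat 𝒢 → w ∉ cnˡ l → (w , T) ∈ concat ℋ
    k i w∉ with j ← ∈-resp-↭ (concat-↭ g) i =
      uncut e′ (≢x u (dom⁺ j)) (≢y u (dom⁺ j)) (keep F (∈-resp-↭ (↭-sym (cut-↭ e)) (there (there j))) w∉)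
    f : ∀ {w T} → (w , T) ∈ concat ℋ → w ∉ cnˡ l → (w , T) ∈ concat 𝒢
    f i w∉ = ∈-resp-↭ (↭-sym (concat-↭ g))
      (uncut e (≢x u′ (dom⁺ i)) (≢y u′ (dom⁺ i)) (from F (∈-resp-↭ (↭-sym (cut-↭ e′)) (there (there i))) w∉))
    rejoin : ∀ {w w′} → Together (conc D) w w′ → w ≢ x → w ≢ y → w′ ≢ x → w′ ≢ y → Together 𝒢 w w′
    rejoin t w≢x w≢y w′≢x w′≢y with together-≋ e t
    ... | here (i , j)         = together-≋ (≋-sym g)
      (here (dom-++⁺ˡ (Any.tail w≢x i) , dom-++⁺ˡ (Any.tail w′≢x j)))
    ... | there (here (i , j)) = together-≋ (≋-sym g)
      (here (dom-++⁺ʳ Γ (Any.tail w≢y i) , dom-++⁺ʳ Γ (Any.tail w′≢y j)))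
    ... | there (there t′)     = together-≋ (≋-sym g) (there t′)
    inΓ : ∀ {w} → Together (conc D) w x → w ≢ x → w ∈ dom Γ
    inΓ t w≢x with together-≋ e t
    ... | here (i , _)         = Any.tail w≢x i
    ... | there (here (_ , j)) = ⊥-elim (xΔ j)
      where
      xΔ : x ∉ y ∷ dom Δ
      xΔ (here x≡y) = ∷-unique⁻ u (here x≡y)
      xΔ (there j)  = ∷-unique⁻ u (there (dom-++⁺ˡ (dom-++⁺ʳ Γ j)))
    ... | there (there t′)     =
      ⊥-elim (∷-unique⁻ u (there (dom-++⁺ʳ (Γ ++ Δ) (proj₂ (together⇒names t′)))))
    inΔ : ∀ {w} → Together (conc D) w y → w ≢ y → w ∈ dom Δ
    inΔ t w≢y with together-≋ e t
    ... | here (_ , j)         = ⊥-elim (yΓ j)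
      where
      yΓ : y ∉ x ∷ dom Γ
      yΓ (here y≡x) = ∷-unique⁻ u (here (sym y≡x))
      yΓ (there j)  = ∷-unique⁻ (unique-tail u) (dom-++⁺ˡ (dom-++⁺ˡ j))
    ... | there (here (i , _)) = Any.tail w≢y i
    ... | there (there t′)     =
      ⊥-elim (∷-unique⁻ (unique-tail u) (dom-++⁺ʳ (Γ ++ Δ) (proj₂ (together⇒names t′))))
    back : ∀ {w w′} → Together ((Γ′ ▸ x ∶ A) ∷ (Δ′ ▸ y ∶ dual A) ∷ 𝒢₀′) w w′ →
           w ∉ cnˡ l → w′ ∉ cnˡ l → Together (conc D) w w′
    back t = apart F (together-≋ (≋-sym e′) t)
    Γ′≢ : ∀ {w} → w ∈ dom Γ′ → w ≢ x × w ≢ y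
    Γ′≢ i = ≢x u′ (dom-++⁺ˡ (dom-++⁺ˡ i)) , ≢y u′ (dom-++⁺ˡ (dom-++⁺ˡ i))
    Δ′≢ : ∀ {w} → w ∈ dom Δ′ → w ≢ x × w ≢ y
    Δ′≢ i = ≢x u′ (dom-++⁺ˡ (dom-++⁺ʳ Γ′ i)) , ≢y u′ (dom-++⁺ˡ (dom-++⁺ʳ Γ′ i))
    -- Joining `Γ′` and `Δ′` brings new names together. A name sharing an environment with `x` after
    -- the transition shared it with `x` before, hence lies in `Γ`; likewise for `y` and `Δ`. So
    -- names joined afterwards were already joined by the original cut.
    fromΓ′ : ∀ {w} → w ∈ dom Γ′ → w ∉ cnˡ l → w ∈ dom Γ
    fromΓ′ i w∉ = inΓ (back (here (there i , here refl)) w∉ x∉) (proj₁ (Γ′≢ i))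
    fromΔ′ : ∀ {w} → w ∈ dom Δ′ → w ∉ cnˡ l → w ∈ dom Δ
    fromΔ′ i w∉ = inΔ (back (there (here (there i , here refl))) w∉ y∉) (proj₂ (Δ′≢ i))
    a : ∀ {w w′} → Together ℋ w w′ → w ∉ cnˡ l → w′ ∉ cnˡ l → Together 𝒢 w w′
    a (there t) w∉ w′∉ with i , j ← together⇒names t =
      rejoin (back (there (there t)) w∉ w′∉)
        (≢x u′ (dom-++⁺ʳ (Γ′ ++ Δ′) i)) (≢y u′ (dom-++⁺ʳ (Γ′ ++ Δ′) i))
        (≢x u′ (dom-++⁺ʳ (Γ′ ++ Δ′) j)) (≢y u′ (dom-++⁺ʳ (Γ′ ++ Δ′) j))
    a (here (i , j)) w∉ w′∉ = together-≋ (≋-sym g) (here (inΓΔ i w∉ , inΓΔ j w′∉))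
      where
      inΓΔ : ∀ {w} → w ∈ dom (Γ′ ++ Δ′) → w ∉ cnˡ l → w ∈ dom (Γ ++ Δ)
      inΓΔ i w∉ with dom-++⁻ Γ′ i
      ... | inj₁ j = dom-++⁺ˡ (fromΓ′ j w∉)
      ... | inj₂ j = dom-++⁺ʳ Γ (fromΔ′ j w∉)

  -- Performing actions

  distinct-[] : ∀ {n} (Γ : Env n) → Unique (dom Γ) → Distinct [ Γ ]
  distinct-[] Γ = subst (Unique ∘ dom) (sym (++-identityʳ Γ))

  distinct-[]⁻ : ∀ {n} (Γ : Env n) → Distinct [ Γ ] → Unique (dom Γ)
  distinct-[]⁻ Γ = subst (Unique ∘ dom) (++-identityʳ Γ)

  shape-frame : ∀ {n k} {𝒢 𝒢′ : HEnv n} {x} {ys : Vec Name k} {D : Tree n} → Shape 𝒢 x ys D →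
                𝒢′ ≡ conc D → Frame 𝒢 (x ∷ toList ys) 𝒢′
  shape-frame s refl = frame-[] concl (here refl)
    (λ i → ∈-resp-↭ (↭-sym perm) (∈-++⁺ʳ E i))
    (λ i w∉ → premise⊆ s i (w∉ ∘ there) (w∉ ∘ here))
    where open Shape s

  direct-transition : ∀ {n k 𝒢 x ys D} {p : Pre n k} → Direct p → Valid (pre 𝒢 p x ys D) →
                      Transition (pre 𝒢 p x ys D) ⌊ act (↑ p) x ys ⌋
  direct-transition {D = D} δ v@(valid _ r) =
    D , step v (Shape.premise s) (prefix δ) , shape-frame s refl
    where s = pre-shape r

  -- Splitting on `p` lets `Direct p` compute to the unit type. Weakening and contraction remain,
  -- whose targets put a new prefix in front of the premise.
  prefix-transition : ∀ {n k 𝒢 x ys D} {p : Pre n k} → Valid (pre 𝒢 p x ys D) →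
                      Transition (pre 𝒢 p x ys D) ⌊ act (↑ p) x ys ⌋
  prefix-transition {p = close}     v = direct-transition _ v
  prefix-transition {p = wait}      v = direct-transition _ v
  prefix-transition {p = selₗ}      v = direct-transition _ v
  prefix-transition {p = selᵣ}      v = direct-transition _ v
  prefix-transition {p = send-ty A} v = direct-transition _ v
  prefix-transition {p = send}      v = direct-transition _ v
  prefix-transition {p = recv}      v = direct-transition _ v
  prefix-transition {p = use}       v = direct-transition _ v
  prefix-transition {p = serve}     v = direct-transition _ v
  prefix-transition {p = weaken} v@(valid d (RW {Γ = Γ} {x} w e g)) =
    pre [ Γ ▸ x ∶ ⊥ ] wait x [] _ ,
    step v (valid (distinct-[] (Γ ▸ x ∶ ⊥) (unique-↭ ([]-↭ g) d)) (R⊥ w e ≋-refl)) weaken ,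
    frame-[] g (here refl) (λ i → there (∈-++⁺ˡ i)) out
    where
    out : ∀ {w T} → (w , T) ∈ concat [ Γ ▸ x ∶ ⊥ ] → w ∉ x ∷ [] → (w , T) ∈ Γ
    out (here refl) w∉ = ⊥-elim (w∉ (here refl))
    out (there i)   w∉ = subst (_ ∈_) (++-identityʳ Γ) i
  prefix-transition {p = contract} v@(valid d r@(RC {Γ = Γ} {x} {x₁} {x₂} {A} {D} w e g)) =
    pre [ Γ ▸ x₁ ∶ ¿ A ⅋ ¿ A ] recv x₁ (x₂ ∷ []) D ,
    -- The contraction lists `x₂` last, whereas the input `x₁(x₂)` expects its subject `x₁` last.
    step v (valid distinct (R⅋ w (≋-trans e [ ↭-swap _ _ ↭-refl ]≋) ≋-refl)) contract ,
    frame-[] g (here refl) (λ i → there (∈-++⁺ˡ i)) out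
    where
    s = pre-shape r
    distinct : Unique (x₁ ∷ dom (Γ ++ []))
    distinct rewrite ++-identityʳ Γ =
      ∷-unique⁺ (λ i → bound-disjoint s (here refl , i)) (unique-tail (unique-tail (shape-unique s)))
    out : ∀ {w T} → (w , T) ∈ concat [ Γ ▸ x₁ ∶ ¿ A ⅋ ¿ A ] → w ∉ x ∷ x₁ ∷ x₂ ∷ [] → (w , T) ∈ Γ
    out (here refl) w∉ = ⊥-elim (w∉ (there (here refl)))
    out (there i)   w∉ = subst (_ ∈_) (++-identityʳ Γ) i

  renᴱ-id : ∀ {n} (𝒢 : HEnv n) → map (renᴱ (λ y → y)) 𝒢 ≡ 𝒢
  renᴱ-id 𝒢 = trans (map-cong map-id 𝒢) (map-id 𝒢)

  id-injective : ∀ xs → InjectiveOn (λ y → y) xs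
  id-injective xs _ _ e = e

  -- The prefix rules use the bound names written in the tree. Other names are reached through `α`,
  -- from a variant whose outermost prefix binds `zs`; the identity renaming leaves the conclusion
  -- as it is.
  rebound-transition : ∀ {n k 𝒢 x ys zs D} {p : Pre n k} → Valid (pre 𝒢 p x ys D) →
                       Unique (toList zs) → Disjoint (toList zs) (fnᵀ D ∖ toList ys) →
                       Transition (pre 𝒢 p x ys D) ⌊ act (↑ p) x zs ⌋
  rebound-transition {𝒢 = 𝒢} {x} {ys} {zs} {D} {p} v u d =
    transition-α v (renamed-≈ r λ _ → free) (sym (renᴱ-id 𝒢))
      (prefix-transition (renamed-valid r v (id-injective _)))
    where
    r : Renamed (λ y → y) (pre 𝒢 p x ys D) _
    r = pre u (λ (i , j) → d (i , subst (_ ∈_) (map-id _) j)) (renᵀ-renamed _ D)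

  weakenAll-conc : ∀ {n} (Θ : Env n) x → conc (weakenAll Θ x) ≋ [ Θ ▸ x ∶ 𝟏 ]
  weakenAll-conc []      x = ≋-refl
  weakenAll-conc (_ ∷ Θ) x = [ ↭-swap _ _ ↭-refl ]≋

  weakenAll-valid : ∀ {n} (Θ : Env n) x → WhyNot Θ → Unique (x ∷ dom Θ) → Valid (weakenAll Θ x)
  weakenAll-valid [] x _ u = valid u (R𝟏 (valid [] Mix₀) ≋-refl ≋-refl)
  weakenAll-valid ((z , T) ∷ Θ) x ((_ , refl) ∷ q) u =
    valid (distinct-[] (Θ ▸ x ∶ 𝟏 ▸ z ∶ T) (unique-↭ (↭-swap (x , 𝟏) (z , T) ↭-refl) u))
          (RW (weakenAll-valid Θ x q (∷-unique⁺ (λ i → ∷-unique⁻ u (there i)) (unique-tail (unique-tail u))))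
              (weakenAll-conc Θ x) ≋-refl)

  serve-context : ∀ {n Γ x′ A} (D : Tree n) → Valid D → conc D ≋ [ Γ ▸ x′ ∶ A ] →
                  dom Γ ∼[ set ] (fnᵀ D ∖ [ x′ ])
  serve-context {Γ = Γ} {x′} D v e {w} = mk⇔ into out
    where
    u = unique-↭ ([]-↭ e) (Valid.distinct v)
    into : w ∈ dom Γ → w ∈ fnᵀ D ∖ [ x′ ]
    into i = ∈-∖⁺ (names⊆fn D v (∈-resp-↭ (dom-↭ (↭-sym ([]-↭ e))) (there i)))
                λ { (here refl) → ∷-unique⁻ u i }
    out : w ∈ fnᵀ D ∖ [ x′ ] → w ∈ dom Γ
    out i with j , w∉ ← ∈-∖⁻ i with ∈-resp-↭ (dom-↭ ([]-↭ e)) (fn⊆names D v j)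
    ... | here p  = ⊥-elim (w∉ (here p))
    ... | there k = k

  serve-weaken-transition : ∀ {n 𝒢 x ys} {D : Tree n} → Valid (pre 𝒢 serve x ys D) →
                            Transition (pre 𝒢 serve x ys D) ⌊ act serve-weaken x [] ⌋
  serve-weaken-transition v@(valid d (R! {Γ = Γ} {x} {D = D} w q e g)) =
    weakenAll Γ x ,
    step v (weakenAll-valid Γ x q (unique-↭ ([]-↭ g) d)) (serve-weaken g (serve-context D w e)) ,
    frame-[] g (here refl)
      (λ i → ∈-resp-↭ (↭-sym ([]-↭ (weakenAll-conc Γ x))) (there i))
      λ i w∉ → Any.tail (λ { refl → w∉ (here refl) }) (∈-resp-↭ ([]-↭ (weakenAll-conc Γ x)) i)

  -- Provides the copies of a server's context: injectivity keeps a renamed server valid, and `L`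
  -- separates its names from those in use.
  fresh-renaming : ∀ xs L → ∃[ σ ] InjectiveOn σ xs × Disjoint (map σ xs) L
  fresh-renaming []       L = (λ y → y) , (λ ()) , λ ()
  fresh-renaming (x ∷ xs) L with σ , inj , d ← fresh-renaming xs L =
    (σ [ x ↦ y ]) , inj′ , d′
    where
    y = fresh (L ++ map σ xs)
    y∉ : y ∉ L ++ map σ xs
    y∉ = fresh-∉ (L ++ map σ xs)
    inj′ : InjectiveOn (σ [ x ↦ y ]) (x ∷ xs)
    inj′ {a} {b} i j e with a ≟ x | b ≟ x
    ... | yes p | yes q = trans p (sym q)
    ... | yes p | no q  = ⊥-elim (y∉ (∈-++⁺ʳ L (subst (_∈ _) (sym e) (∈-map⁺ σ (Any.tail q j)))))
    ... | no p  | yes q = ⊥-elim (y∉ (∈-++⁺ʳ L (subst (_∈ _) e (∈-map⁺ σ (Any.tail p i)))))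
    ... | no p  | no q  = inj (Any.tail p i) (Any.tail q j) e
    d′ : Disjoint (map (σ [ x ↦ y ]) (x ∷ xs)) L
    d′ (i , j) with a , k , refl ← ∈-map⁻ (σ [ x ↦ y ]) i with a ≟ x
    ... | yes _ = y∉ (∈-++⁺ˡ j)
    ... | no p  = d (∈-map⁺ σ (Any.tail p k) , j)

  contractAll-conc : ∀ {n} σ₁ σ₂ (Γ : Env n) Θ {D F} → conc D ≋ [ F ] →
                     F ↭ (renᴱ σ₂ Θ ++ renᴱ σ₁ Θ) ++ Γ → conc (contractAll σ₁ σ₂ Γ Θ D) ≋ [ Θ ++ Γ ]
  contractAll-conc σ₁ σ₂ Γ []      e p = ≋-trans e [ p ]≋
  contractAll-conc σ₁ σ₂ Γ (_ ∷ Θ) e p = ≋-refl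

  -- The environment `F` of the innermost derivation stays fixed. By the invariant it consists of
  -- the two copies of the entries still to be contracted and of `Γ`; each step moves one pair
  -- `σ₁ z`, `σ₂ z` into `Γ`. Since `Γ` is part of `F`, disjointness from `F` makes `z` new.
  contractAll-valid : ∀ {n} σ₁ σ₂ (Γ : Env n) Θ {D F} → Valid D → conc D ≋ [ F ] →
                      F ↭ (renᴱ σ₂ Θ ++ renᴱ σ₁ Θ) ++ Γ → WhyNot Θ → Unique (dom Θ) →
                      Disjoint (dom Θ) (dom F) → Valid (contractAll σ₁ σ₂ Γ Θ D)
  contractAll-valid σ₁ σ₂ Γ [] v e p q u d = v
  contractAll-valid {n} σ₁ σ₂ Γ ((z , T) ∷ Θ) {D} {F} v e p ((A , refl) ∷ q) u d =
    valid (distinct-[] (Θ ++ Γ ▸ z ∶ T) distinct)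
          (RC inner (≋-trans conc-inner [ front ]≋) ≋-refl)
    where
    Γ′ : Env n
    Γ′ = Γ ▸ σ₁ z ∶ T ▸ σ₂ z ∶ T
    X Y : Env n
    X = renᴱ σ₂ Θ
    Y = renᴱ σ₁ Θ
    p′ : F ↭ (X ++ Y) ++ Γ′
    p′ = ↭-trans p (↭-trans (↭-prep _ (↭-++⁺ʳ Γ (shift _ X Y)))
      (↭-sym (↭-trans (shift _ (X ++ Y) _) (↭-prep _ (shift _ (X ++ Y) Γ)))))
    inner : Valid (contractAll σ₁ σ₂ Γ′ Θ D)
    inner = contractAll-valid σ₁ σ₂ Γ′ Θ v e p′ q (unique-tail u) λ (i , j) → d (there i , j)
    conc-inner : conc (contractAll σ₁ σ₂ Γ′ Θ D) ≋ [ Θ ++ Γ′ ]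
    conc-inner = contractAll-conc σ₁ σ₂ Γ′ Θ e p′
    front : Θ ++ Γ′ ↭ ((Θ ++ Γ) ▸ σ₁ z ∶ T ▸ σ₂ z ∶ T)
    front = ↭-trans (shift _ Θ _) (↭-prep _ (shift _ Θ Γ))
    distinct : Unique (z ∷ dom (Θ ++ Γ))
    distinct = ∷-unique⁺ z∉ (unique-tail (unique-tail
      (unique-↭ (↭-trans ([]-↭ conc-inner) front) (Valid.distinct inner))))
      where
      z∉ : z ∉ dom (Θ ++ Γ)
      z∉ i with dom-++⁻ Θ i
      ... | inj₁ j = ∷-unique⁻ u j
      ... | inj₂ j = d (here refl , ∈-resp-↭ (dom-↭ (↭-sym p))
        (dom-++⁺ʳ (renᴱ σ₂ ((z , T) ∷ Θ) ++ renᴱ σ₁ ((z , T) ∷ Θ)) j))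

  dom-renᴱ : ∀ {n} σ (Γ : Env n) → dom (renᴱ σ Γ) ≡ map σ (dom Γ)
  dom-renᴱ σ Γ = trans (sym (map-∘ Γ)) (map-∘ Γ)

  module _ {n} {𝒢 : HEnv n} {x x′ Γ A} {D : Tree n} (v₀ : Valid (pre 𝒢 serve x (x′ ∷ []) D))
           (v : Valid D) (q : WhyNot Γ) (e : conc D ≋ [ Γ ▸ x′ ∶ A ]) (g : 𝒢 ≋ [ Γ ▸ x ∶ ! A ])
           {x₁ x₂} (x₁≢x₂ : x₁ ≢ x₂) (x₁∉ : x₁ ∉ fnᵀ D ∖ [ x′ ])
           where

    private
      L₁ L₂ : List Name
      -- Avoiding `x₁` and `x₂` keeps each server's environment distinct, and avoiding the free
      -- names of `D` keeps the contracted names apart from their copies. The second renaming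
      -- additionally avoids the image of the first.
      L₁ = x₁ ∷ x₂ ∷ fnᵀ D
      R₁ = fresh-renaming (fnᵀ D) L₁
      σ₁ : Subst
      σ₁ = proj₁ R₁
      L₂ = map σ₁ (fnᵀ D) ++ L₁
      R₂ = fresh-renaming (fnᵀ D) L₂
      σ₂ : Subst
      σ₂ = proj₁ R₂

      σ₁-injective : InjectiveOn σ₁ (fnᵀ D)
      σ₁-injective = proj₁ (proj₂ R₁)
      σ₂-injective : InjectiveOn σ₂ (fnᵀ D)
      σ₂-injective = proj₁ (proj₂ R₂)

      avoid₁ : ∀ {a} → a ∈ fnᵀ D → σ₁ a ∉ L₁
      avoid₁ i j = proj₂ (proj₂ R₁) (∈-map⁺ σ₁ i , j)
      avoid₂ : ∀ {a} → a ∈ fnᵀ D → σ₂ a ∉ L₁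
      avoid₂ i j = proj₂ (proj₂ R₂) (∈-map⁺ σ₂ i , ∈-++⁺ʳ (map σ₁ (fnᵀ D)) j)
      apart₁₂ : ∀ {a b} → a ∈ fnᵀ D → b ∈ fnᵀ D → σ₁ a ≢ σ₂ b
      apart₁₂ i j p = proj₂ (proj₂ R₂) (∈-map⁺ σ₂ j , ∈-++⁺ˡ (subst (_∈ _) p (∈-map⁺ σ₁ i)))

      dom⊆fn : ∀ {w} → w ∈ dom Γ → w ∈ fnᵀ D
      dom⊆fn i = names⊆fn D v (∈-resp-↭ (dom-↭ (↭-sym ([]-↭ e))) (there i))

      unique-Γ : Unique (dom Γ)
      unique-Γ = unique-tail (unique-↭ ([]-↭ g) (Valid.distinct v₀))

      image : ∀ {σ w} → w ∈ dom (renᴱ σ Γ) → ∃[ a ] a ∈ fnᵀ D × w ≡ σ a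
      image {σ} i with a , j , p ← ∈-map⁻ σ (subst (_ ∈_) (dom-renᴱ σ Γ) i) = a , dom⊆fn j , p

      image-fn : ∀ {σ w} → InjectiveOn σ (fnᵀ D) → w ∈ fnᵀ (renᵀ σ D) → ∃[ a ] a ∈ fnᵀ D × w ≡ σ a
      image-fn {σ} inj i
        with a , j , p ← ∈-map⁻ σ (subst (_ ∈_)
          (trans (cong names (renamed-conc (renᵀ-renamed σ D))) (names-renᴱ σ (conc D)))
          (fn⊆names (renᵀ σ D) (renamed-valid (renᵀ-renamed σ D) v inj) i)) =
        a , names⊆fn D v j , p

      server-valid : ∀ σ y → InjectiveOn σ (fnᵀ D) → (∀ {a} → a ∈ fnᵀ D → y ≢ σ a) →
                     Valid (pre [ renᴱ σ Γ ▸ y ∶ ! A ] serve y (σ x′ ∷ []) (renᵀ σ D))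
      server-valid σ y inj y≢ = valid
        (distinct-[] (renᴱ σ Γ ▸ y ∶ ! A) (∷-unique⁺ y∉ (subst Unique (sym (dom-renᴱ σ Γ))
          (map-unique (dom Γ) (λ i j → inj (dom⊆fn i) (dom⊆fn j)) unique-Γ))))
        (R! (renamed-valid (renᵀ-renamed σ D) v inj) (renᴱ-whyNot q)
          (≋-trans (≡⇒≋ (renamed-conc (renᵀ-renamed σ D))) (≋-renᴱ e)) ≋-refl)
        where
        y∉ : y ∉ dom (renᴱ σ Γ)
        y∉ i with a , j , p ← image i = y≢ j p

      Γ₁ Γ₂ Γ₁₂ : Env n
      Γ₁  = renᴱ σ₁ Γ ▸ x₁ ∶ ! A
      Γ₂  = renᴱ σ₂ Γ ▸ x₂ ∶ ! A
      Γ₁₂ = renᴱ σ₂ Γ ++ renᴱ σ₁ Γ ▸ x₁ ∶ ! A ⊗ ! A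

      server₁ = server-valid σ₁ x₁ σ₁-injective (λ i p → avoid₁ i (here (sym p)))
      server₂ = server-valid σ₂ x₂ σ₂-injective (λ i p → avoid₂ i (there (here (sym p))))

      fresh-x₂ : ∀ {w} → w ∈ dom (renᴱ σ₁ Γ) → w ≢ x₂
      fresh-x₂ i refl with a , k , p ← image {σ₁} i = avoid₁ k (there (here (sym p)))
      fresh-x₁ : ∀ {w} → w ∈ dom (renᴱ σ₂ Γ) → w ≢ x₁
      fresh-x₁ i refl with a , k , p ← image {σ₂} i = avoid₂ k (here (sym p))
      images-disjoint : Disjoint (dom (renᴱ σ₁ Γ)) (dom (renᴱ σ₂ Γ))
      images-disjoint (i , j) with a , k , p ← image {σ₁} i | b , m , p′ ← image {σ₂} j =
        apart₁₂ k m (trans (sym p) p′)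

      servers-disjoint : Disjoint (names [ Γ₁ ]) (names [ Γ₂ ])
      servers-disjoint {w} (i , j) = go (subst (w ∈_) (cong dom (++-identityʳ Γ₁)) i ,
                                         subst (w ∈_) (cong dom (++-identityʳ Γ₂)) j)
        where
        go : Disjoint (dom Γ₁) (dom Γ₂)
        go (here refl , here p)  = x₁≢x₂ p
        go (here refl , there j) = fresh-x₁ j refl
        go (there i , here refl) = fresh-x₂ i refl
        go (there i , there j)   = images-disjoint (i , j)

      unique-Γ₁₂ : Unique (dom Γ₁₂)
      unique-Γ₁₂ = ∷-unique⁺ x₁∉Γ₁₂ (dom-unique⁺ (renᴱ σ₂ Γ)
        (unique-tail (distinct-[]⁻ Γ₂ (Valid.distinct server₂)))
        (unique-tail (distinct-[]⁻ Γ₁ (Valid.distinct server₁)))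
        λ (i , j) → images-disjoint (j , i))
        where
        x₁∉Γ₁₂ : x₁ ∉ dom (renᴱ σ₂ Γ ++ renᴱ σ₁ Γ)
        x₁∉Γ₁₂ i with dom-++⁻ (renᴱ σ₂ Γ) i
        ... | inj₁ j = fresh-x₁ j refl
        ... | inj₂ j with a , k , p ← image {σ₁} j = avoid₁ k (here (sym p))

      servers-valid : Valid (twoServers σ₁ σ₂ Γ x₁ x₂ x′ A D)
      servers-valid = valid (distinct-[] Γ₁₂ unique-Γ₁₂)
        (R⊗ (par-valid server₁ server₂ servers-disjoint)
            (Permutation.swap ↭-refl ↭-refl ≋-refl) ≋-refl)

      Γ₁₂-↭ : Γ₁₂ ↭ (renᴱ σ₂ Γ ++ renᴱ σ₁ Γ) ++ ([] ▸ x₁ ∶ ! A ⊗ ! A)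
      Γ₁₂-↭ = ++-comm ([] ▸ x₁ ∶ ! A ⊗ ! A) (renᴱ σ₂ Γ ++ renᴱ σ₁ Γ)

      Γ-disjoint : Disjoint (dom Γ) (dom Γ₁₂)
      -- Of the names bound by the label, `x₁` is free in the innermost derivation while `x₂` is
      -- bound by its output, so it is `x₁` that has to avoid the contracted names.
      Γ-disjoint (i , here refl) = x₁∉ (Equivalence.to (serve-context D v e) i)
      Γ-disjoint (i , there j) with dom-++⁻ (renᴱ σ₂ Γ) j
      ... | inj₁ j with a , k , refl ← image {σ₂} j = avoid₂ k (there (there (dom⊆fn i)))
      ... | inj₂ j with a , k , refl ← image {σ₁} j = avoid₁ k (there (there (dom⊆fn i)))

    serve-contract-transition :
      Transition (pre 𝒢 serve x (x′ ∷ []) D) ⌊ act serve-contract x (x₁ ∷ x₂ ∷ []) ⌋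
    serve-contract-transition =
      contractAll σ₁ σ₂ ([] ▸ x₁ ∶ ! A ⊗ ! A) Γ (twoServers σ₁ σ₂ Γ x₁ x₂ x′ A D) ,
      step v₀ (contractAll-valid σ₁ σ₂ _ Γ servers-valid ≋-refl Γ₁₂-↭ q unique-Γ Γ-disjoint)
        (serve-contract σ₁ σ₂ g fn-disjoint (serve-context D v e)) ,
      frame-[] g (here refl)
        (λ i → ∈-resp-↭ (↭-sym ([]-↭ target-conc)) (∈-++⁺ˡ i)) out
      where
      target-conc : conc (contractAll σ₁ σ₂ ([] ▸ x₁ ∶ ! A ⊗ ! A) Γ (twoServers σ₁ σ₂ Γ x₁ x₂ x′ A D))
                    ≋ [ Γ ++ ([] ▸ x₁ ∶ ! A ⊗ ! A) ]
      target-conc = contractAll-conc σ₁ σ₂ _ Γ ≋-refl Γ₁₂-↭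
      fn-disjoint : Disjoint (fnᵀ (renᵀ σ₁ D)) (fnᵀ (renᵀ σ₂ D))
      fn-disjoint (i , j) with a , k , p ← image-fn σ₁-injective i | b , m , p′ ← image-fn σ₂-injective j =
        apart₁₂ k m (trans (sym p) p′)
      out : ∀ {w T} → (w , T) ∈ concat (conc (contractAll σ₁ σ₂ ([] ▸ x₁ ∶ ! A ⊗ ! A) Γ
              (twoServers σ₁ σ₂ Γ x₁ x₂ x′ A D))) → w ∉ x ∷ x₁ ∷ x₂ ∷ [] → (w , T) ∈ Γ
      out i w∉ with ∈-++⁻ Γ (∈-resp-↭ ([]-↭ target-conc) i)
      ... | inj₁ j           = j
      ... | inj₂ (here refl) = ⊥-elim (w∉ (there (here refl)))

  serve-transition : ∀ {n 𝒢 x ys x₁ x₂} {D : Tree n} → Valid (pre 𝒢 serve x ys D) →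
                     x₁ ≢ x₂ → x₁ ∉ fnᵀ D ∖ toList ys →
                     Transition (pre 𝒢 serve x ys D) ⌊ act serve-contract x (x₁ ∷ x₂ ∷ []) ⌋
  serve-transition v₀@(valid _ (R! v q e g)) = serve-contract-transition v₀ v q e g

  case-transitionₗ : ∀ {n 𝒢 x} {D E : Tree n} → Valid (case 𝒢 x D E) →
                     Transition (case 𝒢 x D E) ⌊ act offₗ x [] ⌋
  case-transitionₗ v₀@(valid _ (R& {D = D} v w e f g)) = D , step v₀ v caseₗ ,
    frame-[] g (here refl) (λ i → ∈-resp-↭ (↭-sym ([]-↭ e)) (there i))
      λ i w∉ → Any.tail (λ { refl → w∉ (here refl) }) (∈-resp-↭ ([]-↭ e) i)

  case-transitionᵣ : ∀ {n 𝒢 x} {D E : Tree n} → Valid (case 𝒢 x D E) →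
                     Transition (case 𝒢 x D E) ⌊ act offᵣ x [] ⌋
  case-transitionᵣ v₀@(valid _ (R& {E = E} v w e f g)) = E , step v₀ w caseᵣ ,
    frame-[] g (here refl) (λ i → ∈-resp-↭ (↭-sym ([]-↭ f)) (there i))
      λ i w∉ → Any.tail (λ { refl → w∉ (here refl) }) (∈-resp-↭ ([]-↭ f) i)

  all-transition : ∀ {n 𝒢 x D} (A : Ty n) → Valid (all 𝒢 x D) →
                   Transition (all 𝒢 x D) ⌊ act (recv-ty A) x [] ⌋
  all-transition A v₀@(valid _ (R∀ {Γ = Γ} {x} {B} {D} v e g)) =
    subᵀ (inst A) D , step v₀ (subᵀ-valid (inst A) v) all ,
    frame-[] g (here refl) (λ i → ∈-resp-↭ (↭-sym ([]-↭ e′)) (there i))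
      λ i w∉ → Any.tail (λ { refl → w∉ (here refl) }) (∈-resp-↭ ([]-↭ e′) i)
    where
    e′ : conc (subᵀ (inst A) D) ≋ [ Γ ▸ x ∶ B ⟦ A ⟧ ]
    e′ = ≋-trans (subᵀ-premise (inst A) {D} e)
           (≡⇒≋ (cong (λ Γ → [ Γ ▸ x ∶ B ⟦ A ⟧ ]) (inst-wkᴱ A Γ)))

  can⇒transition : ∀ {n k} {f : Form n k} {x ys} (D : Tree n) → Valid D → Can f x ys (proc D) →
                   Transition D ⌊ act f x ys ⌋
  can⇒transition (pre _ _ _ _ D) v (prefix u d)         = rebound-transition v u d
  can⇒transition (pre _ _ _ _ D) v serve-weaken         = serve-weaken-transition v
  can⇒transition (pre _ _ _ _ D) v (serve-contract p q) = serve-transition v p q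
  can⇒transition (case _ _ _ _)  v offₗ                 = case-transitionₗ v
  can⇒transition (case _ _ _ _)  v offᵣ                 = case-transitionᵣ v
  can⇒transition (all _ _ _)     v all                  = all-transition _ v
  can⇒transition (par _ D E) v@(valid _ (Mix w _ _)) (parₗ c d) =
    transition-parₗ v (λ { (here refl) → can-fn c }) d (can⇒transition D w c)
  can⇒transition (par _ D E) v@(valid _ (Mix _ w _)) (parᵣ c d) =
    transition-parᵣ v (λ { (here refl) → can-fn c }) d (can⇒transition E w c)
  can⇒transition (ν _ _ _ D) v@(valid _ (Cut w _ _)) (ν c x∉ y∉) =
    transition-ν v x∉ y∉ (can⇒transition D w c)
  can⇒transition nil          v ()
  can⇒transition (link _ _ _) v ()

  -- Performing two actions at once

  disjoint-++ : ∀ {xs ys zs : List Name} → Disjoint xs zs → Disjoint ys zs → Disjoint (xs ++ ys) zs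
  disjoint-++ {xs} d d′ (i , j) with ∈-++⁻ xs i
  ... | inj₁ k = d (k , j)
  ... | inj₂ k = d′ (k , j)

  ∉-pair : ∀ {z x₁ x₂} {ys₁ ys₂ : List Name} → z ∉ x₁ ∷ ys₁ → z ∉ x₂ ∷ ys₂ → z ∉ x₁ ∷ x₂ ∷ ys₁ ++ ys₂
  ∉-pair p q (here e)         = p (here e)
  ∉-pair p q (there (here e)) = q (here e)
  ∉-pair {ys₁ = ys₁} p q (there (there i)) with ∈-++⁻ ys₁ i
  ... | inj₁ j = p (there j)
  ... | inj₂ j = q (there j)

  can-pair⇒transition :
    ∀ {n k₁ k₂} {f₁ : Form n k₁} {f₂ : Form n k₂} {x₁ x₂ ys₁ ys₂} (D : Tree n) → Valid D →
    Can f₁ x₁ ys₁ (proc D) → Can f₂ x₂ ys₂ (proc D) → x₁ ≢ x₂ →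
    Disjoint (toList ys₁) (toList ys₂) → Transition D (act f₁ x₁ ys₁ ∥ act f₂ x₂ ys₂)
  can-pair⇒transition (pre _ _ _ _ _) v c₁ c₂ x≢ d = ⊥-elim (x≢ (trans (subject c₁) (sym (subject c₂))))
    where
    subject : ∀ {n k m} {f : Form n k} {p : Pre n m} {x y ys zs P} → Can f x ys (pre p y zs P) → x ≡ y
    subject (prefix _ _)         = refl
    subject serve-weaken         = refl
    subject (serve-contract _ _) = refl
  can-pair⇒transition (case _ _ _ _) v c₁ c₂ x≢ d = ⊥-elim (x≢ (trans (subject c₁) (sym (subject c₂))))
    where
    subject : ∀ {n k} {f : Form n k} {x y ys P Q} → Can f x ys (case y P Q) → x ≡ y
    subject offₗ = refl
    subject offᵣ = refl
  can-pair⇒transition (all _ _ _) v all all x≢ d = ⊥-elim (x≢ refl)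
  can-pair⇒transition nil v () _
  can-pair⇒transition (link _ _ _) v () _
  can-pair⇒transition (ν _ _ _ D) v@(valid _ (Cut w _ _)) (ν c₁ p₁ q₁) (ν c₂ p₂ q₂) x≢ d =
    transition-ν v (∉-pair p₁ p₂) (∉-pair q₁ q₂) (can-pair⇒transition D w c₁ c₂ x≢ d)
  can-pair⇒transition (par _ D E) v@(valid _ (Mix w _ _)) (parₗ c₁ d₁) (parₗ c₂ d₂) x≢ d =
    transition-parₗ v (λ { (here refl) → can-fn c₁ ; (there (here refl)) → can-fn c₂ })
      (disjoint-++ d₁ d₂) (can-pair⇒transition D w c₁ c₂ x≢ d)
  can-pair⇒transition (par _ D E) v@(valid _ (Mix _ w _)) (parᵣ c₁ d₁) (parᵣ c₂ d₂) x≢ d =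
    transition-parᵣ v (λ { (here refl) → can-fn c₁ ; (there (here refl)) → can-fn c₂ })
      (disjoint-++ d₁ d₂) (can-pair⇒transition E w c₁ c₂ x≢ d)
  can-pair⇒transition (par _ D E) v@(valid _ (Mix w w′ _)) (parₗ c₁ d₁) (parᵣ c₂ d₂) x≢ d =
    transition-syn v (λ { (here refl) → can-fn c₁ }) (λ { (here refl) → can-fn c₂ }) d₁ d₂ d
      (can⇒transition D w c₁) (can⇒transition E w′ c₂)
  -- `Syn` lists the action of the left component first, so the pair is formed in the opposite order
  -- and then flipped.
  can-pair⇒transition (par _ D E) v@(valid _ (Mix w w′ _)) (parᵣ c₁ d₁) (parₗ c₂ d₂) x≢ d =
    transition-flip (transition-syn v (λ { (here refl) → can-fn c₂ }) (λ { (here refl) → can-fn c₁ }) d₂ d₁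
      (λ (i , j) → d (j , i)) (can⇒transition D w c₂) (can⇒transition E w′ c₁))

  -- Combining the two given transitions

  disjoint? : ∀ xs ys → Dec (Disjoint xs ys)
  disjoint? xs ys = map′ (λ h (i , j) → All.lookup h i j)
    (λ d → All.tabulate λ i j → d (i , j)) (All.all? (λ x → ¬? (x ∈? ys)) xs)

  avoids-⊆ : ∀ {n L L′} (P : Proc n) → (∀ {w} → w ∈ L′ → w ∈ L) → Avoids L P → Avoids L′ P
  avoids-⊆ (ν x y P) h (x∉ , y∉ , a) = x∉ ∘ h , y∉ ∘ h , avoids-⊆ P h a
  avoids-⊆ (P ∥ Q) h (a , b)         = avoids-⊆ P h a , avoids-⊆ Q h b
  avoids-⊆ (pre _ _ _ _) _ _ = tt
  avoids-⊆ (case _ _ _) _ _  = tt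
  avoids-⊆ (all _ _) _ _     = tt
  avoids-⊆ nil _ _           = tt
  avoids-⊆ (link _ _) _ _    = tt

  -- Renaming relates `D` to its variant, but reading actions off the variant needs the equivalence
  -- in the other direction; this is where symmetry enters.
  step⇒can-renamed : ∀ {n k} {f : Form n k} {x ys D D₁ D′ L} → D ─[ ⌊ act f x ys ⌋ ]→ D₁ →
                     Renamed (λ y → y) D D′ → Avoids L (proc D′) →
                     (∀ {w} → w ∈ x ∷ toList ys → w ∈ L) → Can f x ys (proc D′)
  step⇒can-renamed {D = D} {D′ = D′} s r a h =
    step⇒can {ρ = []} s
      (≈-sym converse (valid⇒proper D v) (valid⇒proper D′ (renamed-valid r v (id-injective _)))
        (renamed-≈ r λ _ → free))
      free (λ ()) (avoids-⊆ (proc D′) h a)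
    where
    v = _─[_]→_.source-valid s
    converse : Converse [] []
    converse free = free

  non-interference :
    ∀ {n} (D : Tree n) → Valid D → ∀ (l₁ l₂ : Act n) → Disjoint (fnᵃ l₁) (fnᵃ l₂) →
    (∃[ D₁ ] (D ─[ ⌊ l₁ ⌋ ]→ D₁)) → (∃[ D₂ ] (D ─[ ⌊ l₂ ⌋ ]→ D₂)) →
    ∃[ l₂′ ] (l₂ ≅ l₂′) × (Disjoint (bnᵃ l₁) (bnᵃ l₂) → l₂′ ≡ l₂) ×
      (∃[ D′ ] (D ─[ l₁ ∥ l₂′ ]→ D′))
  non-interference {n} D v l₁@(act f₁ x₁ ys₁) l₂@(act {k} f₂ x₂ ys₂) d (_ , s₁) (_ , s₂) =
    go (disjoint? (toList ys₁) (toList ys₂))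
    where
    x₁≢x₂ : x₁ ≢ x₂
    x₁≢x₂ e = d (here refl , here e)

    zs : Vec Name k
    zs = freshes k (toList ys₁ ++ fnᵀ D)

    L : List Name
    -- The replacement names `zs` are included from the start, so that one variant `D°` serves both
    -- when the bound names clash and when they do not.
    L = toList zs ++ (x₁ ∷ toList ys₁) ++ (x₂ ∷ toList ys₂)

    D° : Tree n
    D° = proj₁ (freshen (λ y → y) L D)
    r : Renamed (λ y → y) D D°
    r = proj₁ (proj₂ (freshen (λ y → y) L D))
    a : Avoids L (proc D°)
    a = proj₂ (proj₂ (freshen (λ y → y) L D))
    v° : Valid D°
    v° = renamed-valid r v (id-injective _)

    can₁ : Can f₁ x₁ ys₁ (proc D°)
    can₁ = step⇒can-renamed s₁ r a λ i → ∈-++⁺ʳ (toList zs) (∈-++⁺ˡ i)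
    can₂ : Can f₂ x₂ ys₂ (proc D°)
    can₂ = step⇒can-renamed s₂ r a λ i → ∈-++⁺ʳ (toList zs) (∈-++⁺ʳ (x₁ ∷ toList ys₁) i)

    pair : ∀ ys → Can f₂ x₂ ys (proc D°) → Disjoint (toList ys₁) (toList ys) →
           ∃[ D′ ] (D ─[ l₁ ∥ act f₂ x₂ ys ]→ D′)
    pair ys c d
      -- The pair is performed in `D°` and transferred to `D` by `α`, which is possible because the
      -- identity renaming preserves the conclusion.
      with D′ , s , _ ← transition-α v (renamed-≈ r λ _ → free)
             (sym (trans (renamed-conc r) (renᴱ-id (conc D))))
             (can-pair⇒transition D° v° can₁ c x₁≢x₂ d) = D′ , s

    go : Dec (Disjoint (toList ys₁) (toList ys₂)) →
         ∃[ l₂′ ] (l₂ ≅ l₂′) × (Disjoint (bnᵃ l₁) (bnᵃ l₂) → l₂′ ≡ l₂) ×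
           (∃[ D′ ] (D ─[ l₁ ∥ l₂′ ]→ D′))
    go (yes dis) = l₂ , rebind , (λ _ → refl) , pair ys₂ can₂ dis
    go (no ¬dis) = act f₂ x₂ zs , rebind , (λ dis → ⊥-elim (¬dis dis)) ,
      pair zs can₂′ λ (i , j) → freshes-disjoint k _ (j , ∈-++⁺ˡ i)
      where
      can₂′ : Can f₂ x₂ zs (proc D°)
      can₂′ = can-rebind can₂ (freshes-unique k _)
        (λ (i , j) → freshes-disjoint k _ (i , ∈-++⁺ʳ (toList ys₁) (fn-D° j)))
        (avoids-⊆ (proc D°) ∈-++⁺ˡ a)
        where
        fn-D° : ∀ {w} → w ∈ fnᵀ D° → w ∈ fnᵀ D
        fn-D° i = names⊆fn D v (subst (_ ∈_)
          (cong names (trans (renamed-conc r) (renᴱ-id (conc D)))) (fn⊆names D° v° i))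

theorem4p19 : (𝒩 : NameSet) → let open πLL 𝒩 in
    ∀ {n} (D : Tree n) → Valid D →
    ∀ (l₁ l₂ : Act n) → Disjoint (fnᵃ l₁) (fnᵃ l₂) →
    (∃[ D₁ ] (D ─[ ⌊ l₁ ⌋ ]→ D₁)) →
    (∃[ D₂ ] (D ─[ ⌊ l₂ ⌋ ]→ D₂)) →
    ∃[ l₂′ ] (l₂ ≅ l₂′) × (Disjoint (bnᵃ l₁) (bnᵃ l₂) → l₂′ ≡ l₂) ×
    (∃[ D′ ] (D ─[ l₁ ∥ l₂′ ]→ D′))
theorem4p19 = NonInterference.non-interference
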